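{- Let $s > 3/2$ be real. For $1/3 \le A \le 1$ define \[ L(A;s) = \sum_{\substack{i,j,k\in\mathbb{Z}\\ (i,j,k)\neq(0,0,0)}} \left(\frac{A+1}{A(i+j)^2+(j+k)^2+(i+k)^2}\right)^s . \] Then \[ \frac{\partial}{\partial A} L(A;s)\Big|_{A=1/2} = 0 \qquad\text{and}\qquad \frac{\partial^2}{\partial A^2} L(A;s)\Big|_{A=1/2} > 0 . \]
   Context: The function $L(A;s)$ is the Epstein zeta function of the normalised cuboidal lattice. For $u,v>0$ with $A=u^2/v^2$, the cuboidal lattice is generated by $(u,v,0)$, $(u,0,v)$, $(0,v,v)$. For $1/3\le A\le 1$ it is scaled so that its minimum nonzero squared norm is $1$, i.e. $v = 1/\sqrt{A+1}$. Its quadratic form is then $g(A;i,j,k) = \frac{1}{A+1}\bigl(A(i+j)^2+(j+k)^2+(i+k)^2\bigr)$, and the series defining $L(A;s)$ converges for $s>3/2$. The value $A=1/2$ corresponds to the body-centred cubic lattice, and $A=1$ to the face-centred cubic lattice. -}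

module Defs where

open import Data.Integer as ℤ using (ℤ; +_; 0ℤ; 1ℤ)
import Data.Integer.Properties as ℤ
open import Data.List.Base using (List; foldr)
open import Data.List.Relation.Binary.Subset.Propositional using (_⊆_)
open import Data.List.Relation.Unary.Unique.Propositional using (Unique)
open import Data.Nat.Base as ℕ using (ℕ; zero; suc)
import Data.Nat.Properties as ℕ
open import Data.Product.Base using (Σ-syntax; ∃-syntax; _×_; _,_; proj₁; proj₂)
open import Data.Rational as ℚ using (ℚ; 0ℚ; 1ℚ; ½)
import Data.Rational.Properties as ℚ
import Data.Rational.Unnormalised.Base as ℚᵘ
import Data.Rational.Unnormalised.Properties as ℚᵘ
open import Data.Sum.Base using (inj₁; inj₂)
open import Function.Base using (_$_)
open import Relation.Binary.PropositionalEquality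
  using (_≡_; _≢_; refl; sym; trans; cong; cong₂; subst; subst₂)
open import Relation.Nullary.Decidable.Core using (yes; no; from-yes)
open import Relation.Nullary.Negation.Core using (¬_; contradiction)
open import Relation.Nullary.Recomputable using (¬-recompute)

module ℚ-Lemmas where

  open import Data.Rational using (_+_; _*_; _-_; -_; ∣_∣; _≤_; _<_)
  open import Data.Rational.Solver
  open +-*-Solver
  open import Data.Rational.Properties using (module ≤-Reasoning)
  open ≤-Reasoning

  ⅓ ⅙ : ℚ
  ⅓ = + 1 ℚ./ 3
  ⅙ = + 1 ℚ./ 6

  -- In the product lemmas a nonnegative factor is passed as an inequality
  -- rather than as an instance.
  *-monoˡ : ∀ {r p q} → 0ℚ ≤ r → p ≤ q → r * p ≤ r * q
  *-monoˡ {r} 0≤r p≤q = ℚ.*-monoˡ-≤-nonNeg r {{ℚ.nonNegative 0≤r}} p≤q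

  *-monoʳ : ∀ {r p q} → 0ℚ ≤ r → p ≤ q → p * r ≤ q * r
  *-monoʳ {r} 0≤r p≤q = ℚ.*-monoʳ-≤-nonNeg r {{ℚ.nonNegative 0≤r}} p≤q

  *-mono : ∀ {p q r s} → 0ℚ ≤ p → 0ℚ ≤ s → p ≤ q → r ≤ s → p * r ≤ q * s
  *-mono 0≤p 0≤s p≤q r≤s = ℚ.≤-trans (*-monoˡ 0≤p r≤s) (*-monoʳ 0≤s p≤q)

  *-cancelˡ : ∀ {r p q} → 0ℚ < r → r * p ≤ r * q → p ≤ q
  *-cancelˡ {r} 0<r = ℚ.*-cancelˡ-≤-pos r {{ℚ.positive 0<r}}

  0≤* : ∀ {p q} → 0ℚ ≤ p → 0ℚ ≤ q → 0ℚ ≤ p * q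
  0≤* {p} {q} 0≤p 0≤q =
    ℚ.nonNegative⁻¹ _ {{ℚ.nonNeg*nonNeg⇒nonNeg p {{ℚ.nonNegative 0≤p}} q {{ℚ.nonNegative 0≤q}}}}

  0<* : ∀ {p q} → 0ℚ < p → 0ℚ < q → 0ℚ < p * q
  0<* {p} {q} 0<p 0<q =
    ℚ.positive⁻¹ _ {{ℚ.pos*pos⇒pos p {{ℚ.positive 0<p}} q {{ℚ.positive 0<q}}}}

  0<+ : ∀ {p q} → 0ℚ < p → 0ℚ ≤ q → 0ℚ < p + q
  0<+ 0<p 0≤q = ℚ.+-mono-<-≤ 0<p 0≤q

  0≤1 : 0ℚ ≤ 1ℚ
  0≤1 = from-yes (0ℚ ℚ.≤? 1ℚ)

  0<1 : 0ℚ < 1ℚ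
  0<1 = from-yes (0ℚ ℚ.<? 1ℚ)

  0<½ : 0ℚ < ½
  0<½ = from-yes (0ℚ ℚ.<? ½)

  0<⅓ : 0ℚ < ⅓
  0<⅓ = from-yes (0ℚ ℚ.<? ⅓)

  0<⅙ : 0ℚ < ⅙
  0<⅙ = from-yes (0ℚ ℚ.<? ⅙)

  halves : ∀ ε → ½ * ε + ½ * ε ≡ ε
  halves = solve 1 (λ ε → con ½ :* ε :+ con ½ :* ε := ε) refl

  thirds : ∀ ε → ⅓ * ε + ⅓ * ε + ⅓ * ε ≡ ε
  thirds = solve 1 (λ ε → con ⅓ :* ε :+ con ⅓ :* ε :+ con ⅓ :* ε := ε) refl

  p≤∣p∣ : ∀ p → p ≤ ∣ p ∣
  p≤∣p∣ p with ℚ.≤-total 0ℚ p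
  ... | inj₁ 0≤p = ℚ.≤-reflexive (sym (ℚ.0≤p⇒∣p∣≡p 0≤p))
  ... | inj₂ p≤0 = ℚ.≤-trans p≤0 (ℚ.0≤∣p∣ p)

  ∣p∣≤ : ∀ {p q} → p ≤ q → - p ≤ q → ∣ p ∣ ≤ q
  ∣p∣≤ {p} p≤q -p≤q with ℚ.∣p∣≡p∨∣p∣≡-p p
  ... | inj₁ e = subst (_≤ _) (sym e) p≤q
  ... | inj₂ e = subst (_≤ _) (sym e) -p≤q

  ∣∣-sym : ∀ p q → ∣ p - q ∣ ≡ ∣ q - p ∣
  ∣∣-sym p q = trans (sym (ℚ.∣-p∣≡∣p∣ (p - q)))
    (cong ∣_∣ (solve 2 (λ p q → :- (p :- q) := q :- p) refl p q))

  ∣p∣≤∣q∣+∣p-q∣ : ∀ p q → ∣ p ∣ ≤ ∣ q ∣ + ∣ p - q ∣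
  ∣p∣≤∣q∣+∣p-q∣ p q = subst (λ t → ∣ t ∣ ≤ ∣ q ∣ + ∣ p - q ∣)
    (solve 2 (λ p q → q :+ (p :- q) := p) refl p q) (ℚ.∣p+q∣≤∣p∣+∣q∣ q (p - q))

  ∣∣p∣-∣q∣∣≤∣p-q∣ : ∀ p q → ∣ ∣ p ∣ - ∣ q ∣ ∣ ≤ ∣ p - q ∣
  ∣∣p∣-∣q∣∣≤∣p-q∣ p q = ∣p∣≤ (move (∣p∣≤∣q∣+∣p-q∣ p q))
    (subst₂ _≤_ (solve 2 (λ a b → b :- a := :- (a :- b)) refl ∣ p ∣ ∣ q ∣)
                (∣∣-sym q p) (move (∣p∣≤∣q∣+∣p-q∣ q p)))
    where
    move : ∀ {a b c} → a ≤ b + c → a - b ≤ c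
    move {a} {b} {c} h = subst (a - b ≤_)
      (solve 2 (λ b c → b :+ c :- b := c) refl b c) (ℚ.+-monoˡ-≤ (- b) h)

  recip : ∀ p → 0ℚ < p → ℚ
  recip p 0<p = (ℚ.1/ p) {{ℚ.>-nonZero 0<p}}

  recip-pos : ∀ p 0<p → 0ℚ < recip p 0<p
  recip-pos p 0<p = ℚ.positive⁻¹ _ {{ℚ.1/pos⇒pos p {{ℚ.positive 0<p}}}}

  *-recip : ∀ p 0<p → p * recip p 0<p ≡ 1ℚ
  *-recip p 0<p = ℚ.*-inverseʳ p {{ℚ.>-nonZero 0<p}}

  fromℤ : ℤ → ℚ
  fromℤ m = m ℚ./ 1

  fromℤ-toℚᵘ : ∀ m → ℚ.toℚᵘ (fromℤ m) ℚᵘ.≃ ℚᵘ.mkℚᵘ m 0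
  fromℤ-toℚᵘ m = ℚ.toℚᵘ-fromℚᵘ (ℚᵘ.mkℚᵘ m 0)

  fromℕ : ℕ → ℚ
  fromℕ n = fromℤ (+ n)

  fromℕ-mono : ∀ {m n} → m ℕ.≤ n → fromℕ m ≤ fromℕ n
  fromℕ-mono {m} {n} m≤n = ℚ.toℚᵘ-cancel-≤ $
    ℚᵘ.≤-respʳ-≃ (ℚᵘ.≃-sym (fromℤ-toℚᵘ (+ n))) $
    ℚᵘ.≤-respˡ-≃ (ℚᵘ.≃-sym (fromℤ-toℚᵘ (+ m))) $
    ℚᵘ.*≤* (ℤ.*-monoʳ-≤-nonNeg 1ℤ (ℤ.+≤+ m≤n))

  0≤fromℕ : ∀ n → 0ℚ ≤ fromℕ n
  0≤fromℕ n = fromℕ-mono {0} {n} ℕ.z≤n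

  1/suc : ℕ → ℚ
  1/suc n = 1ℤ ℚ./ suc n

  1/suc-pos : ∀ n → 0ℚ < 1/suc n
  1/suc-pos n = ℚ.positive⁻¹ _ {{ℚ.normalize-pos 1 (suc n)}}

  fromℕ-*-1/suc : ∀ n → fromℕ (suc n) * 1/suc n ≡ 1ℚ
  fromℕ-*-1/suc n = ℚ.toℚᵘ-injective $
    ℚᵘ.≃-trans (ℚ.toℚᵘ-homo-* (fromℕ (suc n)) (1/suc n)) $
    ℚᵘ.≃-trans (ℚᵘ.*-cong (fromℤ-toℚᵘ (+ suc n)) (ℚ.toℚᵘ-fromℚᵘ (ℚᵘ.mkℚᵘ 1ℤ n))) $
    ℚᵘ.*≡* (trans (ℤ.*-identityʳ _) (trans (ℤ.*-identityʳ _)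
      (sym (trans (ℤ.*-identityˡ _) (cong +_ (ℕ.*-identityˡ (suc n)))))))

  1/suc≤1 : ∀ n → 1/suc n ≤ 1ℚ
  1/suc≤1 n = begin
    1/suc n                     ≡⟨ sym (ℚ.*-identityˡ _) ⟩
    1ℚ * 1/suc n                ≤⟨ *-monoʳ (ℚ.<⇒≤ (1/suc-pos n)) (fromℕ-mono {1} {suc n} (ℕ.s≤s ℕ.z≤n)) ⟩
    fromℕ (suc n) * 1/suc n     ≡⟨ fromℕ-*-1/suc n ⟩
    1ℚ                          ∎

  ≤fromℕ : ∀ p → ∃[ n ] p ≤ fromℕ n
  ≤fromℕ p@(ℚ.mkℚ a d _) = ℤ.∣ a ∣ , ℚ.≤-trans (p≤∣p∣ p) (ℚ.toℚᵘ-cancel-≤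
    (ℚᵘ.≤-respʳ-≃ (ℚᵘ.≃-sym (fromℤ-toℚᵘ (+ ℤ.∣ a ∣)))
      (ℚᵘ.*≤* (ℤ.*-monoˡ-≤-nonNeg (+ ℤ.∣ a ∣) (ℤ.+≤+ (ℕ.s≤s ℕ.z≤n))))))

  archimedean : ∀ p {q} → 0ℚ < q → ∃[ n ] p ≤ q * fromℕ n
  archimedean p {q} 0<q with ≤fromℕ (p * recip q 0<q)
  ... | n , h = n , (begin
    p                       ≡⟨ sym (ℚ.*-identityʳ p) ⟩
    p * 1ℚ                  ≡⟨ cong (p *_) (sym (*-recip q 0<q)) ⟩
    p * (q * recip q 0<q)   ≡⟨ solve 3 (λ p q r → p :* (q :* r) := q :* (p :* r)) refl p q (recip q 0<q) ⟩
    q * (p * recip q 0<q)   ≤⟨ *-monoˡ (ℚ.<⇒≤ 0<q) h ⟩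
    q * fromℕ n             ∎)

  0≤p*p : ∀ p → 0ℚ ≤ p * p
  0≤p*p p with ℚ.≤-total 0ℚ p
  ... | inj₁ 0≤p = 0≤* 0≤p 0≤p
  ... | inj₂ p≤0 = ℚ.nonNegative⁻¹ _
    {{ℚ.nonPos*nonPos⇒nonPos p {{ℚ.nonPositive p≤0}} p {{ℚ.nonPositive p≤0}}}}

  1≤m*m : ∀ m → m ≢ 0ℤ → 1ℚ ≤ fromℤ m * fromℤ m
  1≤m*m m m≢0 = ℚ.toℚᵘ-cancel-≤ $
    ℚᵘ.≤-respʳ-≃ (ℚᵘ.≃-sym (ℚᵘ.≃-trans (ℚ.toℚᵘ-homo-* (fromℤ m) (fromℤ m))
                                       (ℚᵘ.*-cong (fromℤ-toℚᵘ m) (fromℤ-toℚᵘ m)))) $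
    ℚᵘ.*≤* (1≤ m m≢0)
    where
    1≤ : ∀ m → m ≢ 0ℤ → 1ℤ ℤ.* 1ℤ ℤ.≤ m ℤ.* m ℤ.* 1ℤ
    1≤ (+ zero)    m≢0 = contradiction refl m≢0
    1≤ (+ suc n)   _   = ℤ.+≤+ (ℕ.s≤s ℕ.z≤n)
    1≤ ℤ.-[1+ n ]  _   = ℤ.+≤+ (ℕ.s≤s ℕ.z≤n)

  infixr 8 _^_
  _^_ : ℚ → ℕ → ℚ
  p ^ zero  = 1ℚ
  p ^ suc n = p * p ^ n

  0≤^ : ∀ {p} → 0ℚ ≤ p → ∀ n → 0ℚ ≤ p ^ n
  0≤^ 0≤p zero    = 0≤1
  0≤^ 0≤p (suc n) = 0≤* 0≤p (0≤^ 0≤p n)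

  ^-mono : ∀ {p q} → 0ℚ ≤ p → p ≤ q → ∀ n → p ^ n ≤ q ^ n
  ^-mono 0≤p p≤q zero    = ℚ.≤-refl
  ^-mono 0≤p p≤q (suc n) = *-mono 0≤p (0≤^ (ℚ.≤-trans 0≤p p≤q) n) p≤q (^-mono 0≤p p≤q n)

  ∣^∣ : ∀ p n → ∣ p ^ n ∣ ≡ ∣ p ∣ ^ n
  ∣^∣ p zero    = refl
  ∣^∣ p (suc n) = trans (ℚ.∣p*q∣≡∣p∣*∣q∣ p (p ^ n)) (cong (∣ p ∣ *_) (∣^∣ p n))

  fromℕ-suc : ∀ n → fromℕ (suc n) ≡ 1ℚ + fromℕ n
  fromℕ-suc n = ℚ.toℚᵘ-injective $
    ℚᵘ.≃-trans (fromℤ-toℚᵘ (+ suc n)) $ ℚᵘ.≃-sym $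
    ℚᵘ.≃-trans (ℚ.toℚᵘ-homo-+ 1ℚ (fromℕ n)) $
    ℚᵘ.≃-trans (ℚᵘ.+-congʳ (ℚ.toℚᵘ 1ℚ) (fromℤ-toℚᵘ (+ n))) $
    ℚᵘ.*≡* (cong (λ t → (1ℤ ℤ.+ t) ℤ.* 1ℤ) (ℤ.*-identityʳ (+ n)))

  -- Bernoulli's inequality for r = 1 - h.
  geometric-decay : ∀ {r} → 0ℚ ≤ r → ∀ n → r ^ n * (1ℚ + fromℕ n * (1ℚ - r)) ≤ 1ℚ
  geometric-decay {r} 0≤r zero = ℚ.≤-reflexive
    (solve 1 (λ r → con 1ℚ :* (con 1ℚ :+ con 0ℚ :* (con 1ℚ :- r)) := con 1ℚ) refl r)
  geometric-decay {r} 0≤r (suc n) = begin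
    r ^ suc n * (1ℚ + fromℕ (suc n) * (1ℚ - r))
      ≡⟨ cong (λ t → r ^ suc n * (1ℚ + t * (1ℚ - r))) (fromℕ-suc n) ⟩
    r * r ^ n * (1ℚ + (1ℚ + fromℕ n) * (1ℚ - r))
      ≡⟨ solve 3 (λ r a m →
           r :* a :* (con 1ℚ :+ (con 1ℚ :+ m) :* (con 1ℚ :- r))
           := a :* (con 1ℚ :+ m :* (con 1ℚ :- r))
              :- a :* ((con 1ℚ :+ m) :* ((con 1ℚ :- r) :* (con 1ℚ :- r))))
           refl r (r ^ n) (fromℕ n) ⟩
    r ^ n * (1ℚ + fromℕ n * (1ℚ - r)) - r ^ n * ((1ℚ + fromℕ n) * ((1ℚ - r) * (1ℚ - r)))
      ≤⟨ ℚ.+-monoʳ-≤ (r ^ n * (1ℚ + fromℕ n * (1ℚ - r)))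
           (ℚ.neg-antimono-≤ (0≤* (0≤^ 0≤r n)
             (0≤* (ℚ.<⇒≤ (0<+ 0<1 (0≤fromℕ n))) (0≤p*p (1ℚ - r))))) ⟩
    r ^ n * (1ℚ + fromℕ n * (1ℚ - r)) + 0ℚ
      ≡⟨ ℚ.+-identityʳ _ ⟩
    r ^ n * (1ℚ + fromℕ n * (1ℚ - r))
      ≤⟨ geometric-decay 0≤r n ⟩
    1ℚ ∎

  module GeometricTail {S u : ℕ → ℚ} (step : ∀ n → S (suc n) ≡ S n + u n)
    {C r : ℚ} (0≤r : 0ℚ ≤ r) (r<1 : r < 1ℚ) (bound : ∀ n → ∣ u n ∣ ≤ C * r ^ n) where

    h : ℚ
    h = 1ℚ - r

    0<h : 0ℚ < h
    0<h = subst (_< h) (ℚ.+-inverseʳ r) (ℚ.+-monoˡ-< (- r) r<1)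

    0≤h : 0ℚ ≤ h
    0≤h = ℚ.<⇒≤ 0<h

    0≤C : 0ℚ ≤ C
    0≤C = subst (0ℚ ≤_) (ℚ.*-identityʳ C) (ℚ.≤-trans (ℚ.0≤∣p∣ (u 0)) (bound 0))

    telescope : ∀ i j → h * ∣ S (i ℕ.+ j) - S i ∣ ≤ C * (r ^ i - r ^ (i ℕ.+ j))
    telescope i zero rewrite ℕ.+-identityʳ i = ℚ.≤-reflexive (begin-equality
      h * ∣ S i - S i ∣     ≡⟨ cong (λ t → h * ∣ t ∣) (ℚ.+-inverseʳ (S i)) ⟩
      h * 0ℚ                ≡⟨ solve 3 (λ h c p → h :* con 0ℚ := c :* (p :- p)) refl h C (r ^ i) ⟩
      C * (r ^ i - r ^ i)   ∎)
    telescope i (suc j) rewrite ℕ.+-suc i j = begin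
      h * ∣ S (suc k) - S i ∣
        ≡⟨ cong (λ t → h * ∣ t - S i ∣) (step k) ⟩
      h * ∣ S k + u k - S i ∣
        ≡⟨ cong (λ t → h * ∣ t ∣)
             (solve 3 (λ s a t → s :+ a :- t := (s :- t) :+ a) refl (S k) (u k) (S i)) ⟩
      h * ∣ (S k - S i) + u k ∣
        ≤⟨ *-monoˡ 0≤h (ℚ.∣p+q∣≤∣p∣+∣q∣ (S k - S i) (u k)) ⟩
      h * (∣ S k - S i ∣ + ∣ u k ∣)
        ≡⟨ ℚ.*-distribˡ-+ h ∣ S k - S i ∣ ∣ u k ∣ ⟩
      h * ∣ S k - S i ∣ + h * ∣ u k ∣
        ≤⟨ ℚ.+-mono-≤ (telescope i j) (*-monoˡ 0≤h (bound k)) ⟩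
      C * (r ^ i - r ^ k) + h * (C * r ^ k)
        ≡⟨ solve 4 (λ c p q r → c :* (p :- q) :+ (con 1ℚ :- r) :* (c :* q) := c :* (p :- r :* q))
             refl C (r ^ i) (r ^ k) r ⟩
      C * (r ^ i - r * r ^ k) ∎
      where
      k = i ℕ.+ j

    tail-bound : ∀ i j → h * ∣ S (i ℕ.+ j) - S i ∣ ≤ C * r ^ i
    tail-bound i j = begin
      h * ∣ S (i ℕ.+ j) - S i ∣          ≤⟨ telescope i j ⟩
      C * (r ^ i - r ^ (i ℕ.+ j))        ≤⟨ *-monoˡ 0≤C (ℚ.+-monoʳ-≤ (r ^ i)
                                              (ℚ.neg-antimono-≤ (0≤^ 0≤r (i ℕ.+ j)))) ⟩
      C * (r ^ i + 0ℚ)                   ≡⟨ cong (C *_) (ℚ.+-identityʳ (r ^ i)) ⟩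
      C * r ^ i                          ∎

    small : ∀ {ε} i → 0ℚ < ε → C ≤ ε * (h * h) * fromℕ i → 0ℚ < fromℕ i →
            ∀ j → ∣ S (i ℕ.+ j) - S i ∣ ≤ ε
    small {ε} i 0<ε C≤ 0<i j = *-cancelˡ (0<* 0<i (0<* 0<h 0<h)) (begin
      m * (h * h) * D
        ≡⟨ solve 3 (λ m h d → m :* (h :* h) :* d := m :* h :* (h :* d)) refl m h D ⟩
      m * h * (h * D)
        ≤⟨ *-monoˡ (0≤* 0≤m 0≤h) (tail-bound i j) ⟩
      m * h * (C * r ^ i)
        ≡⟨ solve 3 (λ x c p → x :* (c :* p) := c :* (x :* p)) refl (m * h) C (r ^ i) ⟩
      C * (m * h * r ^ i)
        ≤⟨ *-monoˡ 0≤C decay ⟩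
      C * 1ℚ
        ≡⟨ ℚ.*-identityʳ C ⟩
      C
        ≤⟨ C≤ ⟩
      ε * (h * h) * m
        ≡⟨ solve 3 (λ e h m → e :* h :* m := m :* h :* e) refl ε (h * h) m ⟩
      m * (h * h) * ε ∎)
      where
      m = fromℕ i
      D = ∣ S (i ℕ.+ j) - S i ∣
      0≤m : 0ℚ ≤ m
      0≤m = ℚ.<⇒≤ 0<i
      decay : m * h * r ^ i ≤ 1ℚ
      decay = begin
        m * h * r ^ i             ≡⟨ sym (ℚ.+-identityˡ _) ⟩
        0ℚ + m * h * r ^ i        ≤⟨ ℚ.+-monoˡ-≤ (m * h * r ^ i) (0≤^ 0≤r i) ⟩
        r ^ i + m * h * r ^ i     ≡⟨ solve 3 (λ p m h → p :+ m :* h :* p := p :* (con 1ℚ :+ m :* h))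
                                       refl (r ^ i) m h ⟩
        r ^ i * (1ℚ + m * h)      ≤⟨ geometric-decay 0≤r i ⟩
        1ℚ                        ∎

  tail-index : ∀ C r ε → r < 1ℚ → 0ℚ < ε →
    ∃[ i ] C ≤ ε * ((1ℚ - r) * (1ℚ - r)) * fromℕ i × 0ℚ < fromℕ i
  tail-index C r ε r<1 0<ε = suc (proj₁ i) , enlarge , 0<m
    where
    0<h : 0ℚ < 1ℚ - r
    0<h = subst (_< 1ℚ - r) (ℚ.+-inverseʳ r) (ℚ.+-monoˡ-< (- r) r<1)
    i = archimedean C (0<* 0<ε (0<* 0<h 0<h))
    0<m : 0ℚ < fromℕ (suc (proj₁ i))
    0<m = ℚ.<-≤-trans 0<1 (fromℕ-mono {1} {suc (proj₁ i)} (ℕ.s≤s ℕ.z≤n))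
    enlarge : C ≤ ε * ((1ℚ - r) * (1ℚ - r)) * fromℕ (suc (proj₁ i))
    enlarge = ℚ.≤-trans (proj₂ i) (*-monoˡ (ℚ.<⇒≤ (0<* 0<ε (0<* 0<h 0<h)))
      (fromℕ-mono {proj₁ i} {suc (proj₁ i)} (ℕ.n≤1+n (proj₁ i))))

Eventually : (ℕ → Set) → Set
Eventually P = ∃[ N ] (∀ n → N ℕ.≤ n → P n)

both : ∀ {P Q} → Eventually P → Eventually Q → Eventually (λ n → P n × Q n)
both (M , p) (N , q) = M ℕ.⊔ N , λ n h →
  p n (ℕ.≤-trans (ℕ.m≤m⊔n M N) h) , q n (ℕ.≤-trans (ℕ.m≤n⊔m M N) h)

IsCauchy : (ℕ → ℚ) → Set
IsCauchy u = ∀ ε → 0ℚ ℚ.< ε →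
  ∃[ N ] (∀ m n → N ℕ.≤ m → N ℕ.≤ n → ℚ.∣ u m ℚ.- u n ∣ ℚ.≤ ε)

module Cauchy where

  open import Data.Rational using (_+_; _*_; _-_; -_; ∣_∣; _≤_; _<_; _⊔_)
  open import Data.Rational.Solver
  open +-*-Solver
  open import Data.Rational.Properties using (module ≤-Reasoning)
  open ≤-Reasoning
  open ℚ-Lemmas

  const-cauchy : ∀ p → IsCauchy (λ _ → p)
  const-cauchy p ε 0<ε = 0 , λ _ _ _ _ →
    ℚ.≤-trans (ℚ.≤-reflexive (cong ∣_∣ (ℚ.+-inverseʳ p))) (ℚ.<⇒≤ 0<ε)

  sum-close : ∀ {ε} a b c d → ∣ a - c ∣ ≤ ½ * ε → ∣ b - d ∣ ≤ ½ * ε → ∣ a + b - (c + d) ∣ ≤ ε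
  sum-close {ε} a b c d ac bd = begin
    ∣ a + b - (c + d) ∣
      ≡⟨ cong ∣_∣ (solve 4 (λ a b c d → a :+ b :- (c :+ d) := (a :- c) :+ (b :- d)) refl a b c d) ⟩
    ∣ (a - c) + (b - d) ∣      ≤⟨ ℚ.∣p+q∣≤∣p∣+∣q∣ (a - c) (b - d) ⟩
    ∣ a - c ∣ + ∣ b - d ∣      ≤⟨ ℚ.+-mono-≤ ac bd ⟩
    ½ * ε + ½ * ε              ≡⟨ halves ε ⟩
    ε                          ∎

  +-cauchy : ∀ {u v} → IsCauchy u → IsCauchy v → IsCauchy (λ n → u n + v n)
  +-cauchy {u} {v} cu cv ε 0<ε = M ℕ.⊔ N , λ m n hm hn →
    sum-close (u m) (v m) (u n) (v n)
      (proj₂ p m n (ℕ.m⊔n≤o⇒m≤o M N hm) (ℕ.m⊔n≤o⇒m≤o M N hn))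
      (proj₂ q m n (ℕ.m⊔n≤o⇒n≤o M N hm) (ℕ.m⊔n≤o⇒n≤o M N hn))
    where
    p = cu (½ * ε) (0<* 0<½ 0<ε)
    q = cv (½ * ε) (0<* 0<½ 0<ε)
    M = proj₁ p
    N = proj₁ q

  neg-cauchy : ∀ {u} → IsCauchy u → IsCauchy (λ n → - u n)
  neg-cauchy {u} cu ε 0<ε with cu ε 0<ε
  ... | N , p = N , λ m n hm hn → subst (_≤ ε)
    (trans (∣∣-sym (u m) (u n))
           (cong ∣_∣ (solve 2 (λ a b → b :- a := :- a :- :- b) refl (u m) (u n))))
    (p m n hm hn)

  abs-cauchy : ∀ {u} → IsCauchy u → IsCauchy (λ n → ∣ u n ∣)
  abs-cauchy {u} cu ε 0<ε with cu ε 0<ε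
  ... | N , p = N , λ m n hm hn → ℚ.≤-trans (∣∣p∣-∣q∣∣≤∣p-q∣ (u m) (u n)) (p m n hm hn)

  bounded : ∀ {u} → IsCauchy u → ∃[ B ] 0ℚ < B × Eventually (λ n → ∣ u n ∣ ≤ B)
  bounded {u} cu with cu 1ℚ 0<1
  ... | N , p = 1ℚ + ∣ u N ∣ , 0<+ 0<1 (ℚ.0≤∣p∣ (u N)) , N , λ n h → begin
    ∣ u n ∣                    ≤⟨ ∣p∣≤∣q∣+∣p-q∣ (u n) (u N) ⟩
    ∣ u N ∣ + ∣ u n - u N ∣    ≤⟨ ℚ.+-monoʳ-≤ ∣ u N ∣ (p n N h ℕ.≤-refl) ⟩
    ∣ u N ∣ + 1ℚ               ≡⟨ ℚ.+-comm ∣ u N ∣ 1ℚ ⟩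
    1ℚ + ∣ u N ∣               ∎

  factor-close : ∀ {ε p q A} (0<A : 0ℚ < A) → ∣ p ∣ ≤ A → ∣ q ∣ ≤ ½ * ε * recip A 0<A →
                 ∣ p * q ∣ ≤ ½ * ε
  factor-close {ε} {p} {q} {A} 0<A hp hq = begin
    ∣ p * q ∣        ≡⟨ ℚ.∣p*q∣≡∣p∣*∣q∣ p q ⟩
    ∣ p ∣ * ∣ q ∣    ≤⟨ *-mono (ℚ.0≤∣p∣ p) (ℚ.≤-trans (ℚ.0≤∣p∣ q) hq) hp hq ⟩
    A * (½ * ε * recip A 0<A)
      ≡⟨ solve 3 (λ a e r → a :* (e :* r) := e :* (a :* r)) refl A (½ * ε) (recip A 0<A) ⟩
    ½ * ε * (A * recip A 0<A)
      ≡⟨ trans (cong (½ * ε *_) (*-recip A 0<A)) (ℚ.*-identityʳ (½ * ε)) ⟩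
    ½ * ε ∎

  product-close : ∀ {ε A B} a b c d (0<A : 0ℚ < A) (0<B : 0ℚ < B) → ∣ a ∣ ≤ A → ∣ d ∣ ≤ B →
    ∣ a - c ∣ ≤ ½ * ε * recip B 0<B → ∣ b - d ∣ ≤ ½ * ε * recip A 0<A →
    ∣ a * b - c * d ∣ ≤ ε
  product-close {ε} a b c d 0<A 0<B hA hB ac bd = begin
    ∣ a * b - c * d ∣
      ≡⟨ cong ∣_∣ (solve 4 (λ a b c d → a :* b :- c :* d := a :* (b :- d) :+ d :* (a :- c))
                    refl a b c d) ⟩
    ∣ a * (b - d) + d * (a - c) ∣
      ≤⟨ ℚ.∣p+q∣≤∣p∣+∣q∣ (a * (b - d)) (d * (a - c)) ⟩
    ∣ a * (b - d) ∣ + ∣ d * (a - c) ∣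
      ≤⟨ ℚ.+-mono-≤ (factor-close {ε} {a} {b - d} 0<A hA bd)
                    (factor-close {ε} {d} {a - c} 0<B hB ac) ⟩
    ½ * ε + ½ * ε              ≡⟨ halves ε ⟩
    ε                          ∎

  *-cauchy : ∀ {u v} → IsCauchy u → IsCauchy v → IsCauchy (λ n → u n * v n)
  *-cauchy {u} {v} cu cv ε 0<ε = M ℕ.⊔ N ℕ.⊔ L , λ m n hm hn →
    let hm′ = ℕ.m⊔n≤o⇒m≤o (M ℕ.⊔ N) L hm
        hn′ = ℕ.m⊔n≤o⇒m≤o (M ℕ.⊔ N) L hn
    in product-close (u m) (v m) (u n) (v n) 0<A 0<B
      (proj₁ (proj₂ bounds m (ℕ.m⊔n≤o⇒n≤o (M ℕ.⊔ N) L hm)))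
      (proj₂ (proj₂ bounds n (ℕ.m⊔n≤o⇒n≤o (M ℕ.⊔ N) L hn)))
      (proj₂ p m n (ℕ.m⊔n≤o⇒m≤o M N hm′) (ℕ.m⊔n≤o⇒m≤o M N hn′))
      (proj₂ q m n (ℕ.m⊔n≤o⇒n≤o M N hm′) (ℕ.m⊔n≤o⇒n≤o M N hn′))
    where
    boundedᵘ = bounded {u} cu
    boundedᵛ = bounded {v} cv
    A = proj₁ boundedᵘ
    B = proj₁ boundedᵛ
    0<A = proj₁ (proj₂ boundedᵘ)
    0<B = proj₁ (proj₂ boundedᵛ)
    bounds = both (proj₂ (proj₂ boundedᵘ)) (proj₂ (proj₂ boundedᵛ))
    p = cu (½ * ε * recip B 0<B) (0<* (0<* 0<½ 0<ε) (recip-pos B 0<B))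
    q = cv (½ * ε * recip A 0<A) (0<* (0<* 0<½ 0<ε) (recip-pos A 0<A))
    M = proj₁ p
    N = proj₁ q
    L = proj₁ bounds

  0<⊔ : ∀ {δ} p → 0ℚ < δ → 0ℚ < δ ⊔ p
  0<⊔ {δ} p 0<δ = ℚ.<-≤-trans 0<δ (ℚ.p≤p⊔q δ p)

  clamped-recip : ∀ δ → 0ℚ < δ → ℚ → ℚ
  clamped-recip δ 0<δ p = recip (δ ⊔ p) (0<⊔ p 0<δ)

  *-clamped-recip : ∀ {δ p} (0<δ : 0ℚ < δ) → δ ≤ p → p * clamped-recip δ 0<δ p ≡ 1ℚ
  *-clamped-recip {δ} {p} 0<δ δ≤p =
    trans (cong (_* clamped-recip δ 0<δ p) (sym (ℚ.p≤q⇒p⊔q≡q δ≤p)))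
          (*-recip (δ ⊔ p) (0<⊔ p 0<δ))

  recip-cauchy : ∀ {u δ} (0<δ : 0ℚ < δ) → Eventually (λ n → δ ≤ u n) →
                 IsCauchy u → IsCauchy (λ n → clamped-recip δ 0<δ (u n))
  recip-cauchy {u} {δ} 0<δ (M , δ≤u) cu ε 0<ε = M ℕ.⊔ N , λ m n hm hn →
    close (u m) (u n)
      (δ≤u m (ℕ.m⊔n≤o⇒m≤o M N hm)) (δ≤u n (ℕ.m⊔n≤o⇒m≤o M N hn))
      (proj₂ p n m (ℕ.m⊔n≤o⇒n≤o M N hn) (ℕ.m⊔n≤o⇒n≤o M N hm))
    where
    p = cu (ε * (δ * δ)) (0<* 0<ε (0<* 0<δ 0<δ))
    N = proj₁ p
    close : ∀ a b → δ ≤ a → δ ≤ b → ∣ b - a ∣ ≤ ε * (δ * δ) →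
            ∣ clamped-recip δ 0<δ a - clamped-recip δ 0<δ b ∣ ≤ ε
    close a b δ≤a δ≤b h = begin
      ∣ a⁻¹ - b⁻¹ ∣
        ≡⟨ cong ∣_∣ (solve 2 (λ s t → s :- t := s :* con 1ℚ :- t :* con 1ℚ) refl a⁻¹ b⁻¹) ⟩
      ∣ a⁻¹ * 1ℚ - b⁻¹ * 1ℚ ∣
        ≡⟨ cong₂ (λ s t → ∣ a⁻¹ * s - b⁻¹ * t ∣)
             (sym (*-clamped-recip 0<δ δ≤b)) (sym (*-clamped-recip 0<δ δ≤a)) ⟩
      ∣ a⁻¹ * (b * b⁻¹) - b⁻¹ * (a * a⁻¹) ∣
        ≡⟨ cong ∣_∣ (solve 4 (λ a b s t → s :* (b :* t) :- t :* (a :* s)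
                                          := (b :- a) :* (s :* t)) refl a b a⁻¹ b⁻¹) ⟩
      ∣ (b - a) * (a⁻¹ * b⁻¹) ∣
        ≡⟨ trans (ℚ.∣p*q∣≡∣p∣*∣q∣ (b - a) (a⁻¹ * b⁻¹))
                 (cong (∣ b - a ∣ *_) (ℚ.0≤p⇒∣p∣≡p (0≤* 0≤a⁻¹ 0≤b⁻¹))) ⟩
      ∣ b - a ∣ * (a⁻¹ * b⁻¹)
        ≤⟨ *-monoʳ (0≤* 0≤a⁻¹ 0≤b⁻¹) h ⟩
      ε * (δ * δ) * (a⁻¹ * b⁻¹)
        ≡⟨ solve 4 (λ e d s t → e :* (d :* d) :* (s :* t) := e :* ((d :* s) :* (d :* t)))
             refl ε δ a⁻¹ b⁻¹ ⟩
      ε * ((δ * a⁻¹) * (δ * b⁻¹))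
        ≤⟨ *-monoˡ (ℚ.<⇒≤ 0<ε) (*-mono (0≤* (ℚ.<⇒≤ 0<δ) 0≤a⁻¹) 0≤1
             (ℚ.≤-trans (*-monoʳ 0≤a⁻¹ δ≤a) (ℚ.≤-reflexive (*-clamped-recip 0<δ δ≤a)))
             (ℚ.≤-trans (*-monoʳ 0≤b⁻¹ δ≤b) (ℚ.≤-reflexive (*-clamped-recip 0<δ δ≤b)))) ⟩
      ε * (1ℚ * 1ℚ)
        ≡⟨ ℚ.*-identityʳ ε ⟩
      ε ∎
      where
      a⁻¹ = clamped-recip δ 0<δ a
      b⁻¹ = clamped-recip δ 0<δ b
      0≤a⁻¹ : 0ℚ ≤ a⁻¹
      0≤a⁻¹ = ℚ.<⇒≤ (recip-pos (δ ⊔ a) (0<⊔ a 0<δ))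
      0≤b⁻¹ : 0ℚ ≤ b⁻¹
      0≤b⁻¹ = ℚ.<⇒≤ (recip-pos (δ ⊔ b) (0<⊔ b 0<δ))

record ℝ : Set where
  no-eta-equality
  constructor mkℝ
  field
    seq    : ℕ → ℚ
    cauchy : IsCauchy seq

open ℝ public

infix  4 _≃_ _≤_ _<_
infixl 6 _+_ _-_
infixl 7 _*_
infix  8 -_
infixr 8 _^_

record _≃_ (x y : ℝ) : Set where
  constructor mk≃
  field close : ∀ ε → 0ℚ ℚ.< ε → Eventually (λ n → ℚ.∣ seq x n ℚ.- seq y n ∣ ℚ.≤ ε)

record _≤_ (x y : ℝ) : Set where
  constructor mk≤
  field bound : ∀ ε → 0ℚ ℚ.< ε → Eventually (λ n → seq x n ℚ.≤ seq y n ℚ.+ ε)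

record _<_ (x y : ℝ) : Set where
  constructor mk<
  field
    gap       : ℚ
    gap-pos   : 0ℚ ℚ.< gap
    separated : Eventually (λ n → seq x n ℚ.+ gap ℚ.≤ seq y n)

fromℚ : ℚ → ℝ
seq    (fromℚ p) _ = p
cauchy (fromℚ p)   = Cauchy.const-cauchy p

0ℝ 1ℝ 2ℝ : ℝ
0ℝ = fromℚ 0ℚ
1ℝ = fromℚ 1ℚ
2ℝ = fromℚ (+ 2 ℚ./ 1)

_+_ : ℝ → ℝ → ℝ
seq    (x + y) n = seq x n ℚ.+ seq y n
cauchy (x + y)   = Cauchy.+-cauchy {seq x} {seq y} (cauchy x) (cauchy y)

-_ : ℝ → ℝ
seq    (- x) n = ℚ.- seq x n
cauchy (- x)   = Cauchy.neg-cauchy {seq x} (cauchy x)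

_-_ : ℝ → ℝ → ℝ
x - y = x + (- y)

_*_ : ℝ → ℝ → ℝ
seq    (x * y) n = seq x n ℚ.* seq y n
cauchy (x * y)   = Cauchy.*-cauchy {seq x} {seq y} (cauchy x) (cauchy y)

∣_∣ : ℝ → ℝ
seq    ∣ x ∣ n = ℚ.∣ seq x n ∣
cauchy ∣ x ∣   = Cauchy.abs-cauchy {seq x} (cauchy x)

_^_ : ℝ → ℕ → ℝ
x ^ zero  = 1ℝ
x ^ suc n = x * x ^ n

eventually-≥ : ∀ {x} (0<x : 0ℝ < x) → Eventually (λ n → _<_.gap 0<x ℚ.≤ seq x n)
eventually-≥ {x} (mk< δ _ (N , h)) =
  N , λ n N≤n → subst (ℚ._≤ seq x n) (ℚ.+-identityˡ δ) (h n N≤n)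

eventually-≥⇒0< : ∀ {x δ} → 0ℚ ℚ.< δ → Eventually (λ n → δ ℚ.≤ seq x n) → 0ℝ < x
eventually-≥⇒0< {x} {δ} 0<δ (N , h) =
  mk< δ 0<δ (N , λ n N≤n → subst (ℚ._≤ seq x n) (sym (ℚ.+-identityˡ δ)) (h n N≤n))

-- The lower bound δ contained in the proof of 0 < x is used to clamp the
-- entries of x to max δ xₙ; this only alters the finitely many entries
-- before the bound takes effect.
recip : ∀ x → 0ℝ < x → ℝ
seq    (recip x (mk< δ 0<δ _)) n = Cauchy.clamped-recip δ 0<δ (seq x n)
cauchy (recip x 0<x@(mk< δ 0<δ _)) =
  Cauchy.recip-cauchy {seq x} 0<δ (eventually-≥ 0<x) (cauchy x)

infixl 7 _÷_[_]
_÷_[_] : ∀ x y → 0ℝ < y → ℝ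
x ÷ y [ 0<y ] = x * recip y 0<y

partialSum : (ℕ → ℝ) → ℕ → ℝ
partialSum a zero    = 0ℝ
partialSum a (suc n) = partialSum a n + a n

-- Entrywise domination of Σ aₖ by a convergent geometric series, from the
-- K-th term on and uniformly in all sufficiently late entries.
Dominated : (ℕ → ℝ) → Set
Dominated a = ∃[ K ] ∃[ C ] ∃[ r ] 0ℚ ℚ.≤ r × r ℚ.< 1ℚ ×
  Eventually (λ n → ∀ j → ℚ.∣ seq (a (K ℕ.+ j)) n ∣ ℚ.≤ C ℚ.* r ℚ-Lemmas.^ j)

module Series where

  open ℚ-Lemmas using (⅓; 0<⅓; 0<*; thirds; ∣∣-sym; tail-index; module GeometricTail)

  uniform-tail : ∀ a → Dominated a → ∀ ε → 0ℚ ℚ.< ε →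
    ∃[ N ] Eventually (λ n → ∀ m → N ℕ.≤ m →
      ℚ.∣ seq (partialSum a m) n ℚ.- seq (partialSum a N) n ∣ ℚ.≤ ε)
  uniform-tail a (K , C , r , 0≤r , r<1 , P , bound) ε 0<ε = K ℕ.+ i , P , close
    where
    index = tail-index C r ε r<1 0<ε
    i = proj₁ index
    S : ℕ → ℕ → ℚ
    S n m = seq (partialSum a m) n
    close : ∀ n → P ℕ.≤ n → ∀ m → K ℕ.+ i ℕ.≤ m → ℚ.∣ S n m ℚ.- S n (K ℕ.+ i) ∣ ℚ.≤ ε
    close n P≤n m N≤m = subst (λ t → ℚ.∣ S n t ℚ.- S n (K ℕ.+ i) ∣ ℚ.≤ ε)
      (trans (sym (ℕ.+-assoc K i (m ℕ.∸ (K ℕ.+ i)))) (ℕ.m+[n∸m]≡n N≤m))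
      (GeometricTail.small {λ j → S n (K ℕ.+ j)} {λ j → seq (a (K ℕ.+ j)) n}
        (λ j → cong (S n) (ℕ.+-suc K j)) 0≤r r<1 (bound n P≤n)
        i 0<ε (proj₁ (proj₂ index)) (proj₂ (proj₂ index)) (m ℕ.∸ (K ℕ.+ i)))

  triangle : ∀ {ε} p q r s → ℚ.∣ p ℚ.- q ∣ ℚ.≤ ⅓ ℚ.* ε → ℚ.∣ q ℚ.- r ∣ ℚ.≤ ⅓ ℚ.* ε →
             ℚ.∣ s ℚ.- r ∣ ℚ.≤ ⅓ ℚ.* ε → ℚ.∣ p ℚ.- s ∣ ℚ.≤ ε
  triangle {ε} p q r s pq qr sr = begin
    ℚ.∣ p ℚ.- s ∣
      ≡⟨ cong ℚ.∣_∣ (solve 4 (λ p q r s → p :- s := (p :- q) :+ (q :- r) :+ (r :- s)) refl p q r s) ⟩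
    ℚ.∣ (p ℚ.- q) ℚ.+ (q ℚ.- r) ℚ.+ (r ℚ.- s) ∣
      ≤⟨ ℚ.∣p+q∣≤∣p∣+∣q∣ ((p ℚ.- q) ℚ.+ (q ℚ.- r)) (r ℚ.- s) ⟩
    ℚ.∣ (p ℚ.- q) ℚ.+ (q ℚ.- r) ∣ ℚ.+ ℚ.∣ r ℚ.- s ∣
      ≤⟨ ℚ.+-mono-≤ (ℚ.≤-trans (ℚ.∣p+q∣≤∣p∣+∣q∣ (p ℚ.- q) (q ℚ.- r)) (ℚ.+-mono-≤ pq qr))
                    (subst (ℚ._≤ ⅓ ℚ.* ε) (∣∣-sym s r) sr) ⟩
    ⅓ ℚ.* ε ℚ.+ ⅓ ℚ.* ε ℚ.+ ⅓ ℚ.* ε  ≡⟨ thirds ε ⟩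
    ε                                ∎
    where
    open import Data.Rational.Solver
    open +-*-Solver
    open import Data.Rational.Properties using (module ≤-Reasoning)
    open ≤-Reasoning

  diagonal-cauchy : ∀ a → Dominated a → IsCauchy (λ n → seq (partialSum a n) n)
  diagonal-cauchy a dom ε 0<ε = N ℕ.⊔ P ℕ.⊔ M , λ m n hm hn →
    triangle (seq (partialSum a m) m) (seq (partialSum a N) m)
             (seq (partialSum a N) n) (seq (partialSum a n) n)
      (proj₂ (proj₂ tail) m (P≤ hm) m (N≤ hm))
      (proj₂ centre m n (ℕ.m⊔n≤o⇒n≤o (N ℕ.⊔ P) M hm) (ℕ.m⊔n≤o⇒n≤o (N ℕ.⊔ P) M hn))
      (proj₂ (proj₂ tail) n (P≤ hn) n (N≤ hn))
    where
    tail = uniform-tail a dom (⅓ ℚ.* ε) (0<* 0<⅓ 0<ε)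
    N = proj₁ tail
    P = proj₁ (proj₂ tail)
    centre = cauchy (partialSum a N) (⅓ ℚ.* ε) (0<* 0<⅓ 0<ε)
    M = proj₁ centre
    N≤ : ∀ {m} → N ℕ.⊔ P ℕ.⊔ M ℕ.≤ m → N ℕ.≤ m
    N≤ h = ℕ.m⊔n≤o⇒m≤o N P (ℕ.m⊔n≤o⇒m≤o (N ℕ.⊔ P) M h)
    P≤ : ∀ {m} → N ℕ.⊔ P ℕ.⊔ M ℕ.≤ m → P ℕ.≤ m
    P≤ h = ℕ.m⊔n≤o⇒n≤o N P (ℕ.m⊔n≤o⇒m≤o (N ℕ.⊔ P) M h)

-- Σ aₖ, represented by the diagonal of the double sequence (partial sum,
-- rational entry), which converges to the sum because the tails are uniformly
-- small.
series : (a : ℕ → ℝ) → Dominated a → ℝ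
seq    (series a dom) n = seq (partialSum a n) n
cauchy (series a dom)   = Series.diagonal-cauchy a dom

expTerm : ℝ → ℕ → ℝ
expTerm x zero    = 1ℝ
expTerm x (suc k) = expTerm x k * x * fromℚ (1ℤ ℚ./ suc k)

artanhTerm : ℝ → ℕ → ℝ
artanhTerm z k = z * (z * z) ^ k * fromℚ (1ℤ ℚ./ suc (2 ℕ.* k))

module Bounds where

  open import Data.Rational renaming
    (_+_ to _⊕_; _*_ to _⊛_; _-_ to _⊖_; ∣_∣ to ∥_∥; _≤_ to _⩽_; _<_ to _≺_)
  open import Data.Rational.Solver
  open +-*-Solver
  open import Data.Rational.Properties using (module ≤-Reasoning)
  open ≤-Reasoning
  open ℚ-Lemmas hiding (_^_; recip) renaming (1/suc to 1/1+_)

  exp-step : ∀ {D} t x k → ∥ t ∥ ⩽ D → ∥ x ∥ ⩽ ½ ⊛ fromℕ (suc k) → ∥ t ⊛ x ⊛ 1/1+ k ∥ ⩽ ½ ⊛ D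
  exp-step {D} t x k ht hx = begin
    ∥ t ⊛ x ⊛ u ∥              ≡⟨ ℚ.∣p*q∣≡∣p∣*∣q∣ (t ⊛ x) u ⟩
    ∥ t ⊛ x ∥ ⊛ ∥ u ∥          ≡⟨ cong₂ _⊛_ (ℚ.∣p*q∣≡∣p∣*∣q∣ t x) (ℚ.0≤p⇒∣p∣≡p 0≤u) ⟩
    ∥ t ∥ ⊛ ∥ x ∥ ⊛ u          ≤⟨ *-monoʳ 0≤u (*-mono (ℚ.0≤∣p∣ t) (ℚ.≤-trans (ℚ.0≤∣p∣ x) hx) ht hx) ⟩
    D ⊛ (½ ⊛ m) ⊛ u            ≡⟨ solve 3 (λ d m u → d :* (con ½ :* m) :* u := con ½ :* d :* (m :* u))
                                    refl D m u ⟩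
    ½ ⊛ D ⊛ (m ⊛ u)            ≡⟨ cong (½ ⊛ D ⊛_) (fromℕ-*-1/suc k) ⟩
    ½ ⊛ D ⊛ 1ℚ                 ≡⟨ ℚ.*-identityʳ (½ ⊛ D) ⟩
    ½ ⊛ D                      ∎
    where
    u = 1/1+ k
    m = fromℕ (suc k)
    0≤u : 0ℚ ⩽ u
    0≤u = ℚ.<⇒≤ (1/suc-pos k)

  expTerm-bound : ∀ x n {C} K → ∥ seq (expTerm x K) n ∥ ⩽ C → ∥ seq x n ∥ ⩽ ½ ⊛ fromℕ K →
                  ∀ j → ∥ seq (expTerm x (K ℕ.+ j)) n ∥ ⩽ C ⊛ ½ ℚ-Lemmas.^ j
  expTerm-bound x n {C} K hC hx zero = subst₂ (λ k c → ∥ seq (expTerm x k) n ∥ ⩽ c)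
    (sym (ℕ.+-identityʳ K)) (sym (ℚ.*-identityʳ C)) hC
  expTerm-bound x n {C} K hC hx (suc j) = subst₂ (λ k c → ∥ seq (expTerm x k) n ∥ ⩽ c)
    (sym (ℕ.+-suc K j))
    (solve 3 (λ h c p → h :* (c :* p) := c :* (h :* p)) refl ½ C (½ ℚ-Lemmas.^ j))
    (exp-step (seq (expTerm x (K ℕ.+ j)) n) (seq x n) (K ℕ.+ j)
      (expTerm-bound x n K hC hx j)
      (ℚ.≤-trans hx (*-monoˡ (ℚ.<⇒≤ 0<½)
        (fromℕ-mono {K} {suc (K ℕ.+ j)} (ℕ.m≤n⇒m≤1+n (ℕ.m≤m+n K j))))))

  exp-dominated : ∀ x → Dominated (expTerm x)
  exp-dominated x = K , C , ½ , ℚ.<⇒≤ 0<½ , from-yes (½ ℚ.<? 1ℚ) , proj₁ bounds , λ n N≤n →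
    let hC , hx = proj₂ bounds n N≤n in expTerm-bound x n K hC (ℚ.≤-trans hx (proj₂ K-large))
    where
    boundˣ = Cauchy.bounded {seq x} (cauchy x)
    K-large = archimedean (proj₁ boundˣ) 0<½
    K = proj₁ K-large
    boundᴷ = Cauchy.bounded {seq (expTerm x K)} (cauchy (expTerm x K))
    C = proj₁ boundᴷ
    bounds = both (proj₂ (proj₂ boundᴷ)) (proj₂ (proj₂ boundˣ))

  seq-^ : ∀ x k n → seq (x ^ k) n ≡ seq x n ℚ-Lemmas.^ k
  seq-^ x zero    n = refl
  seq-^ x (suc k) n = cong (seq x n ⊛_) (seq-^ x k n)

  artanh-step : ∀ {r} z j k → r ⩽ 1ℚ → ∥ z ∥ ⩽ r →
                ∥ z ⊛ (z ⊛ z) ℚ-Lemmas.^ j ⊛ 1/1+ k ∥ ⩽ 1ℚ ⊛ r ℚ-Lemmas.^ j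
  artanh-step {r} z j k r≤1 hz = begin
    ∥ z ⊛ (z ⊛ z) ℚ-Lemmas.^ j ⊛ u ∥
      ≡⟨ trans (ℚ.∣p*q∣≡∣p∣*∣q∣ (z ⊛ (z ⊛ z) ℚ-Lemmas.^ j) u)
               (cong₂ _⊛_ (ℚ.∣p*q∣≡∣p∣*∣q∣ z ((z ⊛ z) ℚ-Lemmas.^ j)) (ℚ.0≤p⇒∣p∣≡p 0≤u)) ⟩
    ∥ z ∥ ⊛ ∥ (z ⊛ z) ℚ-Lemmas.^ j ∥ ⊛ u
      ≡⟨ cong (λ t → ∥ z ∥ ⊛ t ⊛ u) (∣^∣ (z ⊛ z) j) ⟩
    ∥ z ∥ ⊛ ∥ z ⊛ z ∥ ℚ-Lemmas.^ j ⊛ u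
      ≤⟨ *-mono (0≤* (ℚ.0≤∣p∣ z) (0≤^ (ℚ.0≤∣p∣ (z ⊛ z)) j)) 0≤1
           (*-mono (ℚ.0≤∣p∣ z) (0≤^ 0≤r j) (ℚ.≤-trans hz r≤1) (^-mono (ℚ.0≤∣p∣ (z ⊛ z)) square j))
           (1/suc≤1 k) ⟩
    1ℚ ⊛ r ℚ-Lemmas.^ j ⊛ 1ℚ
      ≡⟨ ℚ.*-identityʳ (1ℚ ⊛ r ℚ-Lemmas.^ j) ⟩
    1ℚ ⊛ r ℚ-Lemmas.^ j ∎
    where
    u = 1/1+ k
    0≤u : 0ℚ ⩽ u
    0≤u = ℚ.<⇒≤ (1/suc-pos k)
    0≤r : 0ℚ ⩽ r
    0≤r = ℚ.≤-trans (ℚ.0≤∣p∣ z) hz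
    square : ∥ z ⊛ z ∥ ⩽ r
    square = begin
      ∥ z ⊛ z ∥        ≡⟨ ℚ.∣p*q∣≡∣p∣*∣q∣ z z ⟩
      ∥ z ∥ ⊛ ∥ z ∥    ≤⟨ *-mono (ℚ.0≤∣p∣ z) 0≤r (ℚ.≤-trans hz r≤1) hz ⟩
      1ℚ ⊛ r           ≡⟨ ℚ.*-identityˡ r ⟩
      r                ∎

  artanh-dominated : ∀ z {r} → 0ℚ ⩽ r → r ≺ 1ℚ → Eventually (λ n → ∥ seq z n ∥ ⩽ r) →
                     Dominated (artanhTerm z)
  artanh-dominated z {r} 0≤r r<1 (N , h) = 0 , 1ℚ , r , 0≤r , r<1 , N , λ n N≤n j →
    subst (λ t → ∥ seq z n ⊛ t ⊛ 1/1+ (2 ℕ.* j) ∥ ⩽ 1ℚ ⊛ r ℚ-Lemmas.^ j)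
      (sym (seq-^ (z * z) j n))
      (artanh-step (seq z n) j (2 ℕ.* j) (ℚ.<⇒≤ r<1) (h n N≤n))

  -- ∣x - 1∣ / (x + 1) ≤ 1 - c as soon as c ≤ x, c ≤ 1 and c x ≤ 1.
  cayley-bound : ∀ x w c → (x ⊕ 1ℚ) ⊛ w ≡ 1ℚ → 0ℚ ⩽ w → c ⩽ x → c ⩽ 1ℚ → c ⊛ x ⩽ 1ℚ →
                 0ℚ ⩽ x → ∥ (x ⊕ ℚ.- 1ℚ) ⊛ w ∥ ⩽ 1ℚ ⊖ c
  cayley-bound x w c inverse 0≤w c≤x c≤1 cx≤1 0≤x = begin
    ∥ (x ⊖ 1ℚ) ⊛ w ∥
      ≡⟨ trans (ℚ.∣p*q∣≡∣p∣*∣q∣ (x ⊖ 1ℚ) w) (cong (∥ x ⊖ 1ℚ ∥ ⊛_) (ℚ.0≤p⇒∣p∣≡p 0≤w)) ⟩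
    ∥ x ⊖ 1ℚ ∥ ⊛ w
      ≤⟨ *-monoʳ 0≤w (∣p∣≤ upper lower) ⟩
    (1ℚ ⊖ c) ⊛ (x ⊕ 1ℚ) ⊛ w
      ≡⟨ trans (ℚ.*-assoc (1ℚ ⊖ c) (x ⊕ 1ℚ) w) (cong ((1ℚ ⊖ c) ⊛_) inverse) ⟩
    (1ℚ ⊖ c) ⊛ 1ℚ
      ≡⟨ ℚ.*-identityʳ (1ℚ ⊖ c) ⟩
    1ℚ ⊖ c ∎
    where
    cx≤x : c ⊛ x ⩽ x
    cx≤x = ℚ.≤-trans (*-monoʳ 0≤x c≤1) (ℚ.≤-reflexive (ℚ.*-identityˡ x))
    upper : x ⊖ 1ℚ ⩽ (1ℚ ⊖ c) ⊛ (x ⊕ 1ℚ)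
    upper = begin
      x ⊖ 1ℚ
        ≡⟨ solve 1 (λ x → x :- con 1ℚ := x :+ con 1ℚ :- (con 1ℚ :+ con 1ℚ)) refl x ⟩
      x ⊕ 1ℚ ⊖ (1ℚ ⊕ 1ℚ)
        ≤⟨ ℚ.+-monoʳ-≤ (x ⊕ 1ℚ) (ℚ.neg-antimono-≤ (ℚ.+-mono-≤ cx≤1 c≤1)) ⟩
      x ⊕ 1ℚ ⊖ (c ⊛ x ⊕ c)
        ≡⟨ solve 2 (λ x c → x :+ con 1ℚ :- (c :* x :+ c) := (con 1ℚ :- c) :* (x :+ con 1ℚ)) refl x c ⟩
      (1ℚ ⊖ c) ⊛ (x ⊕ 1ℚ) ∎
    lower : ℚ.- (x ⊖ 1ℚ) ⩽ (1ℚ ⊖ c) ⊛ (x ⊕ 1ℚ)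
    lower = begin
      ℚ.- (x ⊖ 1ℚ)
        ≡⟨ solve 1 (λ x → :- (x :- con 1ℚ) := x :+ con 1ℚ :- (x :+ x)) refl x ⟩
      x ⊕ 1ℚ ⊖ (x ⊕ x)
        ≤⟨ ℚ.+-monoʳ-≤ (x ⊕ 1ℚ) (ℚ.neg-antimono-≤ (ℚ.+-mono-≤ cx≤x c≤x)) ⟩
      x ⊕ 1ℚ ⊖ (c ⊛ x ⊕ c)
        ≡⟨ solve 2 (λ x c → x :+ con 1ℚ :- (c :* x :+ c) := (con 1ℚ :- c) :* (x :+ con 1ℚ)) refl x c ⟩
      (1ℚ ⊖ c) ⊛ (x ⊕ 1ℚ) ∎

  recip-≤ : ∀ {p B} w (0<B : 0ℚ ≺ B) → 0ℚ ⩽ w → p ⊛ w ≡ 1ℚ → p ⩽ B → ℚ-Lemmas.recip B 0<B ⩽ w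
  recip-≤ {p} {B} w 0<B 0≤w inverse p≤B = begin
    b                  ≡⟨ sym (ℚ.*-identityʳ b) ⟩
    b ⊛ 1ℚ             ≡⟨ cong (b ⊛_) (sym inverse) ⟩
    b ⊛ (p ⊛ w)        ≤⟨ *-monoˡ (ℚ.<⇒≤ (recip-pos B 0<B)) (*-monoʳ 0≤w p≤B) ⟩
    b ⊛ (B ⊛ w)        ≡⟨ solve 3 (λ b c w → b :* (c :* w) := c :* b :* w) refl b B w ⟩
    B ⊛ b ⊛ w          ≡⟨ cong (_⊛ w) (*-recip B 0<B) ⟩
    1ℚ ⊛ w             ≡⟨ ℚ.*-identityˡ w ⟩
    w                  ∎
    where
    b = ℚ-Lemmas.recip B 0<B

  ⅙≤a*m² : ∀ {a} m → m ≢ 0ℤ → ⅙ ⩽ a → ⅙ ⩽ a ⊛ (fromℤ m ⊛ fromℤ m)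
  ⅙≤a*m² {a} m m≢0 ⅙≤a = begin
    ⅙                           ≡⟨ sym (ℚ.*-identityʳ ⅙) ⟩
    ⅙ ⊛ 1ℚ                      ≤⟨ *-mono (ℚ.<⇒≤ 0<⅙) (0≤p*p (fromℤ m)) ⅙≤a (1≤m*m m m≢0) ⟩
    a ⊛ (fromℤ m ⊛ fromℤ m)     ∎

  pairwise-sums≡0 : ∀ i j k → i ℤ.+ j ≡ 0ℤ → j ℤ.+ k ≡ 0ℤ → i ℤ.+ k ≡ 0ℤ → i ≡ 0ℤ
  pairwise-sums≡0 i j k ij jk ik = ℤ.*-cancelˡ-≡ (+ 2) i 0ℤ (trans
    (ℤsolve 3 (λ i j k → ℤcon (+ 2) ⊗ i ⊜ (i ⊞ j) ⊞ (i ⊞ k) ⊟ (j ⊞ k)) refl i j k)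
    (cong₂ ℤ._-_ (cong₂ ℤ._+_ ij ik) jk))
    where
    open import Data.Integer.Solver renaming (module +-*-Solver to ℤ-Solver)
    open ℤ-Solver renaming
      (solve to ℤsolve; con to ℤcon; _:*_ to _⊗_; _:+_ to _⊞_; _:-_ to _⊟_; _:=_ to _⊜_)

  form-bound : ∀ a i j k → ⅙ ⩽ a → ¬ (i ≡ 0ℤ × j ≡ 0ℤ × k ≡ 0ℤ) →
    let X = fromℤ (i ℤ.+ j); Y = fromℤ (j ℤ.+ k); Z = fromℤ (i ℤ.+ k) in
    ⅙ ⩽ a ⊛ (X ⊛ X) ⊕ Y ⊛ Y ⊕ Z ⊛ Z
  form-bound a i j k ⅙≤a nonzero =
    cases (i ℤ.+ j ℤ.≟ 0ℤ) (j ℤ.+ k ℤ.≟ 0ℤ) (i ℤ.+ k ℤ.≟ 0ℤ)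
    where
    open import Relation.Nullary.Decidable.Core using (Dec)
    X = fromℤ (i ℤ.+ j)
    Y = fromℤ (j ℤ.+ k)
    Z = fromℤ (i ℤ.+ k)
    x y z : ℚ
    x = a ⊛ (X ⊛ X)
    y = Y ⊛ Y
    z = Z ⊛ Z
    0≤x : 0ℚ ⩽ x
    0≤x = 0≤* (ℚ.≤-trans (ℚ.<⇒≤ 0<⅙) ⅙≤a) (0≤p*p X)
    ⅙≤1 : ⅙ ⩽ 1ℚ
    ⅙≤1 = from-yes (⅙ ℚ.≤? 1ℚ)
    large : ∀ {p q r} → ⅙ ⩽ p → 0ℚ ⩽ q → 0ℚ ⩽ r → ⅙ ⩽ p ⊕ q ⊕ r
    large hp hq hr = ℚ.+-mono-≤ (ℚ.+-mono-≤ hp hq) hr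
    cases : Dec (i ℤ.+ j ≡ 0ℤ) → Dec (j ℤ.+ k ≡ 0ℤ) → Dec (i ℤ.+ k ≡ 0ℤ) → ⅙ ⩽ x ⊕ y ⊕ z
    cases (no ij) _ _ = large (⅙≤a*m² (i ℤ.+ j) ij ⅙≤a) (0≤p*p Y) (0≤p*p Z)
    cases (yes _) (no jk) _ = subst (⅙ ⩽_) (cong (_⊕ z) (ℚ.+-comm y x))
      (large (ℚ.≤-trans ⅙≤1 (1≤m*m (j ℤ.+ k) jk)) 0≤x (0≤p*p Z))
    cases (yes _) (yes _) (no ik) = subst (⅙ ⩽_)
      (solve 3 (λ z x y → z :+ x :+ y := x :+ y :+ z) refl z x y)
      (large (ℚ.≤-trans ⅙≤1 (1≤m*m (i ℤ.+ k) ik)) 0≤x (0≤p*p Y))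
    cases (yes ij) (yes jk) (yes ik) = contradiction
      ( pairwise-sums≡0 i j k ij jk ik
      , pairwise-sums≡0 j k i jk (trans (ℤ.+-comm k i) ik) (trans (ℤ.+-comm j i) ij)
      , pairwise-sums≡0 k i j (trans (ℤ.+-comm k i) ik) ij (trans (ℤ.+-comm k j) jk) )
      nonzero

exp : ℝ → ℝ
exp x = series (expTerm x) (Bounds.exp-dominated x)

*-pos : ∀ {x y} → 0ℝ < x → 0ℝ < y → 0ℝ < x * y
*-pos 0<x@(mk< δ 0<δ _) 0<y@(mk< η 0<η _) =
  eventually-≥⇒0< (ℚ-Lemmas.0<* 0<δ 0<η) (proj₁ lower , λ n N≤n →
    let δ≤x , η≤y = proj₂ lower n N≤n in
    ℚ-Lemmas.*-mono (ℚ.<⇒≤ 0<δ) (ℚ.≤-trans (ℚ.<⇒≤ 0<η) η≤y) δ≤x η≤y)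
  where
  lower = both (eventually-≥ 0<x) (eventually-≥ 0<y)

+1-pos : ∀ {x} → 0ℝ < x → 0ℝ < x + 1ℝ
+1-pos {x} 0<x@(mk< δ 0<δ _) = eventually-≥⇒0< 0<δ (proj₁ lower , λ n N≤n →
  subst (ℚ._≤ seq x n ℚ.+ 1ℚ) (ℚ.+-identityʳ δ) (ℚ.+-mono-≤ (proj₂ lower n N≤n) ℚ-Lemmas.0≤1))
  where
  lower = eventually-≥ 0<x

recip-entry-pos : ∀ {x} (0<x : 0ℝ < x) n → 0ℚ ℚ.< seq (recip x 0<x) n
recip-entry-pos {x} (mk< δ 0<δ _) n =
  ℚ-Lemmas.recip-pos (δ ℚ.⊔ seq x n) (Cauchy.0<⊔ (seq x n) 0<δ)

recip-inverse : ∀ {x} (0<x : 0ℝ < x) →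
  Eventually (λ n → seq x n ℚ.* seq (recip x 0<x) n ≡ 1ℚ)
recip-inverse 0<x@(mk< _ 0<δ _) = proj₁ lower , λ n N≤n →
  Cauchy.*-clamped-recip 0<δ (proj₂ lower n N≤n)
  where
  lower = eventually-≥ 0<x

recip-pos : ∀ {x} (0<x : 0ℝ < x) → 0ℝ < recip x 0<x
recip-pos {x} 0<x = eventually-≥⇒0< (ℚ-Lemmas.recip-pos B 0<B) (proj₁ facts , λ n N≤n →
  let inverse , ∣x∣≤B = proj₂ facts n N≤n in
  Bounds.recip-≤ (seq (recip x 0<x) n) 0<B (ℚ.<⇒≤ (recip-entry-pos 0<x n)) inverse
    (ℚ.≤-trans (ℚ-Lemmas.p≤∣p∣ (seq x n)) ∣x∣≤B))
  where
  bound = Cauchy.bounded {seq x} (cauchy x)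
  B = proj₁ bound
  0<B = proj₁ (proj₂ bound)
  facts = both (recip-inverse 0<x) (proj₂ (proj₂ bound))

-- z = (x - 1) / (x + 1), so that x = (1 + z) / (1 - z) and log x = 2 artanh z.
cayley : ∀ x → 0ℝ < x → ℝ
cayley x 0<x = (x - 1ℝ) ÷ (x + 1ℝ) [ +1-pos 0<x ]

cayley-contracts : ∀ x (0<x : 0ℝ < x) → ∃[ r ] 0ℚ ℚ.≤ r × r ℚ.< 1ℚ ×
  Eventually (λ n → ℚ.∣ seq (cayley x 0<x) n ∣ ℚ.≤ r)
cayley-contracts x 0<x@(mk< δ 0<δ _) = 1ℚ ℚ.- c , 0≤1-c , 1-c<1 , proj₁ facts , λ n N≤n →
  let inverse , ∣x∣≤b , δ≤x = proj₂ facts n N≤n in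
  Bounds.cayley-bound (seq x n) (seq (recip (x + 1ℝ) (+1-pos 0<x)) n) c inverse
    (ℚ.<⇒≤ (recip-entry-pos (+1-pos 0<x) n))
    (ℚ.≤-trans c≤δ δ≤x) c≤1
    (cB≤1 (ℚ.≤-trans (ℚ-Lemmas.p≤∣p∣ (seq x n)) (ℚ.≤-trans ∣x∣≤b b≤B)))
    (ℚ.≤-trans (ℚ.<⇒≤ 0<δ) δ≤x)
  where
  open ℚ-Lemmas using (0<1; 0<+; *-recip; *-monoˡ)
  bound = Cauchy.bounded {seq x} (cauchy x)
  b = proj₁ bound
  0<b : 0ℚ ℚ.< b
  0<b = proj₁ (proj₂ bound)
  δ⁻¹ = ℚ-Lemmas.recip δ 0<δ
  0<δ⁻¹ : 0ℚ ℚ.< δ⁻¹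
  0<δ⁻¹ = ℚ-Lemmas.recip-pos δ 0<δ
  B : ℚ
  B = 1ℚ ℚ.+ b ℚ.+ δ⁻¹
  0<B : 0ℚ ℚ.< B
  0<B = 0<+ (0<+ 0<1 (ℚ.<⇒≤ 0<b)) (ℚ.<⇒≤ 0<δ⁻¹)
  c = ℚ-Lemmas.recip B 0<B
  0<c : 0ℚ ℚ.< c
  0<c = ℚ-Lemmas.recip-pos B 0<B
  grow : ∀ {p q r} → 0ℚ ℚ.≤ q → p ℚ.≤ r → p ℚ.≤ q ℚ.+ r
  grow {p} 0≤q p≤r = subst (ℚ._≤ _) (ℚ.+-identityˡ p) (ℚ.+-mono-≤ 0≤q p≤r)
  shrink : ∀ {p q r} → 0ℚ ℚ.≤ r → p ℚ.≤ q → p ℚ.≤ q ℚ.+ r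
  shrink {p} 0≤r p≤q = subst (ℚ._≤ _) (ℚ.+-identityʳ p) (ℚ.+-mono-≤ p≤q 0≤r)
  1≤B : 1ℚ ℚ.≤ B
  1≤B = shrink (ℚ.<⇒≤ 0<δ⁻¹) (shrink (ℚ.<⇒≤ 0<b) ℚ.≤-refl)
  b≤B : b ℚ.≤ B
  b≤B = shrink (ℚ.<⇒≤ 0<δ⁻¹) (grow ℚ-Lemmas.0≤1 ℚ.≤-refl)
  δ⁻¹≤B : δ⁻¹ ℚ.≤ B
  δ⁻¹≤B = grow (ℚ.<⇒≤ (0<+ 0<1 (ℚ.<⇒≤ 0<b))) ℚ.≤-refl
  cB≤1 : ∀ {p} → p ℚ.≤ B → c ℚ.* p ℚ.≤ 1ℚ
  cB≤1 p≤B = ℚ.≤-trans (*-monoˡ (ℚ.<⇒≤ 0<c) p≤B)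
    (ℚ.≤-reflexive (trans (ℚ.*-comm c B) (*-recip B 0<B)))
  c≤1 : c ℚ.≤ 1ℚ
  c≤1 = subst (ℚ._≤ 1ℚ) (ℚ.*-identityʳ c) (cB≤1 1≤B)
  c≤δ : c ℚ.≤ δ
  c≤δ = Bounds.recip-≤ δ 0<B (ℚ.<⇒≤ 0<δ) (trans (ℚ.*-comm δ⁻¹ δ) (*-recip δ 0<δ)) δ⁻¹≤B
  0≤1-c : 0ℚ ℚ.≤ 1ℚ ℚ.- c
  0≤1-c = subst (ℚ._≤ 1ℚ ℚ.- c) (ℚ.+-inverseʳ c) (ℚ.+-monoˡ-≤ (ℚ.- c) c≤1)
  1-c<1 : 1ℚ ℚ.- c ℚ.< 1ℚ
  1-c<1 = subst (1ℚ ℚ.- c ℚ.<_) (ℚ.+-identityʳ 1ℚ) (ℚ.+-monoʳ-< 1ℚ (ℚ.neg-antimono-< 0<c))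
  facts = both (recip-inverse (+1-pos 0<x)) (both (proj₂ (proj₂ bound)) (eventually-≥ 0<x))

log : ∀ x → 0ℝ < x → ℝ
log x 0<x = 2ℝ * series (artanhTerm z) (Bounds.artanh-dominated z 0≤r r<1 ∣z∣≤r)
  where
  z = cayley x 0<x
  contraction = cayley-contracts x 0<x
  0≤r = proj₁ (proj₂ contraction)
  r<1 = proj₁ (proj₂ (proj₂ contraction))
  ∣z∣≤r = proj₂ (proj₂ (proj₂ contraction))

pow : ∀ x → 0ℝ < x → ℝ → ℝ
pow x 0<x s = exp (s * log x 0<x)

-- Unconditional summation along the finite subsets of I, which are encoded as
-- duplicate-free lists.
sumOver : {I : Set} → (I → ℝ) → List I → ℝ
sumOver a = foldr (λ p t → a p + t) 0ℝ

HasSum : {I : Set} → (I → ℝ) → ℝ → Set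
HasSum {I} a l = ∀ ε → 0ℚ ℚ.< ε → Σ[ F ∈ List I ] Unique F ×
  (∀ G → Unique G → F ⊆ G → ∣ sumOver a G - l ∣ ≤ fromℚ ε)

-- d is the derivative at a of a function f defined on D, written without
-- dividing by x - a.
HasDerivative : {D : ℝ → Set} (f : ∀ x → D x → ℝ) (a : ℝ) (a∈D : D a) (d : ℝ) → Set
HasDerivative {D} f a a∈D d = ∀ ε → 0ℚ ℚ.< ε → ∃[ δ ] 0ℚ ℚ.< δ ×
  (∀ x (x∈D : D x) → ∣ x - a ∣ ≤ fromℚ δ →
    ∣ f x x∈D - f a a∈D - d * (x - a) ∣ ≤ fromℚ ε * ∣ x - a ∣)

fromℤ : ℤ → ℝ
fromℤ m = fromℚ (m ℚ./ 1)

-- The field nonzero is irrelevant so that equality of indices is equality of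
-- coordinates.
record Index : Set where
  constructor index
  field
    i j k    : ℤ
    .nonzero : ¬ (i ≡ 0ℤ × j ≡ 0ℤ × k ≡ 0ℤ)

form : ℝ → Index → ℝ
form A (index i j k _) =
  A * fromℤ (i ℤ.+ j) ^ 2 + fromℤ (j ℤ.+ k) ^ 2 + fromℤ (i ℤ.+ k) ^ 2

⅓ᴿ ½ᴿ : ℝ
⅓ᴿ = fromℚ (+ 1 ℚ./ 3)
½ᴿ = fromℚ (+ 1 ℚ./ 2)

[⅓,1] ⟨⅓,1⟩ : ℝ → Set
[⅓,1] A = ⅓ᴿ ≤ A × A ≤ 1ℝ
⟨⅓,1⟩ A = ⅓ᴿ < A × A < 1ℝ

eventually-≥⅙ : ∀ {A} → ⅓ᴿ ≤ A → Eventually (λ n → ℚ-Lemmas.⅙ ℚ.≤ seq A n)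
eventually-≥⅙ {A} (mk≤ ⅓≤A) = proj₁ lower , λ n N≤n → subst (ℚ-Lemmas.⅙ ℚ.≤_)
  (cancel (seq A n)) (ℚ.+-monoˡ-≤ (ℚ.- ℚ-Lemmas.⅙) (proj₂ lower n N≤n))
  where
  lower = ⅓≤A ℚ-Lemmas.⅙ ℚ-Lemmas.0<⅙
  cancel : ∀ p → p ℚ.+ ℚ-Lemmas.⅙ ℚ.- ℚ-Lemmas.⅙ ≡ p
  cancel p = trans (ℚ.+-assoc p _ _) (ℚ.+-identityʳ p)

A+1-pos : ∀ {A} → ⅓ᴿ ≤ A → 0ℝ < A + 1ℝ
A+1-pos ⅓≤A = +1-pos (eventually-≥⇒0< ℚ-Lemmas.0<⅙ (eventually-≥⅙ ⅓≤A))

form-pos : ∀ {A} → ⅓ᴿ ≤ A → ∀ p → 0ℝ < form A p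
form-pos {A} ⅓≤A (index i j k nonzero) =
  eventually-≥⇒0< ℚ-Lemmas.0<⅙ (proj₁ lower , λ n N≤n → subst (ℚ-Lemmas.⅙ ℚ.≤_)
    (sym (cong₂ ℚ._+_ (cong₂ ℚ._+_ (cong (seq A n ℚ.*_) (square (i ℤ.+ j)))
                                   (square (j ℤ.+ k))) (square (i ℤ.+ k))))
    (Bounds.form-bound (seq A n) i j k (proj₂ lower n N≤n) (¬-recompute nonzero)))
  where
  lower = eventually-≥⅙ ⅓≤A
  square : ∀ m → (m ℚ./ 1) ℚ.* ((m ℚ./ 1) ℚ.* 1ℚ) ≡ (m ℚ./ 1) ℚ.* (m ℚ./ 1)
  square m = cong ((m ℚ./ 1) ℚ.*_) (ℚ.*-identityʳ (m ℚ./ 1))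

term : ℝ → ∀ A → [⅓,1] A → Index → ℝ
term s A (⅓≤A , _) p =
  pow ((A + 1ℝ) ÷ form A p [ form-pos ⅓≤A p ])
      (*-pos (A+1-pos ⅓≤A) (recip-pos (form-pos ⅓≤A p))) s

-- This determines L up to _≃_, and includes the convergence of the series.
IsLatticeSum : ℝ → (∀ A → [⅓,1] A → ℝ) → Set
IsLatticeSum s L = ∀ A A∈ → HasSum (term s A A∈) (L A A∈)

<⇒≤ : ∀ {x y} → x < y → x ≤ y
<⇒≤ {x} {y} (mk< gap 0<gap (N , h)) = mk≤ λ ε 0<ε → N , λ n N≤n →
  ℚ.≤-trans (widen (seq x n) (ℚ.<⇒≤ 0<gap))
    (ℚ.≤-trans (h n N≤n) (widen (seq y n) (ℚ.<⇒≤ 0<ε)))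
  where
  widen : ∀ p {q} → 0ℚ ℚ.≤ q → p ℚ.≤ p ℚ.+ q
  widen p {q} 0≤q = subst (ℚ._≤ p ℚ.+ q) (ℚ.+-identityʳ p) (ℚ.+-monoʳ-≤ p 0≤q)

⟨⅓,1⟩⊆[⅓,1] : ∀ {A} → ⟨⅓,1⟩ A → [⅓,1] A
⟨⅓,1⟩⊆[⅓,1] (⅓<A , A<1) = <⇒≤ ⅓<A , <⇒≤ A<1

½∈⟨⅓,1⟩ : ⟨⅓,1⟩ ½ᴿ
½∈⟨⅓,1⟩ =
  mk< ℚ-Lemmas.⅙ ℚ-Lemmas.0<⅙ (0 , λ _ _ → from-yes (ℚ-Lemmas.⅓ ℚ.+ ℚ-Lemmas.⅙ ℚ.≤? ½)) ,
  mk< ½ ℚ-Lemmas.0<½ (0 , λ _ _ → from-yes (½ ℚ.+ ½ ℚ.≤? 1ℚ))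

{-# OPTIONS --safe #-}

-- With a = (i + j)² and b = (j + k)² + (i + k)² a term of the series is
-- f = ((A + 1) / (a A + b))ˢ, and its logarithmic derivative in A is
-- h = s (1 / (A + 1) - a / (a A + b)), which on [⅓ , 1] is bounded uniformly in
-- i, j, k. The value of f at A + Δ is f times (1 + t)ˢ with t = O(Δ), so the
-- Taylor remainders of f and f h are O(f Δ²) with uniform constants, and the
-- series may be differentiated term by term.
--
-- At A = ½ the form is (P² + Q² + R²) / 2 with P = i + j, Q = i + j + 2k and
-- R = j - i, so that f is invariant under the cyclic permutations of P, Q, R.
-- Over an orbit the terms f h cancel, and the terms of the second derivative
-- add up to a positive multiple of
-- f (s² + s) (3 (P⁴ + Q⁴ + R⁴) - (P² + Q² + R²)²) ≥ 0.
--
-- The functional equations of exp and log, which are given by their power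
-- series, follow from quadratic error bounds for difference quotients: a
-- function with ∣f x - f y∣ ≤ K (x - y)² is constant.

module Submission where

open import Algebra.Bundles using (CommutativeRing)
import Algebra.Solver.Ring as RingSolver
open import Algebra.Solver.Ring.AlmostCommutativeRing as ACR using (AlmostCommutativeRing)
open import Data.Integer.Base as ℤ using (ℤ; +_; 0ℤ; 1ℤ)
import Data.Integer.Properties as ℤ
open import Data.List.Base using (List; []; _∷_; _++_; map; length; upTo; concatMap; cartesianProduct; deduplicate)
import Data.List.Properties as List
open import Data.List.Membership.Propositional using (_∈_; _∉_; find)
open import Data.List.Membership.Propositional.Properties
open import Data.List.Relation.Binary.Permutation.Propositional using (_↭_; ↭-sym; prep; swap)
import Data.List.Relation.Binary.Permutation.Propositional as ↭
open import Data.List.Relation.Binary.Permutation.Propositional.Properties using (∈-resp-↭; All-resp-↭; ↭-length)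
open import Data.List.Relation.Binary.Subset.Propositional using (_⊆_)
open import Data.List.Relation.Unary.All as All using (All; []; _∷_)
open import Data.List.Relation.Unary.AllPairs using ([]; _∷_)
open import Data.List.Relation.Unary.Any as Any using (Any; here; there)
open import Data.List.Relation.Unary.Unique.DecPropositional.Properties using (deduplicate-!)
open import Data.List.Relation.Unary.Unique.Propositional using (Unique)
import Data.List.Relation.Unary.Unique.Propositional.Properties as Unique
open import Data.Maybe.Base using (Maybe; just; nothing)
open import Data.Nat.Base as ℕ using (ℕ; zero; suc)
import Data.Nat.Properties as ℕ
open import Data.Product.Base using (Σ-syntax; ∃-syntax; _×_; _,_; proj₁; proj₂)
import Data.Rational.Base as ℚ
open import Data.Rational.Base using (ℚ; 0ℚ; 1ℚ; ½)
import Data.Rational.Properties as ℚ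
import Data.Rational.Unnormalised.Base as ℚᵘ
import Data.Rational.Unnormalised.Properties as ℚᵘ
open import Data.Sum.Base using (_⊎_; inj₁; inj₂)
open import Level using (0ℓ)
open import Relation.Binary.Bundles using (Poset)
open import Relation.Binary.PropositionalEquality
  using (_≡_; _≢_; refl; sym; trans; cong; cong₂; subst; subst₂)
import Relation.Binary.Reasoning.PartialOrder
open import Relation.Binary.Structures using (IsEquivalence)
open import Relation.Binary.Definitions using (DecidableEquality)
open import Relation.Nullary.Decidable using (Dec; yes; no; from-yes; _×-dec_)
open import Relation.Nullary.Negation.Core using (¬_; contradiction)
open import Defs

-- Reals are Cauchy sequences of rationals without decidable comparison, so no mean value theorem is
-- invoked: every Taylor estimate carries an explicit constant. Division is kept out of the algebra
-- as well. A reciprocal r of D enters the ring solver as a variable, and the relation D r = 1 is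
-- applied through `modulo`.
--
-- The uniform constants come from A ≥ 1/3, which gives a / (a A + b) ≤ 1 / A ≤ 3. One dominating
-- series, f itself, serves L and both derivatives, because h and its derivative are bounded
-- uniformly in the lattice point.
--
-- Convergence is a count: outside the box of half-width 2ᵐ the form is at least a constant times
-- 4ᵐ, so a term is O(4^(-s m)), while the next dyadic shell has O(8ᵐ) points. The ratio 8 · 4^(-s)
-- is below 1 exactly when s > 3/2.
--
-- The inequality for the second derivative on orbits is only weak. Strictness comes from the single
-- orbit of (P, Q, R) = (2, 0, 0), whose contribution is a fixed lower bound that survives the
-- limit.

module Rational where

  open import Data.Rational.Base using () renaming
    (_+_ to _⊕_; _*_ to _⊛_; _-_ to _⊖_; ∣_∣ to ∥_∥; _≤_ to _⩽_)
  open import Data.Rational.Solver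
  open +-*-Solver
  open ℚ-Lemmas using (p≤∣p∣; ∣p∣≤; ∣∣-sym)

  triangle : ∀ p q r → ∥ p ⊖ r ∥ ⩽ ∥ p ⊖ q ∥ ⊕ ∥ q ⊖ r ∥
  triangle p q r = subst (λ t → ∥ t ∥ ⩽ ∥ p ⊖ q ∥ ⊕ ∥ q ⊖ r ∥)
    (solve 3 (λ p q r → (p :- q) :+ (q :- r) := p :- r) refl p q r)
    (ℚ.∣p+q∣≤∣p∣+∣q∣ (p ⊖ q) (q ⊖ r))

  ∣--∣ : ∀ p q → ∥ ℚ.- p ⊖ ℚ.- q ∥ ≡ ∥ p ⊖ q ∥
  ∣--∣ p q = trans (cong ∥_∥ (solve 2 (λ p q → :- p :- :- q := q :- p) refl p q)) (∣∣-sym q p)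

  ≤+∣-∣ : ∀ p q → p ⩽ q ⊕ ∥ p ⊖ q ∥
  ≤+∣-∣ p q = subst (_⩽ q ⊕ ∥ p ⊖ q ∥)
    (solve 2 (λ p q → q :+ (p :- q) := p) refl p q) (ℚ.+-monoʳ-≤ q (p≤∣p∣ (p ⊖ q)))

  ≤+⇒-≤ : ∀ {p q r} → p ⩽ q ⊕ r → p ⊖ q ⩽ r
  ≤+⇒-≤ {p} {q} {r} h = subst (p ⊖ q ⩽_)
    (solve 2 (λ q r → q :+ r :- q := r) refl q r) (ℚ.+-monoˡ-≤ (ℚ.- q) h)

  ∣-∣≤ : ∀ {p q r} → p ⩽ q ⊕ r → q ⩽ p ⊕ r → ∥ p ⊖ q ∥ ⩽ r
  ∣-∣≤ {p} {q} {r} h k = ∣p∣≤ (≤+⇒-≤ h)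
    (subst (_⩽ r) (solve 2 (λ p q → q :- p := :- (p :- q)) refl p q) (≤+⇒-≤ k))

  ≤+nonneg : ∀ {p q r} → 0ℚ ⩽ r → p ⩽ q → p ⩽ q ⊕ r
  ≤+nonneg {p} 0≤r p≤q = subst (_⩽ _) (ℚ.+-identityʳ p) (ℚ.+-mono-≤ p≤q 0≤r)

  ∣p-∣p∣∣≤ : ∀ p {ε} → 0ℚ ⩽ ε → 0ℚ ⩽ p ⊕ ½ ⊛ ε → ∥ p ⊖ ∥ p ∥ ∥ ⩽ ε
  ∣p-∣p∣∣≤ p {ε} 0≤ε h = ∣-∣≤ (≤+nonneg 0≤ε (p≤∣p∣ p)) (∣p∣≤ (≤+nonneg 0≤ε ℚ.≤-refl)
    (subst₂ _⩽_ (solve 1 (λ p → :- p :+ (con 0ℚ :+ con 0ℚ) := :- p) refl p)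
      (solve 2 (λ p ε → :- p :+ ((p :+ con ½ :* ε) :+ (p :+ con ½ :* ε)) := p :+ ε) refl p ε)
      (ℚ.+-monoʳ-≤ (ℚ.- p) (ℚ.+-mono-≤ h h))))

  halves-≤ : ∀ {p q r ε} → p ⩽ q ⊕ ½ ⊛ ε → q ⩽ r ⊕ ½ ⊛ ε → p ⩽ r ⊕ ε
  halves-≤ {p} {q} {r} {ε} h k = ℚ.≤-trans h (subst (q ⊕ ½ ⊛ ε ⩽_)
    (solve 2 (λ r ε → r :+ con ½ :* ε :+ con ½ :* ε := r :+ ε) refl r ε)
    (ℚ.+-monoˡ-≤ (½ ⊛ ε) k))

  halves-mono : ∀ {p q r s ε} → p ⩽ q ⊕ ½ ⊛ ε → r ⩽ s ⊕ ½ ⊛ ε → p ⊕ r ⩽ q ⊕ s ⊕ ε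
  halves-mono {p} {q} {r} {s} {ε} h k = subst (p ⊕ r ⩽_)
    (solve 3 (λ q s ε → q :+ con ½ :* ε :+ (s :+ con ½ :* ε) := q :+ s :+ ε) refl q s ε)
    (ℚ.+-mono-≤ h k)


eventually : ∀ {P Q : ℕ → Set} → (∀ n → P n → Q n) → Eventually P → Eventually Q
eventually f (N , h) = N , λ n N≤n → f n (h n N≤n)

eventually-witness : ∀ {P} → Eventually P → ∃[ n ] P n
eventually-witness (N , h) = N , h N ℕ.≤-refl

½ε : ∀ {ε} → 0ℚ ℚ.< ε → 0ℚ ℚ.< ½ ℚ.* ε
½ε = ℚ-Lemmas.0<* ℚ-Lemmas.0<½

-- The ordered ring structure

≃-pointwise : ∀ {x y} → (∀ n → seq x n ≡ seq y n) → x ≃ y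
≃-pointwise {x} {y} h = mk≃ λ ε 0<ε → 0 , λ n _ → ℚ.≤-trans
  (ℚ.≤-reflexive (cong ℚ.∣_∣ (trans (cong (ℚ._- seq y n) (h n)) (ℚ.+-inverseʳ (seq y n)))))
  (ℚ.<⇒≤ 0<ε)

≃-refl : ∀ {x} → x ≃ x
≃-refl = ≃-pointwise λ _ → refl

≃-sym : ∀ {x y} → x ≃ y → y ≃ x
≃-sym {x} {y} (mk≃ h) = mk≃ λ ε 0<ε → eventually
  (λ n → subst (ℚ._≤ ε) (ℚ-Lemmas.∣∣-sym (seq x n) (seq y n))) (h ε 0<ε)

≃-trans : ∀ {x y z} → x ≃ y → y ≃ z → x ≃ z
≃-trans {x} {y} {z} (mk≃ h) (mk≃ k) = mk≃ λ ε 0<ε → eventually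
  (λ n (p , q) → ℚ.≤-trans (Rational.triangle (seq x n) (seq y n) (seq z n))
    (ℚ.≤-trans (ℚ.+-mono-≤ p q) (ℚ.≤-reflexive (ℚ-Lemmas.halves ε))))
  (both (h _ (½ε 0<ε)) (k _ (½ε 0<ε)))

≃-isEquivalence : IsEquivalence _≃_
≃-isEquivalence = record { refl = ≃-refl ; sym = ≃-sym ; trans = ≃-trans }

+-cong : ∀ {x y u v} → x ≃ y → u ≃ v → x + u ≃ y + v
+-cong {x} {y} {u} {v} (mk≃ h) (mk≃ k) = mk≃ λ ε 0<ε → eventually
  (λ n (p , q) → Cauchy.sum-close {ε} (seq x n) (seq u n) (seq y n) (seq v n) p q)
  (both (h _ (½ε 0<ε)) (k _ (½ε 0<ε)))

*-cong : ∀ {x y u v} → x ≃ y → u ≃ v → x * u ≃ y * v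
*-cong {x} {y} {u} {v} (mk≃ h) (mk≃ k) = mk≃ λ ε 0<ε →
  let A , 0<A , ∣x∣≤A = Cauchy.bounded {seq x} (cauchy x)
      B , 0<B , ∣v∣≤B = Cauchy.bounded {seq v} (cauchy v)
  in eventually
    (λ n (p , q , a , b) →
      Cauchy.product-close {ε} (seq x n) (seq u n) (seq y n) (seq v n) 0<A 0<B a b p q)
    (both (h _ (ℚ-Lemmas.0<* (½ε 0<ε) (ℚ-Lemmas.recip-pos B 0<B)))
      (both (k _ (ℚ-Lemmas.0<* (½ε 0<ε) (ℚ-Lemmas.recip-pos A 0<A))) (both ∣x∣≤A ∣v∣≤B)))

-‿cong : ∀ {x y} → x ≃ y → - x ≃ - y
-‿cong {x} {y} (mk≃ h) = mk≃ λ ε 0<ε → eventually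
  (λ n → subst (ℚ._≤ ε) (sym (Rational.∣--∣ (seq x n) (seq y n)))) (h ε 0<ε)

∣∣-cong : ∀ {x y} → x ≃ y → ∣ x ∣ ≃ ∣ y ∣
∣∣-cong {x} {y} (mk≃ h) = mk≃ λ ε 0<ε → eventually
  (λ n → ℚ.≤-trans (ℚ-Lemmas.∣∣p∣-∣q∣∣≤∣p-q∣ (seq x n) (seq y n))) (h ε 0<ε)

ℝ-commutativeRing : CommutativeRing 0ℓ 0ℓ
ℝ-commutativeRing = record
  { Carrier = ℝ ; _≈_ = _≃_ ; _+_ = _+_ ; _*_ = _*_ ; -_ = -_ ; 0# = 0ℝ ; 1# = 1ℝ
  ; isCommutativeRing = record
    { isRing = record
      { +-isAbelianGroup = record
        { isGroup = record
          { isMonoid = record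
            { isSemigroup = record
              { isMagma = record { isEquivalence = ≃-isEquivalence ; ∙-cong = +-cong }
              ; assoc = λ x y z → ≃-pointwise λ n → ℚ.+-assoc (seq x n) (seq y n) (seq z n)
              }
            ; identity = (λ x → ≃-pointwise λ n → ℚ.+-identityˡ (seq x n)) ,
                         (λ x → ≃-pointwise λ n → ℚ.+-identityʳ (seq x n))
            }
          ; inverse = (λ x → ≃-pointwise λ n → ℚ.+-inverseˡ (seq x n)) ,
                      (λ x → ≃-pointwise λ n → ℚ.+-inverseʳ (seq x n))
          ; ⁻¹-cong = -‿cong
          }
        ; comm = λ x y → ≃-pointwise λ n → ℚ.+-comm (seq x n) (seq y n)
        }
      ; *-cong = *-cong
      ; *-assoc = λ x y z → ≃-pointwise λ n → ℚ.*-assoc (seq x n) (seq y n) (seq z n)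
      ; *-identity = (λ x → ≃-pointwise λ n → ℚ.*-identityˡ (seq x n)) ,
                     (λ x → ≃-pointwise λ n → ℚ.*-identityʳ (seq x n))
      ; distrib = (λ x y z → ≃-pointwise λ n → ℚ.*-distribˡ-+ (seq x n) (seq y n) (seq z n)) ,
                  (λ x y z → ≃-pointwise λ n → ℚ.*-distribʳ-+ (seq x n) (seq y n) (seq z n))
      }
    ; *-comm = λ x y → ≃-pointwise λ n → ℚ.*-comm (seq x n) (seq y n)
    }
  }

module ℝ-Solver where

  ℝ-ring : AlmostCommutativeRing 0ℓ 0ℓ
  ℝ-ring = ACR.fromCommutativeRing ℝ-commutativeRing

  -- Coefficients in ℚ let the solver compute with constants such as ½ or 9/2 instead of treating
  -- them as atoms.
  fromℚ-homomorphism : CommutativeRing.rawRing ℚ.+-*-commutativeRing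
                         ACR.-Raw-AlmostCommutative⟶ ℝ-ring
  fromℚ-homomorphism = record
    { ⟦_⟧    = fromℚ
    ; +-homo = λ _ _ → ≃-pointwise λ _ → refl
    ; *-homo = λ _ _ → ≃-pointwise λ _ → refl
    ; -‿homo = λ _ → ≃-pointwise λ _ → refl
    ; 0-homo = ≃-refl
    ; 1-homo = ≃-refl
    }

  weaklyDecidable : ∀ p q → Maybe (fromℚ p ≃ fromℚ q)
  weaklyDecidable p q with p ℚ.≟ q
  ... | yes refl = just ≃-refl
  ... | no _     = nothing

  open RingSolver (CommutativeRing.rawRing ℚ.+-*-commutativeRing) ℝ-ring
    fromℚ-homomorphism weaklyDecidable public

open ℝ-Solver using (solve; _:=_; _:+_; _:*_; _:-_; :-_; con) public

module ℚ-Solver where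
  open import Data.Rational.Solver
  open +-*-Solver public using () renaming
    (solve to ≡-solve; _:-_ to _⊟_; _:+_ to _⊞_; _:=_ to _⊜_; _:*_ to _⊠_; con to const)

≤-eventually : ∀ {x y} → Eventually (λ n → seq x n ℚ.≤ seq y n) → x ≤ y
≤-eventually h = mk≤ λ ε 0<ε → eventually (λ n → Rational.≤+nonneg (ℚ.<⇒≤ 0<ε)) h

≤-pointwise : ∀ {x y} → (∀ n → seq x n ℚ.≤ seq y n) → x ≤ y
≤-pointwise h = ≤-eventually (0 , λ n _ → h n)

≤-reflexive : ∀ {x y} → x ≃ y → x ≤ y
≤-reflexive {x} {y} (mk≃ h) = mk≤ λ ε 0<ε → eventually
  (λ n k → ℚ.≤-trans (Rational.≤+∣-∣ (seq x n) (seq y n)) (ℚ.+-monoʳ-≤ (seq y n) k)) (h ε 0<ε)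

≤-refl : ∀ {x} → x ≤ x
≤-refl = ≤-reflexive ≃-refl

≤-trans : ∀ {x y z} → x ≤ y → y ≤ z → x ≤ z
≤-trans {z = z} (mk≤ h) (mk≤ k) = mk≤ λ ε 0<ε → eventually
  (λ n (p , q) → Rational.halves-≤ {r = seq z n} {ε} p q) (both (h _ (½ε 0<ε)) (k _ (½ε 0<ε)))

≤-antisym : ∀ {x y} → x ≤ y → y ≤ x → x ≃ y
≤-antisym (mk≤ h) (mk≤ k) = mk≃ λ ε 0<ε → eventually
  (λ n (p , q) → Rational.∣-∣≤ p q) (both (h ε 0<ε) (k ε 0<ε))

ℝ-poset : Poset 0ℓ 0ℓ 0ℓ
ℝ-poset = record
  { Carrier = ℝ ; _≈_ = _≃_ ; _≤_ = _≤_
  ; isPartialOrder = record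
    { isPreorder = record
      { isEquivalence = ≃-isEquivalence ; reflexive = ≤-reflexive ; trans = ≤-trans }
    ; antisym = ≤-antisym
    }
  }

module ≤-Reasoning = Relation.Binary.Reasoning.PartialOrder ℝ-poset

≤-respˡ : ∀ {x y z} → x ≃ y → x ≤ z → y ≤ z
≤-respˡ h = ≤-trans (≤-reflexive (≃-sym h))

≤-respʳ : ∀ {x y z} → y ≃ z → x ≤ y → x ≤ z
≤-respʳ h k = ≤-trans k (≤-reflexive h)

+-mono-≤ : ∀ {x y u v} → x ≤ y → u ≤ v → x + u ≤ y + v
+-mono-≤ {y = y} {v = v} (mk≤ h) (mk≤ k) = mk≤ λ ε 0<ε → eventually
  (λ n (p , q) → Rational.halves-mono {q = seq y n} {s = seq v n} {ε} p q) (both (h _ (½ε 0<ε)) (k _ (½ε 0<ε)))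

≤⇒0≤- : ∀ {x y} → x ≤ y → 0ℝ ≤ y - x
≤⇒0≤- {x} h = ≤-respˡ (solve 1 (λ x → x :- x := con 0ℚ) ≃-refl x) (+-mono-≤ h (≤-refl { - x }))

-- In this form an inequality is derived by exhibiting y - x as a
-- manifestly nonnegative z and leaving the identity to the ring solver.
≤-by : ∀ {x y z} → 0ℝ ≤ z → y ≃ x + z → x ≤ y
≤-by {x} h e = ≤-trans
  (≤-respˡ (solve 1 (λ x → x :+ con 0ℚ := x) ≃-refl x) (+-mono-≤ (≤-refl {x}) h))
  (≤-reflexive (≃-sym e))

fromℚ-mono : ∀ {p q} → p ℚ.≤ q → fromℚ p ≤ fromℚ q
fromℚ-mono h = ≤-pointwise λ _ → h

-- If q < p, then half the gap as ε would give p ≤ q + ε < p.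
fromℚ-cancel-≤ : ∀ {p q} → fromℚ p ≤ fromℚ q → p ℚ.≤ q
fromℚ-cancel-≤ {p} {q} (mk≤ h) with p ℚ.≤? q
... | yes p≤q = p≤q
... | no p≰q = contradiction refl λ e → ℚ.<-irrefl e (ℚ.≤-<-trans
  (proj₂ (eventually-witness (h ε 0<ε)))
  (subst₂ ℚ._<_ (ℚ.+-comm ε q)
    (≡-solve 2 (λ p q → (p ⊟ q) ⊞ q ⊜ p) refl p q)
    (ℚ.+-monoˡ-< q (subst₂ ℚ._<_ (ℚ.*-comm (p ℚ.- q) ½) (ℚ.*-identityʳ (p ℚ.- q))
      (ℚ.*-monoʳ-<-pos (p ℚ.- q) {{ℚ.positive 0<p-q}} (from-yes (½ ℚ.<? 1ℚ)))))))
  where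
  open ℚ-Solver
  ε = ½ ℚ.* (p ℚ.- q)
  0<p-q : 0ℚ ℚ.< p ℚ.- q
  0<p-q = subst (ℚ._< p ℚ.- q) (ℚ.+-inverseʳ q) (ℚ.+-monoˡ-< (ℚ.- q) (ℚ.≰⇒> p≰q))
  0<ε : 0ℚ ℚ.< ε
  0<ε = ½ε 0<p-q

≤-closed : ∀ {x y} → (∀ ε → 0ℚ ℚ.< ε → x ≤ y + fromℚ ε) → x ≤ y
≤-closed {y = y} h = mk≤ λ ε 0<ε → eventually
  (λ n k → Rational.halves-≤ {r = seq y n} {ε} k ℚ.≤-refl) (_≤_.bound (h _ (½ε 0<ε)) _ (½ε 0<ε))

0≤∣∣ : ∀ x → 0ℝ ≤ ∣ x ∣
0≤∣∣ x = ≤-pointwise λ n → ℚ.0≤∣p∣ (seq x n)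

0≤⇒≃∣∣ : ∀ {x} → 0ℝ ≤ x → x ≃ ∣ x ∣
0≤⇒≃∣∣ {x} (mk≤ h) = mk≃ λ ε 0<ε → eventually
  (λ n → Rational.∣p-∣p∣∣≤ (seq x n) (ℚ.<⇒≤ 0<ε)) (h _ (½ε 0<ε))

∣*∣ : ∀ x y → ∣ x * y ∣ ≃ ∣ x ∣ * ∣ y ∣
∣*∣ x y = ≃-pointwise λ n → ℚ.∣p*q∣≡∣p∣*∣q∣ (seq x n) (seq y n)

-- Entries of a nonnegative real may be slightly negative, so the product is first identified with
-- `∣ x * y ∣`.
0≤* : ∀ {x y} → 0ℝ ≤ x → 0ℝ ≤ y → 0ℝ ≤ x * y
0≤* {x} {y} hx hy = ≤-respʳ
  (≃-trans (∣*∣ x y) (≃-sym (*-cong (0≤⇒≃∣∣ hx) (0≤⇒≃∣∣ hy)))) (0≤∣∣ (x * y))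

0≤+ : ∀ {x y} → 0ℝ ≤ x → 0ℝ ≤ y → 0ℝ ≤ x + y
0≤+ hx hy = ≤-respˡ (solve 0 (con 0ℚ :+ con 0ℚ := con 0ℚ) ≃-refl) (+-mono-≤ hx hy)

0≤x*x : ∀ x → 0ℝ ≤ x * x
0≤x*x x = ≤-pointwise λ n → ℚ-Lemmas.0≤p*p (seq x n)

0≤1ℝ : 0ℝ ≤ 1ℝ
0≤1ℝ = fromℚ-mono ℚ-Lemmas.0≤1

*-monoˡ-≤ : ∀ {x y z} → 0ℝ ≤ z → x ≤ y → z * x ≤ z * y
*-monoˡ-≤ {x} {y} {z} hz h = ≤-by (0≤* hz (≤⇒0≤- h))
  (solve 3 (λ x y z → z :* y := z :* x :+ z :* (y :- x)) ≃-refl x y z)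

*-monoʳ-≤ : ∀ {x y z} → 0ℝ ≤ z → x ≤ y → x * z ≤ y * z
*-monoʳ-≤ {x} {y} {z} hz h = ≤-by (0≤* hz (≤⇒0≤- h))
  (solve 3 (λ x y z → y :* z := x :* z :+ z :* (y :- x)) ≃-refl x y z)

*-mono-≤ : ∀ {x y u v} → 0ℝ ≤ x → 0ℝ ≤ v → x ≤ y → u ≤ v → x * u ≤ y * v
*-mono-≤ hx hv h k = ≤-trans (*-monoˡ-≤ hx k) (*-monoʳ-≤ hv h)

-- Absolute values

x≤∣x∣ : ∀ x → x ≤ ∣ x ∣
x≤∣x∣ x = ≤-pointwise λ n → ℚ-Lemmas.p≤∣p∣ (seq x n)

∣-x∣ : ∀ x → ∣ - x ∣ ≃ ∣ x ∣
∣-x∣ x = ≃-pointwise λ n → ℚ.∣-p∣≡∣p∣ (seq x n)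

-x≤∣x∣ : ∀ x → - x ≤ ∣ x ∣
-x≤∣x∣ x = ≤-respʳ (∣-x∣ x) (x≤∣x∣ (- x))

∣∣≤ : ∀ {x y} → x ≤ y → - x ≤ y → ∣ x ∣ ≤ y
∣∣≤ (mk≤ h) (mk≤ k) = mk≤ λ ε 0<ε → eventually
  (λ n (p , q) → ℚ-Lemmas.∣p∣≤ p q) (both (h ε 0<ε) (k ε 0<ε))

∣∣≤-+ : ∀ {x y a b} → ∣ x ∣ ≤ a → ∣ y ∣ ≤ b → ∣ x + y ∣ ≤ a + b
∣∣≤-+ {x} {y} h k = ≤-trans
  (≤-pointwise λ n → ℚ.∣p+q∣≤∣p∣+∣q∣ (seq x n) (seq y n)) (+-mono-≤ h k)

∣∣≤-neg : ∀ {x a} → ∣ x ∣ ≤ a → ∣ - x ∣ ≤ a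
∣∣≤-neg {x} = ≤-respˡ (≃-sym (∣-x∣ x))

∣∣≤-- : ∀ {x y a b} → ∣ x ∣ ≤ a → ∣ y ∣ ≤ b → ∣ x - y ∣ ≤ a + b
∣∣≤-- h k = ∣∣≤-+ h (∣∣≤-neg k)

∣∣≤-* : ∀ {x y a b} → ∣ x ∣ ≤ a → ∣ y ∣ ≤ b → ∣ x * y ∣ ≤ a * b
∣∣≤-* {x} {y} h k = ≤-respˡ (≃-sym (∣*∣ x y))
  (*-mono-≤ (0≤∣∣ x) (≤-trans (0≤∣∣ y) k) h k)

∣∣≤-by : ∀ {x y a b} → x ≃ y → ∣ y ∣ ≤ a → a ≤ b → ∣ x ∣ ≤ b
∣∣≤-by e h k = ≤-trans (≤-respˡ (∣∣-cong (≃-sym e)) h) k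

0≤⇒∣∣≤ : ∀ {x a} → 0ℝ ≤ x → x ≤ a → ∣ x ∣ ≤ a
0≤⇒∣∣≤ h = ≤-respˡ (0≤⇒≃∣∣ h)

∣x∣*∣x∣ : ∀ x → ∣ x ∣ * ∣ x ∣ ≃ x * x
∣x∣*∣x∣ x = ≃-trans (≃-sym (∣*∣ x x)) (≃-sym (0≤⇒≃∣∣ (0≤x*x x)))

∣-∣-sym : ∀ x y → ∣ x - y ∣ ≃ ∣ y - x ∣
∣-∣-sym x y = ≃-pointwise λ n → ℚ-Lemmas.∣∣-sym (seq x n) (seq y n)

∣-∣≤⇒≤+ : ∀ {x y a} → ∣ x - y ∣ ≤ a → x ≤ y + a
∣-∣≤⇒≤+ {x} {y} h = ≤-respˡ (solve 2 (λ x y → y :+ (x :- y) := x) ≃-refl x y)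
  (+-mono-≤ (≤-refl {y}) (≤-trans (x≤∣x∣ (x - y)) h))

∣-∣≤⇒≃ : ∀ {x y} → (∀ ε → 0ℚ ℚ.< ε → ∣ x - y ∣ ≤ fromℚ ε) → x ≃ y
∣-∣≤⇒≃ {x} {y} h = ≤-antisym (≤-closed λ ε 0<ε → ∣-∣≤⇒≤+ (h ε 0<ε))
  (≤-closed λ ε 0<ε → ∣-∣≤⇒≤+ (≤-respˡ (∣-∣-sym x y) (h ε 0<ε)))

≃⇒∣-∣≤ : ∀ {x y a} → x ≃ y → 0ℝ ≤ a → ∣ x - y ∣ ≤ a
≃⇒∣-∣≤ {x} {y} e = ≤-trans (≤-reflexive (≃-trans
  (∣∣-cong (≃-trans (+-cong e ≃-refl) (solve 1 (λ y → y :- y := con 0ℚ) ≃-refl y)))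
  (≃-pointwise λ _ → refl)))

bounded : ∀ x → ∃[ B ] 0ℚ ℚ.< B × ∣ x ∣ ≤ fromℚ B
bounded x = let B , 0<B , h = Cauchy.bounded {seq x} (cauchy x) in B , 0<B , ≤-eventually h

-- Strict inequalities

<-≤-trans : ∀ {x y z} → x < y → y ≤ z → x < z
<-≤-trans {x} {z = z} (mk< g 0<g h) (mk≤ k) = mk< (½ ℚ.* g) (½ε 0<g) (eventually
  (λ n (p , q) → cancel {seq x n} {c = seq z n} p q) (both h (k _ (½ε 0<g))))
  where
  open ℚ-Solver
  cancel : ∀ {a b c} → a ℚ.+ g ℚ.≤ b → b ℚ.≤ c ℚ.+ ½ ℚ.* g → a ℚ.+ ½ ℚ.* g ℚ.≤ c
  cancel {a} {b} {c} p q = subst₂ ℚ._≤_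
    (≡-solve 2 (λ a g → a ⊞ g ⊟ const ½ ⊠ g ⊜ a ⊞ const ½ ⊠ g) refl a g)
    (≡-solve 2 (λ c g → c ⊞ const ½ ⊠ g ⊟ const ½ ⊠ g ⊜ c) refl c g)
    (ℚ.+-monoˡ-≤ (ℚ.- (½ ℚ.* g)) (ℚ.≤-trans p q))

0<fromℚ : ∀ {p} → 0ℚ ℚ.< p → 0ℝ < fromℚ p
0<fromℚ 0<p = eventually-≥⇒0< 0<p (0 , λ _ _ → ℚ.≤-refl)

fromℚ≤⇒0< : ∀ {p x} → 0ℚ ℚ.< p → fromℚ p ≤ x → 0ℝ < x
fromℚ≤⇒0< 0<p = <-≤-trans (0<fromℚ 0<p)

0<⇒fromℚ≤ : ∀ {x} → 0ℝ < x → ∃[ p ] 0ℚ ℚ.< p × fromℚ p ≤ x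
0<⇒fromℚ≤ 0<x = _<_.gap 0<x , _<_.gap-pos 0<x , ≤-eventually (eventually-≥ 0<x)

-- Reals cannot be compared by cases, but rational entries can. At an index k beyond which both
-- sequences stay within η = ε / 8 of their k-th entries, either xₖ ≤ yₖ + 6η, whence x ≤ y + 8η, or
-- xₖ ≥ yₖ + 6η, which leaves a positive gap between y and x.
≮⇒≥ : ∀ {x y} → ¬ (y < x) → x ≤ y
≮⇒≥ {x} {y} y≮x = ≤-closed λ ε 0<ε →
  let M , hx = cauchy x (η ε) (0<η 0<ε)
      N , hy = cauchy y (η ε) (0<η 0<ε)
      k = M ℕ.⊔ N
  in decide 0<ε k
    (λ n k≤n → hx n k (ℕ.m⊔n≤o⇒m≤o M N k≤n) (ℕ.m≤m⊔n M N))
    (λ n k≤n → hy n k (ℕ.m⊔n≤o⇒n≤o M N k≤n) (ℕ.m≤n⊔m M N))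
  where
  open ℚ-Solver
  η : ℚ → ℚ
  η ε = ½ ℚ.* (½ ℚ.* (½ ℚ.* ε))
  0<η : ∀ {ε} → 0ℚ ℚ.< ε → 0ℚ ℚ.< η ε
  0<η 0<ε = ½ε (½ε (½ε 0<ε))
  six : ℚ
  six = + 6 ℚ./ 1
  near : ∀ p q {r} → ℚ.∣ p ℚ.- q ∣ ℚ.≤ r → p ℚ.≤ q ℚ.+ r
  near p q h = ℚ.≤-trans (Rational.≤+∣-∣ p q) (ℚ.+-monoʳ-≤ q h)
  reverse : ∀ p q {r} → ℚ.∣ p ℚ.- q ∣ ℚ.≤ r → q ℚ.≤ p ℚ.+ r
  reverse p q h = near q p (subst (ℚ._≤ _) (ℚ-Lemmas.∣∣-sym p q) h)
  decide : ∀ {ε} → 0ℚ ℚ.< ε → ∀ k →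
    (∀ n → k ℕ.≤ n → ℚ.∣ seq x n ℚ.- seq x k ∣ ℚ.≤ η ε) →
    (∀ n → k ℕ.≤ n → ℚ.∣ seq y n ℚ.- seq y k ∣ ℚ.≤ η ε) → x ≤ y + fromℚ ε
  decide {ε} 0<ε k hx hy with ℚ.≤-total (seq x k) (seq y k ℚ.+ six ℚ.* η ε)
  ... | inj₁ h = ≤-eventually (k , λ n k≤n → subst (seq x n ℚ.≤_)
    (≡-solve 2 (λ b ε → let η = const ½ ⊠ (const ½ ⊠ (const ½ ⊠ ε)) in
      b ⊞ η ⊞ const six ⊠ η ⊞ η ⊜ b ⊞ ε) refl (seq y n) ε)
    (ℚ.≤-trans (near (seq x n) (seq x k) (hx n k≤n)) (ℚ.+-monoˡ-≤ (η ε)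
      (ℚ.≤-trans h (ℚ.+-monoˡ-≤ (six ℚ.* η ε) (reverse (seq y n) (seq y k) (hy n k≤n)))))))
  ... | inj₂ h = contradiction (mk< (η ε) (0<η 0<ε) (k , λ n k≤n →
    ℚ.≤-trans (Rational.≤+nonneg
        (ℚ.<⇒≤ (ℚ-Lemmas.0<* {+ 3 ℚ./ 1} (from-yes (0ℚ ℚ.<? + 3 ℚ./ 1)) (0<η 0<ε)))
        (ℚ.+-monoˡ-≤ (η ε) (near (seq y n) (seq y k) (hy n k≤n))))
      (subst₂ ℚ._≤_
        (≡-solve 2 (λ b η → b ⊞ const six ⊠ η ⊟ η ⊜ b ⊞ η ⊞ η ⊞ const (+ 3 ℚ./ 1) ⊠ η) refl
          (seq y k) (η ε))
        (≡-solve 2 (λ a η → a ⊞ η ⊟ η ⊜ a) refl (seq x n) (η ε))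
        (ℚ.+-monoˡ-≤ (ℚ.- η ε) (ℚ.≤-trans h (reverse (seq x n) (seq x k) (hx n k≤n))))))) y≮x

*-recip : ∀ x (0<x : 0ℝ < x) → x * recip x 0<x ≃ 1ℝ
*-recip x 0<x = mk≃ λ ε 0<ε → eventually
  (λ n h → ℚ.≤-trans (ℚ.≤-reflexive (cong (λ t → ℚ.∣ t ℚ.- 1ℚ ∣) h)) (ℚ.<⇒≤ 0<ε))
  (recip-inverse 0<x)

*-cancelˡ-≤ : ∀ {x y z} → 0ℝ < z → z * x ≤ z * y → x ≤ y
*-cancelˡ-≤ {x} {y} {z} 0<z h = ≤-respˡ (cancel x) (≤-respʳ (cancel y)
  (*-monoˡ-≤ (<⇒≤ (recip-pos 0<z)) h))
  where
  cancel : ∀ t → recip z 0<z * (z * t) ≃ t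
  cancel t = ≃-trans (solve 3 (λ r z t → r :* (z :* t) := z :* r :* t) ≃-refl (recip z 0<z) z t)
    (≃-trans (*-cong (*-recip z 0<z) ≃-refl) (solve 1 (λ t → con 1ℚ :* t := t) ≃-refl t))

-- Limits

∣-∣-triangle : ∀ {x y z a b} → ∣ x - y ∣ ≤ a → ∣ y - z ∣ ≤ b → ∣ x - z ∣ ≤ a + b
∣-∣-triangle {x} {y} {z} h k = ∣∣≤-by
  (solve 3 (λ x y z → x :- z := (x :- y) :+ (y :- z)) ≃-refl x y z) (∣∣≤-+ h k) ≤-refl

fromℚ-halves : ∀ ε → fromℚ (½ ℚ.* ε) + fromℚ (½ ℚ.* ε) ≤ fromℚ ε
fromℚ-halves ε = ≤-pointwise λ _ → ℚ.≤-reflexive (ℚ-Lemmas.halves ε)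

infix 4 _⟶_

record _⟶_ (u : ℕ → ℝ) (l : ℝ) : Set where
  constructor mk⟶
  field near : ∀ ε → 0ℚ ℚ.< ε → Eventually (λ n → ∣ u n - l ∣ ≤ fromℚ ε)

⟶-≃ : ∀ {u l} → (∀ n → u n ≃ l) → u ⟶ l
⟶-≃ h = mk⟶ λ ε 0<ε → 0 , λ n _ → ≃⇒∣-∣≤ (h n) (fromℚ-mono (ℚ.<⇒≤ 0<ε))

⟶-cong : ∀ {u v l k} → (∀ n → u n ≃ v n) → l ≃ k → u ⟶ l → v ⟶ k
⟶-cong h e (mk⟶ c) = mk⟶ λ ε 0<ε → eventually
  (λ n → ≤-respˡ (∣∣-cong (+-cong (h n) (-‿cong e)))) (c ε 0<ε)

⟶-+ : ∀ {u v l k} → u ⟶ l → v ⟶ k → (λ n → u n + v n) ⟶ l + k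
⟶-+ {u} {v} {l} {k} (mk⟶ c) (mk⟶ d) = mk⟶ λ ε 0<ε → eventually
  (λ n (p , q) → ∣∣≤-by
    (solve 4 (λ u v l k → u :+ v :- (l :+ k) := (u :- l) :+ (v :- k)) ≃-refl (u n) (v n) l k)
    (∣∣≤-+ p q) (fromℚ-halves ε))
  (both (c _ (½ε 0<ε)) (d _ (½ε 0<ε)))

⟶-neg : ∀ {u l} → u ⟶ l → (λ n → - u n) ⟶ - l
⟶-neg {u} {l} (mk⟶ c) = mk⟶ λ ε 0<ε → eventually
  (λ n p → ∣∣≤-by (solve 2 (λ u l → :- u :- :- l := :- (u :- l)) ≃-refl (u n) l)
    (∣∣≤-neg p) ≤-refl) (c ε 0<ε)

⟶-*ˡ : ∀ {u l} c → u ⟶ l → (λ n → c * u n) ⟶ c * l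
⟶-*ˡ {u} {l} c (mk⟶ h) = mk⟶ λ ε 0<ε →
  let B , 0<B , c≤B = bounded c in eventually
  (λ n p → ∣∣≤-by (solve 3 (λ c u l → c :* u :- c :* l := c :* (u :- l)) ≃-refl c (u n) l)
    (∣∣≤-* c≤B p)
    (≤-pointwise λ _ → ℚ.≤-reflexive (trans
      (≡-solve 3 (λ b e r → b ⊠ (e ⊠ r) ⊜ e ⊠ (b ⊠ r)) refl B ε (ℚ-Lemmas.recip B 0<B))
      (trans (cong (ε ℚ.*_) (ℚ-Lemmas.*-recip B 0<B)) (ℚ.*-identityʳ ε)))))
  (h (ε ℚ.* ℚ-Lemmas.recip B 0<B) (ℚ-Lemmas.0<* 0<ε (ℚ-Lemmas.recip-pos B 0<B)))
  where open ℚ-Solver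

⟶-∣∣ : ∀ {u l} → u ⟶ l → (λ n → ∣ u n ∣) ⟶ ∣ l ∣
⟶-∣∣ {u} {l} (mk⟶ c) = mk⟶ λ ε 0<ε → eventually
  (λ n → ≤-trans (≤-pointwise λ m → ℚ-Lemmas.∣∣p∣-∣q∣∣≤∣p-q∣ (seq (u n) m) (seq l m))) (c ε 0<ε)

⟶-suc : ∀ {u l} → u ⟶ l → (λ n → u (suc n)) ⟶ l
⟶-suc (mk⟶ c) = mk⟶ λ ε 0<ε → let N , h = c ε 0<ε in
  N , λ n N≤n → h (suc n) (ℕ.m≤n⇒m≤1+n N≤n)

⟶-≤ : ∀ {u v l k} → Eventually (λ n → u n ≤ v n) → u ⟶ l → v ⟶ k → l ≤ k
⟶-≤ {u} {v} {l} {k} h (mk⟶ c) (mk⟶ d) = ≤-closed λ ε 0<ε →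
  let n , u≤v , p , q = eventually-witness (both h (both (c _ (½ε 0<ε)) (d _ (½ε 0<ε))))
  in ≤-trans (∣-∣≤⇒≤+ (≤-respˡ (∣-∣-sym (u n) l) p))
    (≤-trans (+-mono-≤ (≤-trans u≤v (∣-∣≤⇒≤+ q)) (≤-refl {fromℚ (½ ℚ.* ε)}))
      (≤-respˡ (solve 2 (λ k e → k :+ (e :+ e) := k :+ e :+ e) ≃-refl k (fromℚ (½ ℚ.* ε)))
        (+-mono-≤ (≤-refl {k}) (fromℚ-halves ε))))

always : ∀ {P : ℕ → Set} → (∀ n → P n) → Eventually P
always h = 0 , λ n _ → h n

⟶-unique : ∀ {u l k} → u ⟶ l → u ⟶ k → l ≃ k
⟶-unique c d = ≤-antisym (⟶-≤ (always λ _ → ≤-refl) c d) (⟶-≤ (always λ _ → ≤-refl) d c)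

⟶-0 : ∀ {u v} → (∀ n → ∣ u n ∣ ≤ v n) → v ⟶ 0ℝ → u ⟶ 0ℝ
⟶-0 {u} {v} h (mk⟶ c) = mk⟶ λ ε 0<ε → eventually
  (λ n p → ∣∣≤-by (solve 1 (λ u → u :- con 0ℚ := u) ≃-refl (u n)) (h n)
    (≤-trans (≤-trans (x≤∣x∣ (v n))
      (≤-reflexive (∣∣-cong (solve 1 (λ v → v := v :- con 0ℚ) ≃-refl (v n))))) p))
  (c ε 0<ε)

-- Bernoulli's inequality rⁿ (1 + n (1 - r)) ≤ 1 forces rⁿ ≤ ε as soon as ε (1 - r) n ≥ 1.
^-⟶-0 : ∀ {r} → 0ℚ ℚ.≤ r → r ℚ.< 1ℚ → (λ n → fromℚ (r ℚ-Lemmas.^ n)) ⟶ 0ℝ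
^-⟶-0 {r} 0≤r r<1 = mk⟶ λ ε 0<ε →
  let N , large = ℚ-Lemmas.archimedean 1ℚ (ℚ-Lemmas.0<* 0<ε 0<h)
  in N , λ n N≤n → ≤-respˡ (0≤⇒≃∣∣ (≤-respʳ (≃-sym (minus0 n)) (fromℚ-mono (ℚ-Lemmas.0≤^ 0≤r n))))
    (≤-respˡ (≃-sym (minus0 n)) (fromℚ-mono (small ε 0<ε N n large N≤n)))
  where
  open ℚ-Solver
  h : ℚ
  h = 1ℚ ℚ.- r
  0<h : 0ℚ ℚ.< h
  0<h = subst (ℚ._< h) (ℚ.+-inverseʳ r) (ℚ.+-monoˡ-< (ℚ.- r) r<1)
  minus0 : ∀ n → fromℚ (r ℚ-Lemmas.^ n) - 0ℝ ≃ fromℚ (r ℚ-Lemmas.^ n)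
  minus0 n = solve 1 (λ v → v :- con 0ℚ := v) ≃-refl _
  small : ∀ ε → 0ℚ ℚ.< ε → ∀ N n → 1ℚ ℚ.≤ ε ℚ.* h ℚ.* ℚ-Lemmas.fromℕ N → N ℕ.≤ n →
    r ℚ-Lemmas.^ n ℚ.≤ ε
  small ε 0<ε N n large N≤n = ℚ-Lemmas.*-cancelˡ
    (ℚ-Lemmas.0<+ ℚ-Lemmas.0<1 (ℚ-Lemmas.0≤* (ℚ-Lemmas.0≤fromℕ n) (ℚ.<⇒≤ 0<h))) (begin
    (1ℚ ℚ.+ m ℚ.* h) ℚ.* r ℚ-Lemmas.^ n
      ≡⟨ ℚ.*-comm (1ℚ ℚ.+ m ℚ.* h) (r ℚ-Lemmas.^ n) ⟩
    r ℚ-Lemmas.^ n ℚ.* (1ℚ ℚ.+ m ℚ.* h)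
      ≤⟨ ℚ-Lemmas.geometric-decay 0≤r n ⟩
    1ℚ
      ≤⟨ large ⟩
    ε ℚ.* h ℚ.* ℚ-Lemmas.fromℕ N
      ≤⟨ ℚ-Lemmas.*-monoˡ (ℚ.<⇒≤ (ℚ-Lemmas.0<* 0<ε 0<h)) (ℚ-Lemmas.fromℕ-mono {N} {n} N≤n) ⟩
    ε ℚ.* h ℚ.* m
      ≤⟨ Rational.≤+nonneg (ℚ.<⇒≤ 0<ε) ℚ.≤-refl ⟩
    ε ℚ.* h ℚ.* m ℚ.+ ε
      ≡⟨ ≡-solve 3 (λ e h m → e ⊠ h ⊠ m ⊞ e ⊜ (const 1ℚ ⊞ m ⊠ h) ⊠ e) refl ε h m ⟩
    (1ℚ ℚ.+ m ℚ.* h) ℚ.* ε ∎)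
    where
    open ℚ.≤-Reasoning
    m = ℚ-Lemmas.fromℕ n

-- Completeness of the reals

CauchySequence : (ℕ → ℝ) → Set
CauchySequence u = ∀ ε → 0ℚ ℚ.< ε →
  ∃[ N ] (∀ m n → N ℕ.≤ m → N ℕ.≤ n → ∣ u m - u n ∣ ≤ fromℚ ε)

module Completeness (u : ℕ → ℝ) (cu : CauchySequence u) where

  modulus : ∀ k → ∃[ N ] (∀ m n → N ℕ.≤ m → N ℕ.≤ n →
    ℚ.∣ seq (u k) m ℚ.- seq (u k) n ∣ ℚ.≤ ℚ-Lemmas.1/suc k)
  modulus k = cauchy (u k) (ℚ-Lemmas.1/suc k) (ℚ-Lemmas.1/suc-pos k)

  -- The plain diagonal `seq (u k) k` need not converge, since the moduli of the `u k` are
  -- unrelated; the entry is taken where `u k` has settled to within 1 / (k + 1).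
  approximant : ℕ → ℚ
  approximant k = seq (u k) (proj₁ (modulus k))

  approximates : ∀ k → ∣ u k - fromℚ (approximant k) ∣ ≤ fromℚ (ℚ-Lemmas.1/suc k)
  approximates k = ≤-eventually (proj₁ (modulus k) , λ n h →
    proj₂ (modulus k) n (proj₁ (modulus k)) h ℕ.≤-refl)

  1/suc-small : ∀ ε → 0ℚ ℚ.< ε → Eventually (λ n → ℚ-Lemmas.1/suc n ℚ.≤ ε)
  1/suc-small ε 0<ε = let N , large = ℚ-Lemmas.archimedean 1ℚ 0<ε in N , λ n N≤n → begin
    ℚ-Lemmas.1/suc n
      ≡⟨ sym (ℚ.*-identityˡ _) ⟩
    1ℚ ℚ.* ℚ-Lemmas.1/suc n
      ≤⟨ ℚ-Lemmas.*-monoʳ (ℚ.<⇒≤ (ℚ-Lemmas.1/suc-pos n)) (ℚ.≤-trans large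
           (ℚ-Lemmas.*-monoˡ (ℚ.<⇒≤ 0<ε) (ℚ-Lemmas.fromℕ-mono {N} {suc n} (ℕ.m≤n⇒m≤1+n N≤n)))) ⟩
    ε ℚ.* ℚ-Lemmas.fromℕ (suc n) ℚ.* ℚ-Lemmas.1/suc n
      ≡⟨ trans (ℚ.*-assoc ε _ _) (cong (ε ℚ.*_) (ℚ-Lemmas.fromℕ-*-1/suc n)) ⟩
    ε ℚ.* 1ℚ
      ≡⟨ ℚ.*-identityʳ ε ⟩
    ε ∎
    where open ℚ.≤-Reasoning

  approximant-cauchy : IsCauchy approximant
  approximant-cauchy ε 0<ε =
    let δ = ℚ-Lemmas.⅓ ℚ.* ε
        0<δ = ℚ-Lemmas.0<* ℚ-Lemmas.0<⅓ 0<ε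
        M , small = 1/suc-small δ 0<δ
        N , close = cu δ 0<δ
    in M ℕ.⊔ N , λ m n hm hn → fromℚ-cancel-≤ (≤-trans
      (≤-respˡ (≃-pointwise {∣ fromℚ (approximant m) - fromℚ (approximant n) ∣} λ _ → refl)
        (∣-∣-triangle
          (∣-∣-triangle
            (≤-trans (≤-respˡ (∣-∣-sym (u m) (fromℚ (approximant m))) (approximates m))
              (fromℚ-mono (small m (ℕ.m⊔n≤o⇒m≤o M N hm))))
            (close m n (ℕ.m⊔n≤o⇒n≤o M N hm) (ℕ.m⊔n≤o⇒n≤o M N hn)))
          (≤-trans (approximates n) (fromℚ-mono (small n (ℕ.m⊔n≤o⇒m≤o M N hn))))))
      (≤-pointwise λ _ → ℚ.≤-reflexive (ℚ-Lemmas.thirds ε)))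

  limit : ℝ
  limit = mkℝ approximant approximant-cauchy

  converges : u ⟶ limit
  converges = mk⟶ λ ε 0<ε →
    let M , close = approximant-cauchy (½ ℚ.* ε) (½ε 0<ε) in eventually
    (λ n (small , M≤n) → ≤-trans
      (∣-∣-triangle (≤-trans (approximates n) (fromℚ-mono small))
        (≤-eventually (M , λ m M≤m → close n m M≤n M≤m)))
      (fromℚ-halves ε))
    (both (1/suc-small (½ ℚ.* ε) (½ε 0<ε)) (M , λ _ h → h))

-- The tail bound is uniform in the entry index, so it also holds along the diagonal that represents
-- the sum; both sides are compared with the partial sum at `N`.
series-⟶ : ∀ a dom → partialSum a ⟶ series a dom
series-⟶ a dom = mk⟶ λ ε 0<ε →
  let N , P , close = Series.uniform-tail a dom (½ ℚ.* ε) (½ε 0<ε)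
  in N , λ m N≤m → ≤-trans
    (∣-∣-triangle {y = partialSum a N}
      (≤-eventually {y = fromℚ (½ ℚ.* ε)} (P , λ n P≤n → close n P≤n m N≤m))
      (≤-respˡ (∣-∣-sym (series a dom) (partialSum a N))
        (≤-eventually {y = fromℚ (½ ℚ.* ε)} (P ℕ.⊔ N , λ n h →
          close n (ℕ.m⊔n≤o⇒m≤o P N h) n (ℕ.m⊔n≤o⇒n≤o P N h)))))
    (fromℚ-halves ε)

-- A function whose increments are quadratically small: bisecting the
-- interval n times divides the bound by 2ⁿ.
module Constancy {D : ℝ → Set} (f : ∀ x → D x → ℝ) (K : ℝ)
  (midpoint : ∀ {x y} → D x → D y → D (½ᴿ * (x + y)))
  (quadratic : ∀ x y p q → ∣ f x p - f y q ∣ ≤ K * ((x - y) * (x - y))) where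

  bisected : ∀ n x y p q →
    ∣ f x p - f y q ∣ ≤ fromℚ (½ ℚ-Lemmas.^ n) * (K * ((x - y) * (x - y)))
  bisected zero x y p q = ≤-respʳ (solve 1 (λ t → t := con 1ℚ :* t) ≃-refl _) (quadratic x y p q)
  bisected (suc n) x y p q = ≤-respʳ
    (≃-trans
      (solve 4 (λ k x y c →
         c :* (k :* ((x :- con ½ :* (x :+ y)) :* (x :- con ½ :* (x :+ y))))
           :+ c :* (k :* ((con ½ :* (x :+ y) :- y) :* (con ½ :* (x :+ y) :- y)))
         := con ½ :* c :* (k :* ((x :- y) :* (x :- y)))) ≃-refl K x y (fromℚ (½ ℚ-Lemmas.^ n)))
      (*-cong (≃-pointwise λ _ → refl) ≃-refl))
    (∣-∣-triangle (bisected n x (½ᴿ * (x + y)) p (midpoint p q))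
                  (bisected n (½ᴿ * (x + y)) y (midpoint p q) q))

  constant : ∀ x y p q → f x p ≃ f y q
  constant x y p q = ∣-∣≤⇒≃ λ ε 0<ε →
    let n , h = eventually-witness (_⟶_.near vanishing ε 0<ε)
    in ≤-trans (bisected n x y p q) (≤-trans
      (≤-trans (x≤∣x∣ _) (≤-reflexive (∣∣-cong (solve 2 (λ c k → c :* k := k :* c :- k :* con 0ℚ)
        ≃-refl (fromℚ (½ ℚ-Lemmas.^ n)) (K * ((x - y) * (x - y))))))) h)
    where
    vanishing = ⟶-*ˡ (K * ((x - y) * (x - y)))
      (^-⟶-0 (ℚ.<⇒≤ ℚ-Lemmas.0<½) (from-yes (½ ℚ.<? 1ℚ)))

-- The exponential function

-- Ring identities modulo the relation p ≃ q, whose cofactor a is supplied by hand.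
modulo : ∀ {p q x y a} → p ≃ q → x ≃ y + a * (p - q) → x ≃ y
modulo {p} {q} {x} {y} {a} e h = ≃-trans h (≃-trans
  (+-cong ≃-refl (*-cong ≃-refl (+-cong e ≃-refl)))
  (solve 3 (λ y a q → y :+ a :* (q :- q) := y) ≃-refl y a q))

fromℚ-fromℕ-suc : ∀ n → fromℚ (ℚ-Lemmas.fromℕ (suc n)) ≃ 1ℝ + fromℚ (ℚ-Lemmas.fromℕ n)
fromℚ-fromℕ-suc n = ≃-pointwise λ _ → ℚ-Lemmas.fromℕ-suc n

fromℕ-1/suc : ∀ n → fromℚ (ℚ-Lemmas.fromℕ (suc n)) * fromℚ (ℚ-Lemmas.1/suc n) ≃ 1ℝ
fromℕ-1/suc n = ≃-pointwise λ _ → ℚ-Lemmas.fromℕ-*-1/suc n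

0≤1/suc : ∀ n → 0ℝ ≤ fromℚ (ℚ-Lemmas.1/suc n)
0≤1/suc n = fromℚ-mono (ℚ.<⇒≤ (ℚ-Lemmas.1/suc-pos n))

partialSum-cong : ∀ {a b} → (∀ k → a k ≃ b k) → ∀ n → partialSum a n ≃ partialSum b n
partialSum-cong h zero    = ≃-refl
partialSum-cong h (suc n) = +-cong (partialSum-cong h n) (h n)

series-cong : ∀ {a b} d e → (∀ k → a k ≃ b k) → series a d ≃ series b e
series-cong {a} {b} d e h = ⟶-unique
  (⟶-cong (partialSum-cong h) ≃-refl (series-⟶ a d)) (series-⟶ b e)

partialSum-∣∣≤ : ∀ {a b} → (∀ k → ∣ a k ∣ ≤ b k) → ∀ n → ∣ partialSum a n ∣ ≤ partialSum b n
partialSum-∣∣≤ h zero    = ≤-pointwise λ _ → ℚ.≤-refl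
partialSum-∣∣≤ h (suc n) = ∣∣≤-+ (partialSum-∣∣≤ h n) (h n)

expTerm-∣∣≤ : ∀ {x B} → ∣ x ∣ ≤ B → ∀ k → ∣ expTerm x k ∣ ≤ expTerm B k
expTerm-∣∣≤ h zero    = ≤-pointwise λ _ → ℚ.≤-refl
expTerm-∣∣≤ h (suc k) = ∣∣≤-* (∣∣≤-* (expTerm-∣∣≤ h k) h) (0≤⇒∣∣≤ (0≤1/suc k) ≤-refl)

expTerm-cong : ∀ {x y} → x ≃ y → ∀ k → expTerm x k ≃ expTerm y k
expTerm-cong h zero    = ≃-refl
expTerm-cong h (suc k) = *-cong (*-cong (expTerm-cong h k) h) ≃-refl

expTerm-nonneg : ∀ {x} → 0ℝ ≤ x → ∀ k → 0ℝ ≤ expTerm x k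
expTerm-nonneg h zero    = 0≤1ℝ
expTerm-nonneg h (suc k) = 0≤* (0≤* (expTerm-nonneg h k) h) (0≤1/suc k)

exp-⟶ : ∀ x → partialSum (expTerm x) ⟶ exp x
exp-⟶ x = series-⟶ (expTerm x) (Bounds.exp-dominated x)

exp-cong : ∀ {x y} → x ≃ y → exp x ≃ exp y
exp-cong {x} {y} h = series-cong (Bounds.exp-dominated x) (Bounds.exp-dominated y) (expTerm-cong h)

exp-∣∣≤ : ∀ {x B} → ∣ x ∣ ≤ B → ∣ exp x ∣ ≤ exp B
exp-∣∣≤ {x} {B} h = ⟶-≤ (always (partialSum-∣∣≤ (expTerm-∣∣≤ h))) (⟶-∣∣ (exp-⟶ x)) (exp-⟶ B)

exp-0 : exp 0ℝ ≃ 1ℝ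
exp-0 = ⟶-unique (⟶-suc (exp-⟶ 0ℝ)) (⟶-≃ sum)
  where
  vanish : ∀ k → expTerm 0ℝ (suc k) ≃ 0ℝ
  vanish k = solve 2 (λ t u → t :* con 0ℚ :* u := con 0ℚ) ≃-refl (expTerm 0ℝ k) _
  sum : ∀ n → partialSum (expTerm 0ℝ) (suc n) ≃ 1ℝ
  sum zero    = solve 0 (con 0ℚ :+ con 1ℚ := con 1ℚ) ≃-refl
  sum (suc n) = ≃-trans (+-cong (sum n) (vanish n)) (solve 0 (con 1ℚ :+ con 0ℚ := con 1ℚ) ≃-refl)

1+x≤exp : ∀ {x} → 0ℝ ≤ x → 1ℝ + x ≤ exp x
1+x≤exp {x} 0≤x = ⟶-≤ (always lower) (⟶-≃ λ _ → ≃-refl) (⟶-suc (⟶-suc (exp-⟶ x)))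
  where
  lower : ∀ n → 1ℝ + x ≤ partialSum (expTerm x) (suc (suc n))
  lower zero    = ≤-reflexive
    (solve 1 (λ x → con 1ℚ :+ x := con 0ℚ :+ con 1ℚ :+ con 1ℚ :* x :* con 1ℚ) ≃-refl x)
  lower (suc n) = ≤-by {z = z} (0≤+ (≤⇒0≤- (lower n)) (expTerm-nonneg 0≤x (suc (suc n))))
    (solve 3 (λ x s t → s :+ t := con 1ℚ :+ x :+ ((s :- (con 1ℚ :+ x)) :+ t)) ≃-refl x _ _)
    where
    z = (partialSum (expTerm x) (suc (suc n)) - (1ℝ + x)) + expTerm x (suc (suc n))

module ExpQuadratic {x y B : ℝ} (∣x∣≤B : ∣ x ∣ ≤ B) (∣y∣≤B : ∣ y ∣ ≤ B) where

  h² : ℝ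
  h² = (x - y) * (x - y)

  -- The derivative of the exponential term of index k + 2 is the term of index k + 1, so this is
  -- its second-order Taylor remainder at y. The terms of index 0 and 1 have none, hence the shift.
  δ : ℕ → ℝ
  δ k = expTerm x (2 ℕ.+ k) - expTerm y (2 ℕ.+ k) - expTerm y (suc k) * (x - y)

  0≤B : 0ℝ ≤ B
  0≤B = ≤-trans (0≤∣∣ x) ∣x∣≤B

  δ-suc : ∀ k → δ (suc k) ≃ (x * δ k + h² * expTerm y (suc k)) * fromℚ (ℚ-Lemmas.1/suc (2 ℕ.+ k))
  δ-suc k = modulo (fromℕ-1/suc (suc k)) (modulo
    (≃-trans (*-cong (≃-sym (fromℚ-fromℕ-suc (2 ℕ.+ k))) ≃-refl) (fromℕ-1/suc (2 ℕ.+ k)))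
    (solve 7 (λ x y X E n u v →
      X :* x :* u :- E :* y :* v :* y :* u :- E :* y :* v :* (x :- y)
      := (x :* (X :- E :* y :* v :- E :* (x :- y)) :+ (x :- y) :* (x :- y) :* E) :* u
         :+ (:- (E :* y :* (x :- y) :* u)) :* (n :* v :- con 1ℚ)
         :+ E :* y :* (x :- y) :* v :* ((con 1ℚ :+ n) :* u :- con 1ℚ))
      ≃-refl x y (expTerm x (2 ℕ.+ k)) (expTerm y (suc k)) (fromℚ (ℚ-Lemmas.fromℕ (2 ℕ.+ k)))
      (fromℚ (ℚ-Lemmas.1/suc (2 ℕ.+ k))) (fromℚ (ℚ-Lemmas.1/suc (suc k)))))

  -- Since B · Bᵏ / k! = (k + 1) · Bᵏ⁺¹ / (k + 1)!, the left side is (k + 2) / (k + 3) times the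
  -- right side.
  bound-step : ∀ k →
    (B * (h² * expTerm B k) + h² * expTerm B (suc k)) * fromℚ (ℚ-Lemmas.1/suc (2 ℕ.+ k))
      ≤ h² * expTerm B (suc k)
  bound-step k = ≤-by
    (0≤* (0≤* (0≤* (0≤x*x (x - y)) (0≤* (expTerm-nonneg 0≤B k) 0≤B)) (0≤1/suc (2 ℕ.+ k))) (0≤1/suc k))
    (modulo (fromℕ-1/suc k) (modulo
      (≃-trans (*-cong (≃-sym (≃-trans (fromℚ-fromℕ-suc (2 ℕ.+ k))
        (+-cong ≃-refl (fromℚ-fromℕ-suc (suc k))))) ≃-refl) (fromℕ-1/suc (2 ℕ.+ k)))
      (solve 6 (λ h P B m u w →
        h :* (P :* B :* w)
        := (B :* (h :* P) :+ h :* (P :* B :* w)) :* u :+ h :* (P :* B) :* u :* w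
           :+ h :* (P :* B) :* u :* (m :* w :- con 1ℚ)
           :+ (:- (h :* (P :* B) :* w)) :* ((con 1ℚ :+ (con 1ℚ :+ m)) :* u :- con 1ℚ))
        ≃-refl h² (expTerm B k) B (fromℚ (ℚ-Lemmas.fromℕ (suc k)))
        (fromℚ (ℚ-Lemmas.1/suc (2 ℕ.+ k))) (fromℚ (ℚ-Lemmas.1/suc k)))))

  δ-bound : ∀ k → ∣ δ k ∣ ≤ h² * expTerm B k
  δ-bound zero = ∣∣≤-by
    (solve 2 (λ x y →
      con 1ℚ :* x :* con 1ℚ :* x :* con ½ :- con 1ℚ :* y :* con 1ℚ :* y :* con ½
        :- con 1ℚ :* y :* con 1ℚ :* (x :- y)
      := con ½ :* ((x :- y) :* (x :- y))) ≃-refl x y)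
    (0≤⇒∣∣≤ (0≤* 0≤½ (0≤x*x (x - y))) ≤-refl)
    (≤-by (0≤* 0≤½ (0≤x*x (x - y)))
      (solve 1 (λ h → h :* con 1ℚ := con ½ :* h :+ con ½ :* h) ≃-refl h²))
    where
    0≤½ : 0ℝ ≤ fromℚ ½
    0≤½ = fromℚ-mono (ℚ.<⇒≤ ℚ-Lemmas.0<½)
  δ-bound (suc k) = ∣∣≤-by (δ-suc k)
    (∣∣≤-* (∣∣≤-+ (∣∣≤-* ∣x∣≤B (δ-bound k))
                  (∣∣≤-* (0≤⇒∣∣≤ (0≤x*x (x - y)) ≤-refl) (expTerm-∣∣≤ ∣y∣≤B (suc k))))
           (0≤⇒∣∣≤ (0≤1/suc (2 ℕ.+ k)) ≤-refl))
    (bound-step k)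

  S : ℝ → ℕ → ℝ
  S z = partialSum (expTerm z)

  sum-bound : ∀ m →
    ∣ S x (2 ℕ.+ m) - S y (2 ℕ.+ m) - (x - y) * S y (suc m) ∣ ≤ h² * S B m
  sum-bound zero = ∣∣≤-by
    (solve 2 (λ x y → con 0ℚ :+ con 1ℚ :+ con 1ℚ :* x :* con 1ℚ
        :- (con 0ℚ :+ con 1ℚ :+ con 1ℚ :* y :* con 1ℚ) :- (x :- y) :* (con 0ℚ :+ con 1ℚ)
      := con 0ℚ) ≃-refl x y)
    (≤-pointwise λ _ → ℚ.≤-refl)
    (≤-reflexive (solve 1 (λ h → con 0ℚ := h :* con 0ℚ) ≃-refl h²))
  sum-bound (suc m) = ∣∣≤-by
    (solve 8 (λ x y p q r a b c →
      p :+ a :- (q :+ b) :- (x :- y) :* (r :+ c)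
      := (p :- q :- (x :- y) :* r) :+ (a :- b :- c :* (x :- y))) ≃-refl
      x y (S x (2 ℕ.+ m)) (S y (2 ℕ.+ m)) (S y (suc m))
      (expTerm x (2 ℕ.+ m)) (expTerm y (2 ℕ.+ m)) (expTerm y (suc m)))
    (∣∣≤-+ (sum-bound m) (δ-bound m))
    (≤-reflexive (solve 3 (λ h s t → h :* s :+ h :* t := h :* (s :+ t)) ≃-refl
      h² (S B m) (expTerm B m)))

exp-quadratic : ∀ {x y B} → ∣ x ∣ ≤ B → ∣ y ∣ ≤ B →
  ∣ exp x - exp y - (x - y) * exp y ∣ ≤ ((x - y) * (x - y)) * exp B
exp-quadratic {x} {y} {B} ∣x∣≤B ∣y∣≤B = ⟶-≤ (always sum-bound)
  (⟶-∣∣ (⟶-+ (⟶-+ (⟶-suc (⟶-suc (exp-⟶ x))) (⟶-neg (⟶-suc (⟶-suc (exp-⟶ y)))))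
             (⟶-neg (⟶-*ˡ (x - y) (⟶-suc (exp-⟶ y))))))
  (⟶-*ˡ ((x - y) * (x - y)) (exp-⟶ B))
  where open ExpQuadratic ∣x∣≤B ∣y∣≤B

-- exp t · exp (c - t) does not depend on t.
module ExpAdd (c : ℝ) (B : ℝ) (∣c∣≤B : ∣ c ∣ ≤ B) where

  0≤B : 0ℝ ≤ B
  0≤B = ≤-trans (0≤∣∣ c) ∣c∣≤B

  M K : ℝ
  M = exp (B + B)
  K = M * M + M * (1ℝ + (B + B)) * M + M * M

  widen : ∀ {t} → ∣ t ∣ ≤ B → ∣ t ∣ ≤ B + B
  widen h = ≤-trans h (≤-by 0≤B ≃-refl)

  -- With h = x - y, the factors are (1 + h) `exp y` and (1 - h) `exp (c - y)` up to O(h²). The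
  -- linear terms cancel in (1 + h) (1 - h), which leaves -h² and the two remainders.
  quadratic : ∀ x y (p : ∣ x ∣ ≤ B) (q : ∣ y ∣ ≤ B) →
    ∣ exp x * exp (c - x) - exp y * exp (c - y) ∣ ≤ K * ((x - y) * (x - y))
  quadratic x y p q = ∣∣≤-by
    (solve 7 (λ x y c E E′ F F′ →
      E :* F :- E′ :* F′
      := :- (E′ :* F′) :* ((x :- y) :* (x :- y))
         :+ E′ :* (con 1ℚ :+ (x :- y)) :* (F :- F′ :- (c :- x :- (c :- y)) :* F′)
         :+ (E :- E′ :- (x :- y) :* E′) :* F)
      ≃-refl x y c (exp x) (exp y) (exp (c - x)) (exp (c - y)))
    (∣∣≤-+ (∣∣≤-+
      (∣∣≤-* (∣∣≤-neg (∣∣≤-* (exp-∣∣≤ (widen q)) (exp-∣∣≤ (∣∣≤-- ∣c∣≤B q))))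
             (0≤⇒∣∣≤ (0≤x*x (x - y)) ≤-refl))
      (∣∣≤-* (∣∣≤-* (exp-∣∣≤ (widen q)) (∣∣≤-+ (0≤⇒∣∣≤ 0≤1ℝ ≤-refl) (∣∣≤-- p q)))
             (exp-quadratic (∣∣≤-- ∣c∣≤B p) (∣∣≤-- ∣c∣≤B q))))
      (∣∣≤-* (exp-quadratic (widen p) (widen q)) (exp-∣∣≤ (∣∣≤-- ∣c∣≤B p))))
    (≤-reflexive (solve 5 (λ x y c B M →
      M :* M :* ((x :- y) :* (x :- y))
        :+ M :* (con 1ℚ :+ (B :+ B)) :* ((c :- x :- (c :- y)) :* (c :- x :- (c :- y)) :* M)
        :+ (x :- y) :* (x :- y) :* M :* M
      := (M :* M :+ M :* (con 1ℚ :+ (B :+ B)) :* M :+ M :* M) :* ((x :- y) :* (x :- y)))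
      ≃-refl x y c B M))

  midpoint : ∀ {x y} → ∣ x ∣ ≤ B → ∣ y ∣ ≤ B → ∣ ½ᴿ * (x + y) ∣ ≤ B
  midpoint p q = ≤-respʳ (solve 1 (λ B → con ½ :* (B :+ B) := B) ≃-refl B)
    (∣∣≤-* (≤-pointwise λ _ → ℚ.≤-refl) (∣∣≤-+ p q))

  open Constancy (λ t (_ : ∣ t ∣ ≤ B) → exp t * exp (c - t)) K midpoint quadratic public

exp-+ : ∀ x y → exp (x + y) ≃ exp x * exp y
exp-+ x y = begin-equality
  exp (x + y)                  ≈⟨ exp-cong {x + y} {c - 0ℝ} (solve 2 (λ x y → x :+ y := x :+ y :- con 0ℚ) ≃-refl x y) ⟩
  exp (c - 0ℝ)                 ≈⟨ solve 1 (λ e → e := con 1ℚ :* e) ≃-refl (exp (c - 0ℝ)) ⟩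
  1ℝ * exp (c - 0ℝ)            ≈⟨ *-cong (≃-sym exp-0) ≃-refl ⟩
  exp 0ℝ * exp (c - 0ℝ)        ≈⟨ ExpAdd.constant c B ∣c∣≤B 0ℝ x ∣0∣≤B ∣x∣≤B ⟩
  exp x * exp (c - x)          ≈⟨ *-cong ≃-refl (exp-cong {c - x} {y} (solve 2 (λ x y → x :+ y :- x := y) ≃-refl x y)) ⟩
  exp x * exp y                ∎
  where
  open ≤-Reasoning
  c B : ℝ
  c = x + y
  B = ∣ x ∣ + ∣ y ∣
  ∣c∣≤B : ∣ c ∣ ≤ B
  ∣c∣≤B = ∣∣≤-+ ≤-refl ≤-refl
  ∣x∣≤B : ∣ x ∣ ≤ B
  ∣x∣≤B = ≤-by (0≤∣∣ y) ≃-refl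
  ∣0∣≤B : ∣ 0ℝ ∣ ≤ B
  ∣0∣≤B = ≤-trans (≤-pointwise λ _ → ℚ.≤-refl) (≤-trans (0≤∣∣ x) ∣x∣≤B)

exp-inverse : ∀ x → exp x * exp (- x) ≃ 1ℝ
exp-inverse x = ≃-trans (≃-sym (exp-+ x (- x)))
  (≃-trans (exp-cong {x + - x} {0ℝ} (solve 1 (λ x → x :+ :- x := con 0ℚ) ≃-refl x)) exp-0)

exp-nonneg : ∀ x → 0ℝ ≤ exp x
exp-nonneg x = ≤-respʳ
  (≃-trans (≃-sym (exp-+ y y)) (exp-cong {y + y} {x} (solve 1 (λ x → con ½ :* x :+ con ½ :* x := x) ≃-refl x)))
  (0≤x*x (exp y))
  where
  y = fromℚ ½ * x

-- Strict positivity needs a rational witness: if ∣ y ∣ ≤ B, then x ≥ 1 / B.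
0<-by-product : ∀ {x y} → 0ℝ ≤ x → x * y ≃ 1ℝ → 0ℝ < x
0<-by-product {x} {y} 0≤x e =
  let B , 0<B , ∣y∣≤B = bounded y
      b = ℚ-Lemmas.recip B 0<B
      0<b = ℚ-Lemmas.recip-pos B 0<B
  in fromℚ≤⇒0< 0<b (≤-respˡ (solve 1 (λ b → b :* con 1ℚ := b) ≃-refl (fromℚ b))
    (≤-respʳ
      (modulo {a = x} (≃-pointwise {fromℚ B * fromℚ b} {1ℝ} λ _ → ℚ-Lemmas.*-recip B 0<B)
        (solve 3 (λ x B b → b :* (x :* B) := x :+ x :* (B :* b :- con 1ℚ)) ≃-refl x (fromℚ B) (fromℚ b)))
      (*-monoˡ-≤ (fromℚ-mono (ℚ.<⇒≤ 0<b))
        (≤-respˡ e (*-monoˡ-≤ 0≤x (≤-trans (x≤∣x∣ y) ∣y∣≤B))))))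

exp-pos : ∀ x → 0ℝ < exp x
exp-pos x = 0<-by-product (exp-nonneg x) (exp-inverse x)

<-+ : ∀ {x y z} → 0ℝ < z → y ≃ x + z → x < y
<-+ {x} {y} {z} (mk< g 0<g h) e = <-≤-trans
  (mk< g 0<g (eventually (λ n k → subst (λ t → seq x n ℚ.+ t ℚ.≤ seq x n ℚ.+ seq z n)
    (ℚ.+-identityˡ g) (ℚ.+-monoʳ-≤ (seq x n) k)) h))
  (≤-reflexive (≃-sym e))

<⇒0<- : ∀ {x y} → x < y → 0ℝ < y - x
<⇒0<- {x} {y} (mk< g 0<g h) = eventually-≥⇒0< 0<g (eventually
  (λ n k → subst (ℚ._≤ seq y n ℚ.- seq x n)
    (≡-solve 2 (λ a g → a ⊞ g ⊟ a ⊜ g) refl (seq x n) g) (ℚ.+-monoˡ-≤ (ℚ.- seq x n) k)) h)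
  where open ℚ-Solver

<-irrefl : ∀ {x} → ¬ (x < x)
<-irrefl {x} (mk< g 0<g h) = let n , k = eventually-witness h in ℚ.<-irrefl refl (ℚ.<-≤-trans 0<g
  (subst₂ ℚ._≤_ (≡-solve 2 (λ a g → a ⊞ g ⊟ a ⊜ g) refl (seq x n) g) (ℚ.+-inverseʳ (seq x n))
    (ℚ.+-monoˡ-≤ (ℚ.- seq x n) k)))
  where open ℚ-Solver

exp-split : ∀ x y → exp y ≃ exp x + exp x * (exp (y - x) - 1ℝ)
exp-split x y = ≃-trans (exp-cong {y} {x + (y - x)} (solve 2 (λ x y → y := x :+ (y :- x)) ≃-refl x y))
  (≃-trans (exp-+ x (y - x))
    (solve 2 (λ a b → a :* b := a :+ a :* (b :- con 1ℚ)) ≃-refl (exp x) (exp (y - x))))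

x≤exp-1 : ∀ {x} → 0ℝ ≤ x → x ≤ exp x - 1ℝ
x≤exp-1 {x} h = ≤-by (≤⇒0≤- (1+x≤exp h))
  (solve 2 (λ x e → e :- con 1ℚ := x :+ (e :- (con 1ℚ :+ x))) ≃-refl x (exp x))

exp-mono-≤ : ∀ {x y} → x ≤ y → exp x ≤ exp y
exp-mono-≤ {x} {y} h = ≤-by
  (0≤* (exp-nonneg x) (≤-trans (≤⇒0≤- h) (x≤exp-1 (≤⇒0≤- h)))) (exp-split x y)

exp-mono-< : ∀ {x y} → x < y → exp x < exp y
exp-mono-< {x} {y} h = <-+
  (*-pos (exp-pos x) (<-≤-trans (<⇒0<- h) (x≤exp-1 (<⇒≤ (<⇒0<- h))))) (exp-split x y)

-- Strict monotonicity only refutes y < x, which suffices by `≮⇒≥`. Through this the laws of exp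
-- pass to log.
exp-cancel-≤ : ∀ {x y} → exp x ≤ exp y → x ≤ y
exp-cancel-≤ h = ≮⇒≥ λ y<x → <-irrefl (<-≤-trans (exp-mono-< y<x) h)

exp-injective : ∀ {x y} → exp x ≃ exp y → x ≃ y
exp-injective h = ≤-antisym (exp-cancel-≤ (≤-reflexive h)) (exp-cancel-≤ (≤-reflexive (≃-sym h)))

-- The logarithm

^-∣∣≤ : ∀ {x a} → ∣ x ∣ ≤ a → ∀ n → ∣ x ^ n ∣ ≤ a ^ n
^-∣∣≤ h zero    = ≤-pointwise λ _ → ℚ.≤-refl
^-∣∣≤ h (suc n) = ∣∣≤-* h (^-∣∣≤ h n)

^-nonneg : ∀ {x} → 0ℝ ≤ x → ∀ n → 0ℝ ≤ x ^ n
^-nonneg h zero    = 0≤1ℝ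
^-nonneg h (suc n) = 0≤* h (^-nonneg h n)

fromℕᴿ : ℕ → ℝ
fromℕᴿ n = fromℚ (ℚ-Lemmas.fromℕ n)

0≤fromℕᴿ : ∀ n → 0ℝ ≤ fromℕᴿ n
0≤fromℕᴿ n = fromℚ-mono (ℚ-Lemmas.0≤fromℕ n)

fromℕᴿ-double : ∀ n → fromℕᴿ (2 ℕ.* n) ≃ fromℕᴿ n + fromℕᴿ n
fromℕᴿ-double zero    = solve 0 (con 0ℚ := con 0ℚ :+ con 0ℚ) ≃-refl
fromℕᴿ-double (suc n) = ≃-trans (≃-pointwise λ _ → cong ℚ-Lemmas.fromℕ (ℕ.*-suc 2 n))
  (≃-trans (fromℚ-fromℕ-suc (suc (2 ℕ.* n)))
  (≃-trans (+-cong ≃-refl (≃-trans (fromℚ-fromℕ-suc (2 ℕ.* n)) (+-cong ≃-refl (fromℕᴿ-double n))))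
  (≃-trans (solve 1 (λ n → con 1ℚ :+ (con 1ℚ :+ (n :+ n)) := (con 1ℚ :+ n) :+ (con 1ℚ :+ n))
             ≃-refl (fromℕᴿ n))
    (≃-sym (+-cong (fromℚ-fromℕ-suc n) (fromℚ-fromℕ-suc n))))))

-- The partial sums G of the geometric series Σ w²ᵏ are the derivatives of the
-- partial sums S of artanh at w; V bounds the second order terms.
module ArtanhQuadratic {z w ρ C : ℝ} (∣z∣≤1 : ∣ z ∣ ≤ 1ℝ) (∣w∣≤1 : ∣ w ∣ ≤ 1ℝ)
  (z²≤ρ : z * z ≤ ρ) (w²≤ρ : w * w ≤ ρ) (ρ≤1 : ρ ≤ 1ℝ)
  (0≤C : 0ℝ ≤ C) (C-inverse : C * ((1ℝ - ρ) * (1ℝ - ρ)) ≃ 1ℝ) where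

  h h² : ℝ
  h = z - w
  h² = h * h

  0≤h² : 0ℝ ≤ h²
  0≤h² = 0≤x*x h

  0≤ρ : 0ℝ ≤ ρ
  0≤ρ = ≤-trans (0≤x*x z) z²≤ρ

  ∣z²∣≤ρ : ∣ z * z ∣ ≤ ρ
  ∣z²∣≤ρ = 0≤⇒∣∣≤ (0≤x*x z) z²≤ρ

  W : ℕ → ℝ
  W k = (w * w) ^ k

  W-bound : ∀ k → ∣ W k ∣ ≤ ρ ^ k
  W-bound = ^-∣∣≤ (0≤⇒∣∣≤ (0≤x*x w) w²≤ρ)

  n : ℕ → ℝ
  n = fromℕᴿ

  odd : ℕ → ℝ
  odd k = 1ℝ + (n k + n k)

  -- Second-order remainder at w of the power with exponent 2k + 1, before the division by 2k + 1 in
  -- the artanh series.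
  η : ℕ → ℝ
  η k = z * (z * z) ^ k - w * W k - odd k * W k * h

  η-suc : ∀ k → η (suc k) ≃ z * z * η k + h² * W k * (w + odd k * (z + w))
  η-suc k = modulo (fromℚ-fromℕ-suc k)
    (solve 6 (λ z w Z W n n′ →
      z :* (z :* z :* Z) :- w :* (w :* w :* W)
        :- (con 1ℚ :+ (n′ :+ n′)) :* (w :* w :* W) :* (z :- w)
      := z :* z :* (z :* Z :- w :* W :- (con 1ℚ :+ (n :+ n)) :* W :* (z :- w))
         :+ (z :- w) :* (z :- w) :* W :* (w :+ (con 1ℚ :+ (n :+ n)) :* (z :+ w))
         :+ (:- (w :* w :* W :* (z :- w) :* con (+ 2 ℚ./ 1))) :* (n′ :- (con 1ℚ :+ n)))
      ≃-refl z w ((z * z) ^ k) (W k) (n k) (n (suc k)))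

  0≤odd : ∀ k → 0ℝ ≤ odd k
  0≤odd k = 0≤+ 0≤1ℝ (0≤+ (0≤fromℕᴿ k) (0≤fromℕᴿ k))

  increment : ∀ k → ∣ h² * W k * (w + odd k * (z + w)) ∣ ≤ h² * ρ ^ k * (1ℝ + odd k * (1ℝ + 1ℝ))
  increment k = ∣∣≤-* (∣∣≤-* (0≤⇒∣∣≤ 0≤h² ≤-refl) (W-bound k))
    (∣∣≤-+ ∣w∣≤1 (∣∣≤-* (0≤⇒∣∣≤ (0≤odd k) ≤-refl) (∣∣≤-+ ∣z∣≤1 ∣w∣≤1)))

  -- The factor 2 (k + 1) (2k + 3) is the coefficient of the second derivative of the power with
  -- exponent 2k + 3. Division by 2k + 3 leaves multiples of (k + 1) ρᵏ, which is summable.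
  η-bound : ∀ k → ∣ η (suc k) ∣ ≤ h² * ρ ^ k * (2ℝ * (1ℝ + n k) * odd (suc k))
  η-bound zero = ∣∣≤-by
    (≃-trans (η-suc zero)
      (solve 3 (λ z w t →
        z :* z :* (z :* con 1ℚ :- w :* con 1ℚ
          :- (con 1ℚ :+ (con 0ℚ :+ con 0ℚ)) :* con 1ℚ :* (z :- w)) :+ t := t) ≃-refl
        z w (h² * W 0 * (w + odd 0 * (z + w)))))
    (increment zero)
    (≤-by {z = fromℚ (+ 3 ℚ./ 1) * h²} (0≤* (fromℚ-mono (from-yes (0ℚ ℚ.≤? + 3 ℚ./ 1))) 0≤h²)
      (solve 1 (λ h →
        h :* con 1ℚ :* (con (+ 2 ℚ./ 1) :* (con 1ℚ :+ con 0ℚ) :* (con 1ℚ :+ (con 1ℚ :+ con 1ℚ)))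
        := h :* con 1ℚ :* (con 1ℚ :+ (con 1ℚ :+ (con 0ℚ :+ con 0ℚ)) :* (con 1ℚ :+ con 1ℚ))
           :+ con (+ 3 ℚ./ 1) :* h) ≃-refl h²))
  η-bound (suc k) = ∣∣≤-by (η-suc (suc k))
    (∣∣≤-+ (∣∣≤-* ∣z²∣≤ρ (η-bound k)) (increment (suc k)))
    (≤-by (0≤* (0≤* 0≤h² (^-nonneg 0≤ρ (suc k)))
            (0≤+ (fromℚ-mono (from-yes (0ℚ ℚ.≤? + 7 ℚ./ 1)))
                 (0≤* (fromℚ-mono (from-yes (0ℚ ℚ.≤? + 4 ℚ./ 1))) (0≤fromℕᴿ k))))
      (modulo (fromℚ-fromℕ-suc k) (modulo (fromℚ-fromℕ-suc (suc k))
        (solve 6 (λ h r p n n′ n″ →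
          h :* (r :* p) :* (con (+ 2 ℚ./ 1) :* (con 1ℚ :+ n′) :* (con 1ℚ :+ (n″ :+ n″)))
          := r :* (h :* p :* (con (+ 2 ℚ./ 1) :* (con 1ℚ :+ n) :* (con 1ℚ :+ (n′ :+ n′))))
             :+ h :* (r :* p) :* (con 1ℚ :+ (con 1ℚ :+ (n′ :+ n′)) :* (con 1ℚ :+ con 1ℚ))
             :+ h :* (r :* p) :* (con (+ 7 ℚ./ 1) :+ con (+ 4 ℚ./ 1) :* n)
             :+ h :* (r :* p) :* (con (+ 4 ℚ./ 1) :* n′ :+ con (+ 6 ℚ./ 1)) :* (n′ :- (con 1ℚ :+ n))
             :+ h :* (r :* p) :* (con (+ 4 ℚ./ 1) :* (con 1ℚ :+ n′)) :* (n″ :- (con 1ℚ :+ n′)))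
          ≃-refl h² ρ (ρ ^ k) (n k) (n (suc k)) (n (2 ℕ.+ k))))))

  T : ℕ → ℝ
  T k = artanhTerm z k - artanhTerm w k - W k * h

  u : ℕ → ℝ
  u k = fromℚ (ℚ-Lemmas.1/suc (2 ℕ.* k))

  odd-u : ∀ k → odd k * u k ≃ 1ℝ
  odd-u k = ≃-trans
    (*-cong (≃-sym (≃-trans (fromℚ-fromℕ-suc (2 ℕ.* k)) (+-cong ≃-refl (fromℕᴿ-double k)))) ≃-refl)
    (fromℕ-1/suc (2 ℕ.* k))

  T-bound : ∀ k → ∣ T (suc k) ∣ ≤ 2ℝ * h² * ((1ℝ + n k) * ρ ^ k)
  T-bound k = ∣∣≤-by
    (modulo (odd-u (suc k)) (solve 7 (λ z w Z W N u h →
      z :* Z :* u :- w :* W :* u :- W :* h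
      := (z :* Z :- w :* W :- N :* W :* h) :* u :+ W :* h :* (N :* u :- con 1ℚ))
      ≃-refl z w ((z * z) ^ suc k) (W (suc k)) (odd (suc k)) (u (suc k)) h))
    (∣∣≤-* (η-bound k) (0≤⇒∣∣≤ (0≤1/suc (2 ℕ.* suc k)) ≤-refl))
    (≤-reflexive (modulo (odd-u (suc k)) (solve 5 (λ h p m N u →
      h :* p :* (con (+ 2 ℚ./ 1) :* m :* N) :* u
      := con (+ 2 ℚ./ 1) :* h :* (m :* p) :+ h :* p :* (con (+ 2 ℚ./ 1) :* m) :* (N :* u :- con 1ℚ))
      ≃-refl h² (ρ ^ k) (1ℝ + n k) (odd (suc k)) (u (suc k)))))

  V : ℕ → ℝ
  V = partialSum (λ k → (1ℝ + n k) * ρ ^ k)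

  -- `V` is a partial sum of the derivative of the geometric series, whose total is 1 / (1 - ρ)² =
  -- `C`; the second summand is (1 - ρ)² times the omitted tail.
  V-closed : ∀ m → (1ℝ - ρ) * (1ℝ - ρ) * V m + ((1ℝ + n m) - n m * ρ) * ρ ^ m ≃ 1ℝ
  V-closed zero = solve 1 (λ r → (con 1ℚ :- r) :* (con 1ℚ :- r) :* con 0ℚ
    :+ ((con 1ℚ :+ con 0ℚ) :- con 0ℚ :* r) :* con 1ℚ := con 1ℚ) ≃-refl ρ
  V-closed (suc m) = modulo (V-closed m) (modulo (fromℚ-fromℕ-suc m)
    (solve 5 (λ r v p n n′ →
      (con 1ℚ :- r) :* (con 1ℚ :- r) :* (v :+ (con 1ℚ :+ n) :* p)
        :+ ((con 1ℚ :+ n′) :- n′ :* r) :* (r :* p)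
      := con 1ℚ
         :+ con 1ℚ :* ((con 1ℚ :- r) :* (con 1ℚ :- r) :* v
              :+ ((con 1ℚ :+ n) :- n :* r) :* p :- con 1ℚ)
         :+ (con 1ℚ :- r) :* (r :* p) :* (n′ :- (con 1ℚ :+ n)))
      ≃-refl ρ (V m) (ρ ^ m) (n m) (n (suc m))))

  V-bound : ∀ m → V m ≤ C
  V-bound m = ≤-by
    (0≤* 0≤C (0≤* (0≤+ 0≤1ℝ (0≤* (0≤fromℕᴿ m) (≤⇒0≤- ρ≤1))) (^-nonneg 0≤ρ m)))
    (modulo (V-closed m) (modulo C-inverse
      (solve 5 (λ c v r n p →
        c := v :+ c :* ((con 1ℚ :+ n :* (con 1ℚ :- r)) :* p)
          :+ (:- c) :* ((con 1ℚ :- r) :* (con 1ℚ :- r) :* v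
               :+ ((con 1ℚ :+ n) :- n :* r) :* p :- con 1ℚ)
          :+ v :* (c :* ((con 1ℚ :- r) :* (con 1ℚ :- r)) :- con 1ℚ))
        ≃-refl C (V m) ρ (n m) (ρ ^ m))))

  S : ℝ → ℕ → ℝ
  S t = partialSum (artanhTerm t)

  G : ℕ → ℝ
  G = partialSum W

  G-closed : ∀ m → (1ℝ - w * w) * G m ≃ 1ℝ - W m
  G-closed zero = solve 1 (λ w → (con 1ℚ :- w :* w) :* con 0ℚ := con 1ℚ :- con 1ℚ) ≃-refl w
  G-closed (suc m) = modulo (G-closed m) (solve 3 (λ w g v →
    (con 1ℚ :- w :* w) :* (g :+ v)
    := con 1ℚ :- w :* w :* v :+ con 1ℚ :* ((con 1ℚ :- w :* w) :* g :- (con 1ℚ :- v)))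
    ≃-refl w (G m) (W m))

  sum-bound : ∀ m → ∣ S z (suc m) - S w (suc m) - G (suc m) * h ∣ ≤ 2ℝ * h² * V m
  sum-bound zero = ∣∣≤-by
    (solve 2 (λ z w → con 0ℚ :+ z :* con 1ℚ :* con 1ℚ :- (con 0ℚ :+ w :* con 1ℚ :* con 1ℚ)
      :- (con 0ℚ :+ con 1ℚ) :* (z :- w) := con 0ℚ) ≃-refl z w)
    (≤-pointwise λ _ → ℚ.≤-refl)
    (≤-reflexive (solve 1 (λ h → con 0ℚ := con (+ 2 ℚ./ 1) :* h :* con 0ℚ) ≃-refl h²))
  sum-bound (suc m) = ∣∣≤-by
    (solve 7 (λ s t g a b v h →
      s :+ a :- (t :+ b) :- (g :+ v) :* h := (s :- t :- g :* h) :+ (a :- b :- v :* h)) ≃-refl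
      (S z (suc m)) (S w (suc m)) (G (suc m)) (artanhTerm z (suc m)) (artanhTerm w (suc m))
      (W (suc m)) h)
    (∣∣≤-+ (sum-bound m) (T-bound m))
    (≤-reflexive (solve 3 (λ c s t → c :* s :+ c :* t := c :* (s :+ t)) ≃-refl (2ℝ * h²) (V m)
      ((1ℝ + n m) * ρ ^ m)))

  ∣1-w²∣≤1 : ∣ 1ℝ - w * w ∣ ≤ 1ℝ
  ∣1-w²∣≤1 = 0≤⇒∣∣≤ (≤⇒0≤- (≤-trans w²≤ρ ρ≤1))
    (≤-by (0≤x*x w) (solve 1 (λ w → con 1ℚ := con 1ℚ :- w :* w :+ w :* w) ≃-refl w))

  -- The derivative of artanh is 1 / (1 - w²). Multiplication by 1 - w² avoids this division and
  -- turns the geometric sum `G (suc m)` into 1 - `W (suc m)`.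
  scaled-bound : ∀ m →
    ∣ (1ℝ - w * w) * (S z (suc m) - S w (suc m)) - h + h * W (suc m) ∣ ≤ 2ℝ * C * h²
  scaled-bound m = ∣∣≤-by
    (modulo (≃-sym (G-closed (suc m))) (solve 6 (λ w s t g v h →
      (con 1ℚ :- w :* w) :* (s :- t) :- h :+ h :* v
      := (con 1ℚ :- w :* w) :* (s :- t :- g :* h)
         :+ (:- h) :* (con 1ℚ :- v :- (con 1ℚ :- w :* w) :* g))
      ≃-refl w (S z (suc m)) (S w (suc m)) (G (suc m)) (W (suc m)) h))
    (∣∣≤-* ∣1-w²∣≤1 (sum-bound m))
    (≤-by (0≤* (0≤* (fromℚ-mono (from-yes (0ℚ ℚ.≤? + 2 ℚ./ 1))) 0≤h²) (≤⇒0≤- (V-bound m)))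
      (solve 3 (λ c h v → con (+ 2 ℚ./ 1) :* c :* h
        := con 1ℚ :* (con (+ 2 ℚ./ 1) :* h :* v) :+ con (+ 2 ℚ./ 1) :* h :* (c :- v))
        ≃-refl C h² (V m)))

  limit-bound : ∀ d e → W ⟶ 0ℝ →
    ∣ (1ℝ - w * w) * (series (artanhTerm z) d - series (artanhTerm w) e) - h ∣ ≤ 2ℝ * C * h²
  limit-bound d e W→0 = ⟶-≤ (always scaled-bound)
    (⟶-∣∣ (⟶-cong (λ _ → ≃-refl)
      (solve 2 (λ a h → a :- h :+ h :* con 0ℚ := a :- h) ≃-refl
        ((1ℝ - w * w) * (series (artanhTerm z) d - series (artanhTerm w) e)) h)
      (⟶-+ (⟶-+ (⟶-*ˡ (1ℝ - w * w) (⟶-+ (⟶-suc (series-⟶ (artanhTerm z) d))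
                                       (⟶-neg (⟶-suc (series-⟶ (artanhTerm w) e)))))
                (⟶-≃ λ _ → ≃-refl))
           (⟶-*ˡ h (⟶-suc W→0)))))
    (⟶-≃ λ _ → ≃-refl)

^-cong : ∀ {x y} → x ≃ y → ∀ n → x ^ n ≃ y ^ n
^-cong h zero    = ≃-refl
^-cong h (suc n) = *-cong h (^-cong h n)

^ᴿ-⟶-0 : ∀ {x r} → 0ℝ ≤ x → x ≤ fromℚ r → r ℚ.< 1ℚ → (x ^_) ⟶ 0ℝ
^ᴿ-⟶-0 {x} {r} 0≤x x≤r r<1 = ⟶-0
  (λ n → ≤-trans (^-∣∣≤ (0≤⇒∣∣≤ 0≤x x≤r) n) (≤-pointwise λ m → ℚ.≤-reflexive (Bounds.seq-^ (fromℚ r) n m)))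
  (^-⟶-0 (fromℚ-cancel-≤ (≤-trans 0≤x x≤r)) r<1)

logDominated : ∀ x (0<x : 0ℝ < x) → Dominated (artanhTerm (cayley x 0<x))
logDominated x 0<x =
  Bounds.artanh-dominated (cayley x 0<x) (proj₁ (proj₂ bound)) (proj₁ (proj₂ (proj₂ bound)))
    (proj₂ (proj₂ (proj₂ bound)))
  where
  bound = cayley-contracts x 0<x

log-series : ∀ x 0<x → log x 0<x ≃ 2ℝ * series (artanhTerm (cayley x 0<x)) (logDominated x 0<x)
log-series x 0<x = ≃-refl

log-1 : ∀ 0<1 → log 1ℝ 0<1 ≃ 0ℝ
log-1 0<1 = ≃-trans (log-series 1ℝ 0<1) (≃-trans
  (*-cong ≃-refl (⟶-unique (series-⟶ (artanhTerm (cayley 1ℝ 0<1)) (logDominated 1ℝ 0<1)) (⟶-≃ sum)))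
  (solve 0 (con (+ 2 ℚ./ 1) :* con 0ℚ := con 0ℚ) ≃-refl))
  where
  sum : ∀ n → partialSum (artanhTerm (cayley 1ℝ 0<1)) n ≃ 0ℝ
  sum zero    = ≃-refl
  sum (suc n) = ≃-trans (+-cong (sum n) ≃-refl)
    (solve 3 (λ u z v → con 0ℚ :+ (con 1ℚ :- con 1ℚ) :* u :* z :* v := con 0ℚ) ≃-refl
      (recip (1ℝ + 1ℝ) (+1-pos 0<1)) ((cayley 1ℝ 0<1 * cayley 1ℝ 0<1) ^ n)
      (fromℚ (1ℤ ℚ./ suc (2 ℕ.* n))))

module LogQuadratic (c C : ℚ) (0<c : 0ℚ ℚ.< c) (c≤1 : c ℚ.≤ 1ℚ) (1≤C : 1ℚ ℚ.≤ C) where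

  Domain : ℝ → Set
  Domain x = (0ℝ < x) × fromℚ c ≤ x × x ≤ fromℚ C

  0<C+1 : 0ℚ ℚ.< C ℚ.+ 1ℚ
  0<C+1 = ℚ-Lemmas.0<+ (ℚ.<-≤-trans ℚ-Lemmas.0<1 1≤C) ℚ-Lemmas.0≤1

  -- The Cayley transform z of x satisfies 1 - z² = 4x / (x + 1)². On the domain this is at least
  -- `t` = 4c / (C + 1)², so z² ≤ `r` uniformly.
  e t r : ℚ
  e = ℚ-Lemmas.recip (C ℚ.+ 1ℚ) 0<C+1
  t = + 4 ℚ./ 1 ℚ.* (c ℚ.* (e ℚ.* e))
  r = 1ℚ ℚ.- t

  0<e : 0ℚ ℚ.< e
  0<e = ℚ-Lemmas.recip-pos (C ℚ.+ 1ℚ) 0<C+1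

  0<t : 0ℚ ℚ.< t
  0<t = ℚ-Lemmas.0<* {+ 4 ℚ./ 1} (from-yes (0ℚ ℚ.<? + 4 ℚ./ 1)) (ℚ-Lemmas.0<* 0<c (ℚ-Lemmas.0<* 0<e 0<e))

  r<1 : r ℚ.< 1ℚ
  r<1 = subst (r ℚ.<_) (ℚ.+-identityʳ 1ℚ) (ℚ.+-monoʳ-< 1ℚ (ℚ.neg-antimono-< 0<t))

  module Point {x : ℝ} (x∈ : Domain x) where

    0<x = proj₁ x∈

    u z : ℝ
    u = recip (x + 1ℝ) (+1-pos 0<x)
    z = cayley x 0<x

    0≤x : 0ℝ ≤ x
    0≤x = <⇒≤ 0<x

    0≤u : 0ℝ ≤ u
    0≤u = <⇒≤ (recip-pos (+1-pos 0<x))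

    inverse : (x + 1ℝ) * u ≃ 1ℝ
    inverse = *-recip (x + 1ℝ) (+1-pos 0<x)

    u≤1 : u ≤ 1ℝ
    u≤1 = ≤-by (0≤* 0≤x 0≤u) (modulo inverse (solve 2 (λ x u →
      con 1ℚ := u :+ x :* u :+ (:- con 1ℚ) :* ((x :+ con 1ℚ) :* u :- con 1ℚ)) ≃-refl x u))

    ∣z∣≤1 : ∣ z ∣ ≤ 1ℝ
    ∣z∣≤1 = ∣∣≤
      (≤-by (0≤+ 0≤u 0≤u) (modulo inverse (solve 2 (λ x u →
        con 1ℚ := (x :- con 1ℚ) :* u :+ (u :+ u)
          :+ (:- con 1ℚ) :* ((x :+ con 1ℚ) :* u :- con 1ℚ)) ≃-refl x u)))
      (≤-by (0≤* 0≤x (0≤+ 0≤u 0≤u)) (modulo inverse (solve 2 (λ x u →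
        con 1ℚ := :- ((x :- con 1ℚ) :* u) :+ x :* (u :+ u)
          :+ (:- con 1ℚ) :* ((x :+ con 1ℚ) :* u :- con 1ℚ)) ≃-refl x u)))

    e≤u : fromℚ e ≤ u
    e≤u = ≤-by
      (0≤* (fromℚ-mono (ℚ.<⇒≤ 0<e)) (0≤* 0≤u (≤⇒0≤- (proj₂ (proj₂ x∈)))))
      (modulo inverse (modulo
        (≃-pointwise {(fromℚ C + 1ℝ) * fromℚ e} {1ℝ} λ _ → ℚ-Lemmas.*-recip (C ℚ.+ 1ℚ) 0<C+1)
        (solve 4 (λ x u C e → u := e :+ e :* (u :* (C :- x))
          :+ e :* ((x :+ con 1ℚ) :* u :- con 1ℚ)
          :+ (:- u) :* ((C :+ con 1ℚ) :* e :- con 1ℚ)) ≃-refl x u (fromℚ C) (fromℚ e))))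

    z²≤r : z * z ≤ fromℚ r
    z²≤r = ≤-trans
      (≤-by (0≤* (fromℚ-mono (from-yes (0ℚ ℚ.≤? + 4 ℚ./ 1)))
              (≤⇒0≤- (*-mono-≤ (fromℚ-mono (ℚ.<⇒≤ 0<c)) (0≤* 0≤u 0≤u) (proj₁ (proj₂ x∈))
                (*-mono-≤ (fromℚ-mono (ℚ.<⇒≤ 0<e)) 0≤u e≤u e≤u))))
        (modulo inverse (solve 4 (λ x u c e →
          con 1ℚ :- con (+ 4 ℚ./ 1) :* (c :* (e :* e))
          := (x :- con 1ℚ) :* u :* ((x :- con 1ℚ) :* u)
             :+ con (+ 4 ℚ./ 1) :* (x :* (u :* u) :- c :* (e :* e))
             :+ (:- ((x :+ con 1ℚ) :* u :+ con 1ℚ)) :* ((x :+ con 1ℚ) :* u :- con 1ℚ))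
          ≃-refl x u (fromℚ c) (fromℚ e))))
      (≤-pointwise λ _ → ℚ.≤-refl)

  t⁻¹ : ℚ
  t⁻¹ = ℚ-Lemmas.recip t 0<t

  K₀ : ℝ
  K₀ = fromℚ (t⁻¹ ℚ.* t⁻¹)

  0≤K₀ : 0ℝ ≤ K₀
  0≤K₀ = fromℚ-mono (ℚ-Lemmas.0≤p*p t⁻¹)

  K₀-inverse : K₀ * ((1ℝ - fromℚ r) * (1ℝ - fromℚ r)) ≃ 1ℝ
  K₀-inverse = ≃-pointwise λ _ → trans
    (≡-solve 2 (λ s t → s ⊠ s ⊠ ((const 1ℚ ⊟ (const 1ℚ ⊟ t)) ⊠ (const 1ℚ ⊟ (const 1ℚ ⊟ t)))
      ⊜ (t ⊠ s) ⊠ (t ⊠ s)) refl t⁻¹ t)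
    (cong (λ s → s ℚ.* s) (ℚ-Lemmas.*-recip t 0<t))
    where open ℚ-Solver

  K₁ : ℝ
  K₁ = fromℚ (+ 4 ℚ./ 1) * K₀ + 1ℝ

  0≤K₁ : 0ℝ ≤ K₁
  0≤K₁ = 0≤+ (0≤* (fromℚ-mono (from-yes (0ℚ ℚ.≤? + 4 ℚ./ 1))) 0≤K₀) 0≤1ℝ

  -- With u = 1 / (x + 1) and v = 1 / (y + 1) one has z - w = 2 u v (x - y) and 1 - w² = 4 y v².
  -- Multiplying the artanh estimate by (y + 1)² / 2 gives the one for log = 2 artanh, up to an
  -- error u (x - y)².
  combine : ∀ {x y} (x∈ : Domain x) (y∈ : Domain y) →
    let z = Point.z x∈
        w = Point.z y∈
    in ∀ a b → ∣ (1ℝ - w * w) * (a - b) - (z - w) ∣ ≤ 2ℝ * K₀ * ((z - w) * (z - w)) →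
    ∣ y * (2ℝ * a - 2ℝ * b) - (x - y) ∣ ≤ K₁ * ((x - y) * (x - y))
  combine {x} {y} x∈ y∈ a b h = ∣∣≤-by
    (modulo X.inverse (modulo Y.inverse (solve 6 (λ x y u v a b →
      let p = (y :+ con 1ℚ) :* v
          q = (x :+ con 1ℚ) :* u
          Δ = x :- y
          two = con (+ 2 ℚ./ 1)
      in y :* (two :* a :- two :* b) :- Δ
         := con ½ :* ((y :+ con 1ℚ) :* (y :+ con 1ℚ))
              :* (con (+ 4 ℚ./ 1) :* y :* (v :* v) :* (a :- b) :- two :* (u :* v :* Δ))
            :- u :* (Δ :* Δ)
            :+ Δ :* (q :- con 1ℚ)
            :+ ((y :+ con 1ℚ) :* u :* Δ :- two :* y :* (a :- b) :* (p :+ con 1ℚ)) :* (p :- con 1ℚ))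
      ≃-refl x y X.u Y.u a b)))
    (∣∣≤-- (∣∣≤-* (0≤⇒∣∣≤ (0≤* (fromℚ-mono (ℚ.<⇒≤ ℚ-Lemmas.0<½)) (0≤x*x (y + 1ℝ))) ≤-refl) F-bound)
           (0≤⇒∣∣≤ (0≤* X.0≤u (0≤x*x (x - y))) ≤-refl))
    (≤-by
      (0≤* (0≤+ (0≤* (0≤* (fromℚ-mono (from-yes (0ℚ ℚ.≤? + 4 ℚ./ 1))) 0≤K₀) (0≤+ 0≤1ℝ X.0≤u)) 0≤1ℝ)
           (0≤* (≤⇒0≤- X.u≤1) (0≤x*x (x - y))))
      (modulo Y.inverse (solve 5 (λ x y u v k →
        let p = (y :+ con 1ℚ) :* v
            Δ = x :- y
            two = con (+ 2 ℚ./ 1)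
            four = con (+ 4 ℚ./ 1)
        in (four :* k :+ con 1ℚ) :* (Δ :* Δ)
           := con ½ :* ((y :+ con 1ℚ) :* (y :+ con 1ℚ))
                :* (two :* k :* (two :* (u :* v :* Δ) :* (two :* (u :* v :* Δ))))
              :+ u :* (Δ :* Δ)
              :+ (four :* k :* (con 1ℚ :+ u) :+ con 1ℚ) :* ((con 1ℚ :- u) :* (Δ :* Δ))
              :+ (:- (four :* k :* (Δ :* Δ) :* (u :* u) :* (p :+ con 1ℚ))) :* (p :- con 1ℚ))
        ≃-refl x y X.u Y.u K₀)))
    where
    module X = Point x∈
    module Y = Point y∈
    h≃ : X.z - Y.z ≃ 2ℝ * (X.u * Y.u * (x - y))
    h≃ = modulo X.inverse (modulo Y.inverse (solve 4 (λ x y u v →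
      let p = (y :+ con 1ℚ) :* v
          q = (x :+ con 1ℚ) :* u
      in (x :- con 1ℚ) :* u :- (y :- con 1ℚ) :* v
         := con (+ 2 ℚ./ 1) :* (u :* v :* (x :- y))
            :+ (y :- con 1ℚ) :* v :* (q :- con 1ℚ)
            :+ (:- ((x :- con 1ℚ) :* u)) :* (p :- con 1ℚ))
      ≃-refl x y X.u Y.u))
    F-bound : ∣ fromℚ (+ 4 ℚ./ 1) * y * (Y.u * Y.u) * (a - b) - 2ℝ * (X.u * Y.u * (x - y)) ∣
      ≤ 2ℝ * K₀ * (2ℝ * (X.u * Y.u * (x - y)) * (2ℝ * (X.u * Y.u * (x - y))))
    F-bound = ∣∣≤-by
      (+-cong (modulo Y.inverse (solve 3 (λ y v a →
        let p = (y :+ con 1ℚ) :* v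
            w = (y :- con 1ℚ) :* v
        in con (+ 4 ℚ./ 1) :* y :* (v :* v) :* a
           := (con 1ℚ :- w :* w) :* a :+ (p :+ con 1ℚ) :* a :* (p :- con 1ℚ))
        ≃-refl y Y.u (a - b))) (-‿cong (≃-sym h≃)))
      h
      (≤-reflexive (*-cong ≃-refl (*-cong h≃ h≃)))

  log-quadratic : ∀ {x y} (x∈ : Domain x) (y∈ : Domain y) →
    ∣ y * (log x (proj₁ x∈) - log y (proj₁ y∈)) - (x - y) ∣ ≤ K₁ * ((x - y) * (x - y))
  log-quadratic {x} {y} x∈@(0<x , _) y∈@(0<y , _) = ∣∣≤-by
    (+-cong (*-cong ≃-refl (+-cong (log-series x 0<x) (-‿cong (log-series y 0<y)))) ≃-refl)
    (combine x∈ y∈ (series (artanhTerm (cayley x 0<x)) (logDominated x 0<x))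
      (series (artanhTerm (cayley y 0<y)) (logDominated y 0<y)) estimate)
    ≤-refl
    where
    z w : ℝ
    z = cayley x 0<x
    w = cayley y 0<y
    module X = Point x∈
    module Y = Point y∈
    estimate : ∣ (1ℝ - w * w) * (series (artanhTerm (cayley x 0<x)) (logDominated x 0<x)
        - series (artanhTerm (cayley y 0<y)) (logDominated y 0<y)) - (z - w) ∣ ≤ 2ℝ * K₀ * ((z - w) * (z - w))
    estimate = ArtanhQuadratic.limit-bound {cayley x 0<x} {cayley y 0<y} X.∣z∣≤1 Y.∣z∣≤1 X.z²≤r Y.z²≤r
      (fromℚ-mono (ℚ.<⇒≤ r<1)) 0≤K₀ K₀-inverse (logDominated x 0<x) (logDominated y 0<y)
      (^ᴿ-⟶-0 (0≤x*x w) Y.z²≤r r<1)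

  -- Hence x · exp (- log x) is constant on the domain.
  K₂ B K₃ : ℝ
  K₂ = fromℚ (ℚ-Lemmas.recip c 0<c) * (1ℝ + K₁ * (fromℚ C + fromℚ C))
  B = K₂ * (fromℚ C + fromℚ C)
  K₃ = exp B * K₁ + exp B * K₂ + fromℚ C * (K₂ * K₂ * exp B)

  0≤C : 0ℝ ≤ fromℚ C
  0≤C = fromℚ-mono (ℚ.≤-trans ℚ-Lemmas.0≤1 1≤C)

  ∣x∣≤C : ∀ {x} → Domain x → ∣ x ∣ ≤ fromℚ C
  ∣x∣≤C (0<x , _ , x≤C) = 0≤⇒∣∣≤ (<⇒≤ 0<x) x≤C

  -- In y l = (x - y) + O((x - y)²), the bound y ≥ c permits the division and ∣ x - y ∣ ≤ 2C makes
  -- the quadratic term linear.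
  lipschitz : ∀ {x y} → Domain x → Domain y → ∀ l →
    ∣ y * l - (x - y) ∣ ≤ K₁ * ((x - y) * (x - y)) → ∣ l ∣ ≤ K₂ * ∣ x - y ∣
  lipschitz {x} {y} x∈ y∈ l h = ≤-trans
    (≤-by (0≤* 0≤c⁻¹ (≤⇒0≤- (*-monoʳ-≤ (0≤∣∣ l) (proj₁ (proj₂ y∈)))))
      (modulo (≃-pointwise {fromℚ c * fromℚ c⁻¹} {1ℝ} λ _ → ℚ-Lemmas.*-recip c 0<c)
        (solve 4 (λ i y l c → i :* (y :* l)
            := l :+ i :* (y :* l :- c :* l) :+ l :* (c :* i :- con 1ℚ))
          ≃-refl (fromℚ c⁻¹) y ∣ l ∣ (fromℚ c))))
    (≤-respʳ (solve 3 (λ i k d → i :* (k :* d) := i :* k :* d) ≃-refl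
        (fromℚ c⁻¹) (1ℝ + K₁ * (fromℚ C + fromℚ C)) ∣ x - y ∣)
      (*-monoˡ-≤ 0≤c⁻¹ (≤-trans
        (≤-respˡ (≃-trans (∣*∣ y l) (*-cong (≃-sym (0≤⇒≃∣∣ (<⇒≤ (proj₁ y∈)))) ≃-refl))
          (∣∣≤-by (solve 2 (λ y d → y := d :+ (y :- d)) ≃-refl (y * l) (x - y)) (∣∣≤-+ ≤-refl h) ≤-refl))
        (≤-by (0≤* (0≤* 0≤K₁ (0≤∣∣ (x - y))) (≤⇒0≤- (∣∣≤-- (∣x∣≤C x∈) (∣x∣≤C y∈))))
          (modulo (∣x∣*∣x∣ (x - y)) (solve 4 (λ d k c s →
            (con 1ℚ :+ k :* (c :+ c)) :* d
            := d :+ k :* s :+ k :* d :* (c :+ c :- d) :+ k :* (d :* d :- s))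
            ≃-refl ∣ x - y ∣ K₁ (fromℚ C) ((x - y) * (x - y))))))))
    where
    c⁻¹ = ℚ-Lemmas.recip c 0<c
    0≤c⁻¹ : 0ℝ ≤ fromℚ c⁻¹
    0≤c⁻¹ = fromℚ-mono (ℚ.<⇒≤ (ℚ-Lemmas.recip-pos c 0<c))

  1∈ : Domain 1ℝ
  1∈ = 0<fromℚ ℚ-Lemmas.0<1 , fromℚ-mono c≤1 , fromℚ-mono 1≤C

  0≤K₂ : 0ℝ ≤ K₂
  0≤K₂ = 0≤* (fromℚ-mono (ℚ.<⇒≤ (ℚ-Lemmas.recip-pos c 0<c)))
    (0≤+ 0≤1ℝ (0≤* 0≤K₁ (0≤+ 0≤C 0≤C)))

  log-bound : ∀ {x} (x∈ : Domain x) → ∣ log x (proj₁ x∈) ∣ ≤ B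
  log-bound {x} x∈ = ∣∣≤-by
    (≃-trans (solve 1 (λ l → l := l :- con 0ℚ) ≃-refl (log x (proj₁ x∈)))
      (+-cong ≃-refl (-‿cong (≃-sym (log-1 (proj₁ 1∈))))))
    (lipschitz x∈ 1∈ (log x (proj₁ x∈) - log 1ℝ (proj₁ 1∈)) (log-quadratic x∈ 1∈))
    (*-monoˡ-≤ 0≤K₂ (∣∣≤-- (∣x∣≤C x∈) (∣x∣≤C 1∈)))

  -- To first order `exp (- l)` is (1 - (l - m)) `exp (- m)`, and y (l - m) cancels x - y; only
  -- quadratic terms remain.
  product-quadratic : ∀ {x y} → Domain x → Domain y → ∀ l m → ∣ l ∣ ≤ B → ∣ m ∣ ≤ B →
    ∣ y * (l - m) - (x - y) ∣ ≤ K₁ * ((x - y) * (x - y)) →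
    ∣ x * exp (- l) - y * exp (- m) ∣ ≤ K₃ * ((x - y) * (x - y))
  product-quadratic {x} {y} x∈ y∈ l m hl hm h = ∣∣≤-by
    (solve 6 (λ x y l m E F → x :* E :- y :* F
      := :- F :* (y :* (l :- m) :- (x :- y)) :- F :* ((x :- y) :* (l :- m))
         :+ x :* (E :- F :- (:- l :- :- m) :* F)) ≃-refl x y l m (exp (- l)) (exp (- m)))
    (∣∣≤-+ (∣∣≤-- (∣∣≤-* (∣∣≤-neg (exp-∣∣≤ (∣∣≤-neg hm))) h)
                  (∣∣≤-* (exp-∣∣≤ (∣∣≤-neg hm)) (∣∣≤-* ≤-refl (lipschitz x∈ y∈ (l - m) h))))
           (∣∣≤-* (∣x∣≤C x∈) (exp-quadratic (∣∣≤-neg hl) (∣∣≤-neg hm))))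
    (≤-by (0≤* (0≤* 0≤C (exp-nonneg B)) (≤⇒0≤- square))
      (modulo (∣x∣*∣x∣ (x - y)) (solve 8 (λ e k j c s d l m →
        (e :* k :+ e :* j :+ c :* (j :* j :* e)) :* s
        := e :* (k :* s) :+ e :* (d :* (j :* d)) :+ c :* ((:- l :- :- m) :* (:- l :- :- m) :* e)
           :+ c :* e :* (j :* j :* s :- (l :- m) :* (l :- m))
           :+ (:- (e :* j)) :* (d :* d :- s))
        ≃-refl (exp B) K₁ K₂ (fromℚ C) ((x - y) * (x - y)) ∣ x - y ∣ l m)))
    where
    square : (l - m) * (l - m) ≤ K₂ * K₂ * ((x - y) * (x - y))
    square = ≤-respˡ (∣x∣*∣x∣ (l - m)) (≤-respʳ
      (≃-trans (solve 2 (λ k d → k :* d :* (k :* d) := k :* k :* (d :* d)) ≃-refl K₂ ∣ x - y ∣)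
        (*-cong ≃-refl (∣x∣*∣x∣ (x - y))))
      (*-mono-≤ (0≤∣∣ (l - m)) (0≤* 0≤K₂ (0≤∣∣ (x - y)))
        (lipschitz x∈ y∈ (l - m) h) (lipschitz x∈ y∈ (l - m) h)))

  midpoint : ∀ {x y} → Domain x → Domain y → Domain (½ᴿ * (x + y))
  midpoint {x} {y} (0<x , c≤x , x≤C) (0<y , c≤y , y≤C) =
    fromℚ≤⇒0< 0<c c≤mid , c≤mid ,
    ≤-respʳ (solve 1 (λ C → con ½ :* (C :+ C) := C) ≃-refl (fromℚ C))
      (*-monoˡ-≤ 0≤½ (+-mono-≤ x≤C y≤C))
    where
    0≤½ : 0ℝ ≤ ½ᴿ
    0≤½ = fromℚ-mono (from-yes (0ℚ ℚ.≤? + 1 ℚ./ 2))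
    c≤mid : fromℚ c ≤ ½ᴿ * (x + y)
    c≤mid = ≤-respˡ (solve 1 (λ c → con ½ :* (c :+ c) := c) ≃-refl (fromℚ c))
      (*-monoˡ-≤ 0≤½ (+-mono-≤ c≤x c≤y))

  open Constancy {Domain} (λ x x∈ → x * exp (- log x (proj₁ x∈))) K₃ midpoint
    (λ x y x∈ y∈ → product-quadratic x∈ y∈ (log x (proj₁ x∈)) (log y (proj₁ y∈))
      (log-bound x∈) (log-bound y∈) (log-quadratic x∈ y∈)) public

  at-1 : ∀ l → l ≃ 0ℝ → 1ℝ * exp (- l) ≃ 1ℝ
  at-1 l h = ≃-trans
    (*-cong ≃-refl (≃-trans
      (exp-cong { - l} {0ℝ} (≃-trans (-‿cong h) (solve 0 (:- con 0ℚ := con 0ℚ) ≃-refl))) exp-0))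
    (solve 0 (con 1ℚ :* con 1ℚ := con 1ℚ) ≃-refl)

  x*exp-log : ∀ {x} (x∈ : Domain x) → x * exp (- log x (proj₁ x∈)) ≃ 1ℝ
  x*exp-log {x} x∈ = ≃-trans (constant x 1ℝ x∈ 1∈)
    (at-1 (log 1ℝ (proj₁ 1∈)) (log-1 (proj₁ 1∈)))

exp-by-inverse : ∀ x l → x * exp (- l) ≃ 1ℝ → exp l ≃ x
exp-by-inverse x l h = begin-equality
  exp l                         ≈⟨ solve 1 (λ e → e := e :* con 1ℚ) ≃-refl (exp l) ⟩
  exp l * 1ℝ                    ≈⟨ *-cong ≃-refl (≃-sym h) ⟩
  exp l * (x * exp (- l))       ≈⟨ solve 3 (λ e x f → e :* (x :* f) := e :* f :* x) ≃-refl (exp l) x (exp (- l)) ⟩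
  exp l * exp (- l) * x         ≈⟨ *-cong (exp-inverse l) ≃-refl ⟩
  1ℝ * x                        ≈⟨ solve 1 (λ x → con 1ℚ :* x := x) ≃-refl x ⟩
  x                             ∎
  where open ≤-Reasoning

exp-log : ∀ x 0<x → exp (log x 0<x) ≃ x
exp-log x 0<x = exp-by-inverse x (log x 0<x) (x*exp-log (0<x ,
  ≤-trans (fromℚ-mono (ℚ.p⊓q≤p (proj₁ lower) 1ℚ)) (proj₂ (proj₂ lower)) ,
  ≤-trans (≤-trans (x≤∣x∣ x) (proj₂ (proj₂ upper))) (fromℚ-mono (ℚ.p≤p⊔q (proj₁ upper) 1ℚ))))
  where
  lower = 0<⇒fromℚ≤ 0<x
  upper = bounded x
  -- The minimum and the maximum with 1 put the point 1 into the domain, where the constant product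
  -- is evaluated.
  c C : ℚ
  c = proj₁ lower ℚ.⊓ 1ℚ
  C = proj₁ upper ℚ.⊔ 1ℚ
  0<c : 0ℚ ℚ.< c
  0<c with ℚ.⊓-sel (proj₁ lower) 1ℚ
  ... | inj₁ e = subst (0ℚ ℚ.<_) (sym e) (proj₁ (proj₂ lower))
  ... | inj₂ e = subst (0ℚ ℚ.<_) (sym e) ℚ-Lemmas.0<1
  open LogQuadratic c C 0<c (ℚ.p⊓q≤q (proj₁ lower) 1ℚ) (ℚ.p≤q⊔p (proj₁ upper) 1ℚ)

-- Real powers

log-mono-≤ : ∀ {x y} → x ≤ y → ∀ 0<x 0<y → log x 0<x ≤ log y 0<y
log-mono-≤ {x} {y} x≤y 0<x 0<y = exp-cancel-≤ {log x 0<x} {log y 0<y}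
  (≤-respˡ (≃-sym (exp-log x 0<x)) (≤-respʳ (≃-sym (exp-log y 0<y)) x≤y))

-- In particular log does not depend on the positivity proof, although the clamping bound inside
-- that proof enters its definition.
log-cong : ∀ {x y} → x ≃ y → ∀ 0<x 0<y → log x 0<x ≃ log y 0<y
log-cong h 0<x 0<y =
  ≤-antisym (log-mono-≤ (≤-reflexive h) 0<x 0<y) (log-mono-≤ (≤-reflexive (≃-sym h)) 0<y 0<x)

log-* : ∀ x y 0<x 0<y 0<xy → log (x * y) 0<xy ≃ log x 0<x + log y 0<y
log-* x y 0<x 0<y 0<xy = exp-injective {log (x * y) 0<xy} {log x 0<x + log y 0<y}
  (≃-trans (exp-log (x * y) 0<xy) (≃-sym (≃-trans (exp-+ (log x 0<x) (log y 0<y))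
    (*-cong (exp-log x 0<x) (exp-log y 0<y)))))

pow-cong : ∀ {x y} s → x ≃ y → ∀ 0<x 0<y → pow x 0<x s ≃ pow y 0<y s
pow-cong {x} {y} s h 0<x 0<y = exp-cong {s * log x 0<x} {s * log y 0<y}
  (*-cong ≃-refl (log-cong h 0<x 0<y))

pow-* : ∀ x y s 0<x 0<y 0<xy → pow (x * y) 0<xy s ≃ pow x 0<x s * pow y 0<y s
pow-* x y s 0<x 0<y 0<xy = ≃-trans
  (exp-cong {s * log (x * y) 0<xy} {s * log x 0<x + s * log y 0<y}
    (≃-trans (*-cong ≃-refl (log-* x y 0<x 0<y 0<xy))
      (solve 3 (λ s a b → s :* (a :+ b) := s :* a :+ s :* b) ≃-refl s (log x 0<x) (log y 0<y))))
  (exp-+ (s * log x 0<x) (s * log y 0<y))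

module PowTaylor (s : ℝ) where

  open LogQuadratic ½ (+ 2 ℚ./ 1) ℚ-Lemmas.0<½ (from-yes (½ ℚ.≤? 1ℚ)) (from-yes (1ℚ ℚ.≤? + 2 ℚ./ 1))
    using (Domain; 1∈; K₁; 0≤K₁; log-quadratic)

  -- `N` is a Lipschitz constant at 0 for log (1 + t) with ∣ t ∣ ≤ ½, and `B` bounds s log (1 + t).
  -- The summands of `K` are the quadratic errors of log and of exp.
  N B K : ℝ
  N = 1ℝ + K₁ * fromℚ ½
  B = ∣ s ∣ * (N * fromℚ ½)
  K = ∣ s ∣ * K₁ + ∣ s ∣ * N * (∣ s ∣ * N) * exp B

  0≤½ : 0ℝ ≤ fromℚ ½
  0≤½ = fromℚ-mono (ℚ.<⇒≤ ℚ-Lemmas.0<½)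

  0≤N : 0ℝ ≤ N
  0≤N = 0≤+ 0≤1ℝ (0≤* 0≤K₁ 0≤½)

  0≤K : 0ℝ ≤ K
  0≤K = 0≤+ (0≤* (0≤∣∣ s) 0≤K₁)
    (0≤* (0≤* (0≤* (0≤∣∣ s) 0≤N) (0≤* (0≤∣∣ s) 0≤N)) (exp-nonneg B))

  ½≤1+t : ∀ {t} → ∣ t ∣ ≤ fromℚ ½ → fromℚ ½ ≤ 1ℝ + t
  ½≤1+t {t} h = ≤-by (≤⇒0≤- (≤-trans (-x≤∣x∣ t) h))
    (solve 1 (λ t → con 1ℚ :+ t := con ½ :+ (con ½ :- :- t)) ≃-refl t)

  1+t≤2 : ∀ {t} → ∣ t ∣ ≤ fromℚ ½ → 1ℝ + t ≤ fromℚ (+ 2 ℚ./ 1)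
  1+t≤2 {t} h = ≤-trans (+-mono-≤ (≤-refl {1ℝ}) (≤-trans (x≤∣x∣ t) h))
    (≤-pointwise λ _ → from-yes (1ℚ ℚ.+ ½ ℚ.≤? + 2 ℚ./ 1))

  exp-taylor : ∀ t l → ∣ t ∣ ≤ fromℚ ½ → ∣ l - t ∣ ≤ K₁ * (t * t) →
    ∣ exp (s * l) - (1ℝ + s * t) ∣ ≤ K * (t * t)
  exp-taylor t l ht h = ∣∣≤-by
    (modulo exp-0 (solve 5 (λ s t l E Z →
      E :- (con 1ℚ :+ s :* t)
      := s :* (l :- t) :+ (E :- Z :- (s :* l :- con 0ℚ) :* Z)
         :+ (con 1ℚ :+ s :* l) :* (Z :- con 1ℚ)) ≃-refl s t l (exp (s * l)) (exp 0ℝ)))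
    (∣∣≤-+ (∣∣≤-* (≤-refl {∣ s ∣}) h) (exp-quadratic sl≤B 0≤B))
    (≤-by (0≤* (≤⇒0≤- square) (exp-nonneg B))
      (solve 7 (λ a k n e s l t →
        (a :* k :+ a :* n :* (a :* n) :* e) :* (t :* t)
        := a :* (k :* (t :* t)) :+ (s :* l :- con 0ℚ) :* (s :* l :- con 0ℚ) :* e
           :+ (a :* n :* (a :* n) :* (t :* t) :- s :* l :* (s :* l)) :* e)
        ≃-refl ∣ s ∣ K₁ N (exp B) s l t))
    where
    l≤ : ∣ l ∣ ≤ N * ∣ t ∣
    l≤ = ∣∣≤-by (solve 2 (λ l t → l := t :+ (l :- t)) ≃-refl l t) (∣∣≤-+ (≤-refl {∣ t ∣}) h)
      (≤-by (0≤* 0≤K₁ (0≤* (0≤∣∣ t) (≤⇒0≤- ht))) (modulo (∣x∣*∣x∣ t) (solve 3 (λ k d q →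
        (con 1ℚ :+ k :* con ½) :* d := d :+ k :* q :+ k :* (d :* (con ½ :- d)) :+ k :* (d :* d :- q))
        ≃-refl K₁ ∣ t ∣ (t * t))))
    sl≤ : ∣ s * l ∣ ≤ ∣ s ∣ * (N * ∣ t ∣)
    sl≤ = ∣∣≤-* (≤-refl {∣ s ∣}) l≤
    sl≤B : ∣ s * l ∣ ≤ B
    sl≤B = ≤-trans sl≤ (*-monoˡ-≤ (0≤∣∣ s) (*-monoˡ-≤ 0≤N ht))
    0≤B : ∣ 0ℝ ∣ ≤ B
    0≤B = ≤-trans (≤-pointwise λ _ → ℚ.≤-refl) (0≤* (0≤∣∣ s) (0≤* 0≤N 0≤½))
    square : s * l * (s * l) ≤ ∣ s ∣ * N * (∣ s ∣ * N) * (t * t)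
    square = ≤-respˡ (∣x∣*∣x∣ (s * l)) (≤-respʳ
      (modulo (∣x∣*∣x∣ t) (solve 4 (λ a n d q →
        a :* (n :* d) :* (a :* (n :* d)) := a :* n :* (a :* n) :* q :+ a :* n :* (a :* n) :* (d :* d :- q))
        ≃-refl (∣ s ∣) N (∣ t ∣) (t * t)))
      (*-mono-≤ (0≤∣∣ (s * l)) (0≤* (0≤∣∣ s) (0≤* 0≤N (0≤∣∣ t))) sl≤ sl≤))

  log-taylor-by : ∀ t l z → z ≃ 0ℝ →
    ∣ 1ℝ * (l - z) - (1ℝ + t - 1ℝ) ∣ ≤ K₁ * ((1ℝ + t - 1ℝ) * (1ℝ + t - 1ℝ)) →
    ∣ l - t ∣ ≤ K₁ * (t * t)
  log-taylor-by t l z z≃0 h = ∣∣≤-by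
    (modulo z≃0 (solve 3 (λ l t z →
      l :- t := con 1ℚ :* (l :- z) :- (con 1ℚ :+ t :- con 1ℚ) :+ con 1ℚ :* (z :- con 0ℚ))
      ≃-refl l t z))
    h
    (≤-reflexive (solve 2 (λ k t → k :* ((con 1ℚ :+ t :- con 1ℚ) :* (con 1ℚ :+ t :- con 1ℚ)) := k :* (t :* t))
      ≃-refl K₁ t))

  log-taylor : ∀ t 0<1+t → ∣ t ∣ ≤ fromℚ ½ → ∣ log (1ℝ + t) 0<1+t - t ∣ ≤ K₁ * (t * t)
  log-taylor t 0<1+t h = log-taylor-by t (log (1ℝ + t) 0<1+t) (log 1ℝ (proj₁ 1∈)) (log-1 (proj₁ 1∈))
    (log-quadratic (0<1+t , ½≤1+t h , 1+t≤2 h) 1∈)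

  pow-taylor : ∀ t 0<1+t → ∣ t ∣ ≤ fromℚ ½ → ∣ pow (1ℝ + t) 0<1+t s - (1ℝ + s * t) ∣ ≤ K * (t * t)
  pow-taylor t 0<1+t h = exp-taylor t (log (1ℝ + t) 0<1+t) h (log-taylor t 0<1+t h)

-- Here c = 1 / (A + 1) and w = a / (a A + b) are the logarithmic derivatives of
-- numerator and denominator of (A + 1) / (a A + b); primes mark the values at
-- A + Δ, and 1 + t is the ratio of the two values of the fraction.
module TermTaylor {s K Δ c c′ w w′ F F′ φ : ℝ} (0≤K : 0ℝ ≤ K) (0≤F : 0ℝ ≤ F)
  (∣Δ∣≤1 : ∣ Δ ∣ ≤ 1ℝ)
  (∣c∣≤1 : ∣ c ∣ ≤ 1ℝ) (∣c′∣≤1 : ∣ c′ ∣ ≤ 1ℝ)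
  (∣w∣≤3 : ∣ w ∣ ≤ fromℚ (+ 3 ℚ./ 1)) (∣w′∣≤3 : ∣ w′ ∣ ≤ fromℚ (+ 3 ℚ./ 1))
  (c-change : c′ ≃ c - Δ * (c * c′)) (w-change : w′ ≃ w - Δ * (w * w′)) where

  -- The numerator changes by the factor 1 + Δ c and the reciprocal of the denominator by 1 - Δ w′;
  -- `t` is the expansion of their product minus 1.
  t h h′ : ℝ
  t = Δ * (c - w′ - Δ * c * w′)
  h = s * (c - w)
  h′ = s * (c′ - w′)

  7ℝ : ℝ
  7ℝ = fromℚ (+ 7 ℚ./ 1)

  t-bound : ∣ t ∣ ≤ 7ℝ * ∣ Δ ∣
  t-bound = ≤-trans (∣∣≤-* (≤-refl {∣ Δ ∣})
      (∣∣≤-- (∣∣≤-- ∣c∣≤1 ∣w′∣≤3) (∣∣≤-* (∣∣≤-* ∣Δ∣≤1 ∣c∣≤1) ∣w′∣≤3)))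
    (≤-reflexive (solve 1 (λ d → d :* (con 1ℚ :+ con (+ 3 ℚ./ 1) :+ con 1ℚ :* con 1ℚ :* con (+ 3 ℚ./ 1))
      := con (+ 7 ℚ./ 1) :* d) ≃-refl ∣ Δ ∣))

  t²-bound : t * t ≤ fromℚ (+ 49 ℚ./ 1) * (Δ * Δ)
  t²-bound = ≤-respˡ (∣x∣*∣x∣ t) (≤-respʳ
    (modulo (∣x∣*∣x∣ Δ) (solve 2 (λ d q → con (+ 7 ℚ./ 1) :* d :* (con (+ 7 ℚ./ 1) :* d)
      := con (+ 49 ℚ./ 1) :* q :+ con (+ 49 ℚ./ 1) :* (d :* d :- q)) ≃-refl ∣ Δ ∣ (Δ * Δ)))
    (*-mono-≤ (0≤∣∣ t) (0≤* (fromℚ-mono (from-yes (0ℚ ℚ.≤? + 7 ℚ./ 1))) (0≤∣∣ Δ)) t-bound t-bound))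

  -- Here 49 = 7² comes from ∣ t ∣ ≤ 7 ∣ Δ ∣, and 12 = 3 · 3 + 1 · 3 bounds w w′ - c w′, the price
  -- of replacing w′ by w in t.
  K₁ : ℝ
  K₁ = fromℚ (+ 49 ℚ./ 1) * K + fromℚ (+ 12 ℚ./ 1) * ∣ s ∣

  ∣F∣≤F : ∣ F ∣ ≤ F
  ∣F∣≤F = 0≤⇒∣∣≤ 0≤F ≤-refl

  ∣Δ²∣≤ : ∣ Δ * Δ ∣ ≤ Δ * Δ
  ∣Δ²∣≤ = 0≤⇒∣∣≤ (0≤x*x Δ) ≤-refl

  module _ (ratio : F′ ≃ F * φ) (taylor : ∣ φ - (1ℝ + s * t) ∣ ≤ K * (t * t)) where

    first-order : ∣ F′ - F - F * h * Δ ∣ ≤ F * (K₁ * (Δ * Δ))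
    first-order = ∣∣≤-by
      (modulo ratio (modulo w-change (solve 8 (λ s Δ c w w′ F F′ φ →
        F′ :- F :- F :* (s :* (c :- w)) :* Δ
        := F :* ((φ :- (con 1ℚ :+ s :* (Δ :* (c :- w′ :- Δ :* c :* w′))))
                 :+ s :* (Δ :* Δ :* (w :* w′ :- c :* w′)))
           :+ con 1ℚ :* (F′ :- F :* φ)
           :+ (:- (F :* s :* Δ)) :* (w′ :- (w :- Δ :* (w :* w′))))
        ≃-refl s Δ c w w′ F F′ φ)))
      (∣∣≤-* ∣F∣≤F (∣∣≤-+ taylor (∣∣≤-* (≤-refl {∣ s ∣})
        (∣∣≤-* ∣Δ²∣≤ (∣∣≤-- (∣∣≤-* ∣w∣≤3 ∣w′∣≤3) (∣∣≤-* ∣c∣≤1 ∣w′∣≤3))))))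
      (*-monoˡ-≤ 0≤F (≤-by (0≤* 0≤K (≤⇒0≤- t²-bound)) (solve 4 (λ k a d q →
        (con (+ 49 ℚ./ 1) :* k :+ con (+ 12 ℚ./ 1) :* a) :* d
        := k :* q :+ a :* (d :* (con (+ 3 ℚ./ 1) :* con (+ 3 ℚ./ 1) :+ con 1ℚ :* con (+ 3 ℚ./ 1)))
           :+ k :* (con (+ 49 ℚ./ 1) :* d :- q)) ≃-refl K (∣ s ∣) (Δ * Δ) (t * t))))

    -- The numbers 4, 28 and 40 bound c′ - w′, c² c′ - w² w′ and (c - w) (w w′ - c c′), given that
    -- c, c′ are at most 1 and w, w′ at most 3 in absolute value.
    K₂ : ℝ
    K₂ = K₁ * (∣ s ∣ * fromℚ (+ 4 ℚ./ 1)) + ∣ s ∣ * fromℚ (+ 28 ℚ./ 1)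
         + ∣ s ∣ * ∣ s ∣ * fromℚ (+ 40 ℚ./ 1)

    second-order : ∣ F′ * h′ - F * h - F * (h * h + s * (w * w - c * c)) * Δ ∣ ≤ F * (K₂ * (Δ * Δ))
    second-order = ∣∣≤-by
      (modulo c-change (modulo w-change (solve 8 (λ s Δ c c′ w w′ F F′ →
        let h  = s :* (c :- w)
            h′ = s :* (c′ :- w′)
            C  = c′ :- (c :- Δ :* (c :* c′))
            W  = w′ :- (w :- Δ :* (w :* w′))
        in F′ :* h′ :- F :* h :- F :* (h :* h :+ s :* (w :* w :- c :* c)) :* Δ
           := (F′ :- F :- F :* h :* Δ) :* h′
              :+ F :* (s :* (Δ :* Δ :* (c :* c :* c′ :- w :* w :* w′)))
              :+ F :* (s :* (c :- w) :* (s :* (Δ :* Δ :* (w :* w′ :- c :* c′))))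
              :+ (F :* (s :* (con 1ℚ :- c :* Δ) :+ h :* Δ :* s)) :* C
              :+ (:- (F :* (s :* (con 1ℚ :- w :* Δ) :+ h :* Δ :* s))) :* W)
        ≃-refl s Δ c c′ w w′ F F′)))
      (∣∣≤-+ (∣∣≤-+
        (∣∣≤-* first-order (∣∣≤-* (≤-refl {∣ s ∣}) (∣∣≤-- ∣c′∣≤1 ∣w′∣≤3)))
        (∣∣≤-* ∣F∣≤F (∣∣≤-* (≤-refl {∣ s ∣}) (∣∣≤-* ∣Δ²∣≤
          (∣∣≤-- (∣∣≤-* (∣∣≤-* ∣c∣≤1 ∣c∣≤1) ∣c′∣≤1) (∣∣≤-* (∣∣≤-* ∣w∣≤3 ∣w∣≤3) ∣w′∣≤3))))))
        (∣∣≤-* ∣F∣≤F (∣∣≤-* (∣∣≤-* (≤-refl {∣ s ∣}) (∣∣≤-- ∣c∣≤1 ∣w∣≤3)) (∣∣≤-* (≤-refl {∣ s ∣})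
          (∣∣≤-* ∣Δ²∣≤ (∣∣≤-- (∣∣≤-* ∣w∣≤3 ∣w′∣≤3) (∣∣≤-* ∣c∣≤1 ∣c′∣≤1)))))))
      (≤-reflexive (solve 4 (λ F k a d →
        let one   = con 1ℚ
            three = con (+ 3 ℚ./ 1)
        in F :* (k :* d) :* (a :* (one :+ three))
             :+ F :* (a :* (d :* (one :* one :* one :+ three :* three :* three)))
             :+ F :* (a :* (one :+ three) :* (a :* (d :* (three :* three :+ one :* one))))
           := F :* ((k :* (a :* con (+ 4 ℚ./ 1)) :+ a :* con (+ 28 ℚ./ 1)
                :+ a :* a :* con (+ 40 ℚ./ 1)) :* d))
        ≃-refl F K₁ (∣ s ∣) (Δ * Δ)))

-- Unordered sums

∈⇒↭∷ : ∀ {A : Set} {x : A} {xs} → x ∈ xs → ∃[ ys ] xs ↭ x ∷ ys × (Unique xs → Unique ys × x ∉ ys)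
∈⇒↭∷ {x = x} (here refl) = _ , ↭.refl , λ { (x≢ ∷ u) → u , λ x∈ → All.lookup x≢ x∈ refl }
∈⇒↭∷ {x = x} (there {y} x∈) =
  let ys , p , q = ∈⇒↭∷ x∈ in
  y ∷ ys , ↭.trans (prep y p) (swap y x ↭.refl) , λ { (y≢ ∷ u) →
    let uys , x∉ys = q u
        y≢xys = All-resp-↭ p y≢
    in All.tail y≢xys ∷ uys , λ { (here e) → All.head y≢xys (sym e) ; (there h) → x∉ys h } }

⊆⇒↭++ : ∀ {A : Set} {xs ys : List A} → Unique xs → Unique ys → xs ⊆ ys →
  ∃[ zs ] ys ↭ xs ++ zs × (∀ {z} → z ∈ zs → z ∉ xs)
⊆⇒↭++ {xs = []} _ _ _ = _ , ↭.refl , λ _ ()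
⊆⇒↭++ {xs = x ∷ xs} (x≢ ∷ uxs) uys xs⊆ys =
  let rest , p , q = ∈⇒↭∷ (xs⊆ys (here refl))
      urest , x∉rest = q uys
      zs , p′ , q′ = ⊆⇒↭++ uxs urest λ {z} z∈ → strengthen (∈-resp-↭ p (xs⊆ys (there z∈)))
        (λ e → All.lookup x≢ z∈ (sym e))
  in zs , ↭.trans p (prep x p′) , λ { z∈ (here refl) → x∉rest (∈-resp-↭ (↭-sym p′) (∈-++⁺ʳ xs z∈))
                                    ; z∈ (there h) → q′ z∈ h }
  where
  strengthen : ∀ {z rest} → z ∈ x ∷ rest → z ≢ x → z ∈ rest
  strengthen (here e)  z≢x = contradiction e z≢x
  strengthen (there h) _   = h

module _ {I : Set} where

  sumOver-++ : ∀ (a : I → ℝ) F G → sumOver a (F ++ G) ≃ sumOver a F + sumOver a G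
  sumOver-++ a []      G = solve 1 (λ s → s := con 0ℚ :+ s) ≃-refl (sumOver a G)
  sumOver-++ a (i ∷ F) G = ≃-trans (+-cong ≃-refl (sumOver-++ a F G))
    (solve 3 (λ a s t → a :+ (s :+ t) := a :+ s :+ t) ≃-refl (a i) (sumOver a F) (sumOver a G))

  sumOver-↭ : ∀ (a : I → ℝ) {F G} → F ↭ G → sumOver a F ≃ sumOver a G
  sumOver-↭ a ↭.refl          = ≃-refl
  sumOver-↭ a (prep i p)      = +-cong ≃-refl (sumOver-↭ a p)
  sumOver-↭ a (↭.trans p q)   = ≃-trans (sumOver-↭ a p) (sumOver-↭ a q)
  sumOver-↭ a {_ ∷ _ ∷ F} {_ ∷ _ ∷ G} (swap i j p) = ≃-trans
    (+-cong ≃-refl (+-cong ≃-refl (sumOver-↭ a p)))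
    (solve 3 (λ a b s → a :+ (b :+ s) := b :+ (a :+ s)) ≃-refl (a i) (a j) (sumOver a G))

  sumOver-∣∣≤ : ∀ {a b : I → ℝ} → (∀ i → ∣ a i ∣ ≤ b i) → ∀ F → ∣ sumOver a F ∣ ≤ sumOver b F
  sumOver-∣∣≤ h []      = ≤-pointwise λ _ → ℚ.≤-refl
  sumOver-∣∣≤ h (i ∷ F) = ∣∣≤-+ (h i) (sumOver-∣∣≤ h F)

  sumOver-nonneg : ∀ {a : I → ℝ} → (∀ i → 0ℝ ≤ a i) → ∀ F → 0ℝ ≤ sumOver a F
  sumOver-nonneg h []      = ≤-refl
  sumOver-nonneg h (i ∷ F) = 0≤+ (h i) (sumOver-nonneg h F)

  sumOver-cong : ∀ {a b : I → ℝ} → (∀ i → a i ≃ b i) → ∀ F → sumOver a F ≃ sumOver b F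
  sumOver-cong h []      = ≃-refl
  sumOver-cong h (i ∷ F) = +-cong (h i) (sumOver-cong h F)

  sumOver-+ : ∀ (a b : I → ℝ) F → sumOver (λ i → a i + b i) F ≃ sumOver a F + sumOver b F
  sumOver-+ a b []      = solve 0 (con 0ℚ := con 0ℚ :+ con 0ℚ) ≃-refl
  sumOver-+ a b (i ∷ F) = ≃-trans (+-cong ≃-refl (sumOver-+ a b F))
    (solve 4 (λ a b s t → a :+ b :+ (s :+ t) := a :+ s :+ (b :+ t)) ≃-refl
      (a i) (b i) (sumOver a F) (sumOver b F))

  sumOver-* : ∀ c (a : I → ℝ) F → sumOver (λ i → c * a i) F ≃ c * sumOver a F
  sumOver-* c a []      = solve 1 (λ c → con 0ℚ := c :* con 0ℚ) ≃-refl c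
  sumOver-* c a (i ∷ F) = ≃-trans (+-cong ≃-refl (sumOver-* c a F))
    (solve 3 (λ c a s → c :* a :+ c :* s := c :* (a :+ s)) ≃-refl c (a i) (sumOver a F))

  sumOver-map : ∀ (a : I → ℝ) (σ : I → I) F → sumOver a (map σ F) ≡ sumOver (λ i → a (σ i)) F
  sumOver-map a σ []      = refl
  sumOver-map a σ (i ∷ F) = cong (λ t → a (σ i) + t) (sumOver-map a σ F)

  ∈⇒≤sumOver : ∀ {a : I → ℝ} → (∀ i → 0ℝ ≤ a i) → ∀ {i F} → i ∈ F → a i ≤ sumOver a F
  ∈⇒≤sumOver {a} h {F = _ ∷ F} (here refl) = ≤-by (sumOver-nonneg h F) ≃-refl
  ∈⇒≤sumOver {a} h {i} {j ∷ F} (there i∈F) = ≤-trans (∈⇒≤sumOver h i∈F)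
    (≤-by (h j) (solve 2 (λ a s → a :+ s := s :+ a) ≃-refl (a j) (sumOver a F)))

  HasSum-reindex : ∀ {a : I → ℝ} {l} (σ τ : I → I) → (∀ i → σ (τ i) ≡ i) → (∀ i → τ (σ i) ≡ i) →
    HasSum a l → HasSum (λ i → a (σ i)) l
  HasSum-reindex {a} {l} σ τ στ τσ h ε 0<ε =
    let F , unique , close = h ε 0<ε in
    map τ F , Unique.map⁺ (λ {i} {j} e → trans (sym (στ i)) (trans (cong σ e) (στ j))) unique ,
    λ G uniqueG τF⊆G → subst (λ t → ∣ t - l ∣ ≤ fromℚ ε) (sumOver-map a σ G)
      (close (map σ G) (Unique.map⁺ (λ {i} {j} e → trans (sym (τσ i)) (trans (cong τ e) (τσ j))) uniqueG)
        (λ {i} i∈F → subst (_∈ map σ G) (στ i) (∈-map⁺ σ (τF⊆G (∈-map⁺ τ i∈F)))))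

-- Summation along an exhaustion by finite sets

module Exhaustion {I : Set} (ball : ℕ → List I) (ball-unique : ∀ m → Unique (ball m))
  (ball-mono : ∀ {m n} → m ℕ.≤ n → ball m ⊆ ball n) (exhaust : ∀ i → ∃[ m ] i ∈ ball m) where

  exhaust-list : ∀ F → ∃[ m ] F ⊆ ball m
  exhaust-list []      = 0 , λ ()
  exhaust-list (i ∷ F) =
    let m , i∈ = exhaust i
        n , F⊆ = exhaust-list F
    in m ℕ.⊔ n , λ { (here refl) → ball-mono (ℕ.m≤m⊔n m n) i∈
                   ; (there j∈)  → ball-mono (ℕ.m≤n⊔m m n) (F⊆ j∈) }

  ballSum : (I → ℝ) → ℕ → ℝ
  ballSum a m = sumOver a (ball m)

  HasSum⇒⟶ : ∀ {a l} → HasSum a l → ballSum a ⟶ l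
  HasSum⇒⟶ h = mk⟶ λ ε 0<ε →
    let F , _ , close = h ε 0<ε
        m , F⊆ = exhaust-list F
    in m , λ n m≤n → close (ball n) (ball-unique n) (λ i∈ → ball-mono m≤n (F⊆ i∈))

  SmallTails : (I → ℝ) → Set
  SmallTails g = ∀ ε → 0ℚ ℚ.< ε →
    ∃[ m ] (∀ n → m ℕ.≤ n → ballSum g n ≤ ballSum g m + fromℚ ε)

  SmallTails-* : ∀ {g} c → 0ℝ ≤ c → SmallTails g → SmallTails (λ i → c * g i)
  SmallTails-* {g} c 0≤c small ε 0<ε =
    let B , 0<B , c≤B = bounded c
        m , close = small (ε ℚ.* ℚ-Lemmas.recip B 0<B) (ℚ-Lemmas.0<* 0<ε (ℚ-Lemmas.recip-pos B 0<B))
    in m , λ n m≤n → ≤-respˡ (≃-sym (sumOver-* c g (ball n))) (≤-trans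
      (*-monoˡ-≤ 0≤c (close n m≤n))
      (≤-by
        (≤⇒0≤- (*-monoʳ-≤ {z = fromℚ (ε ℚ.* ℚ-Lemmas.recip B 0<B)}
          (fromℚ-mono (ℚ.<⇒≤ (ℚ-Lemmas.0<* 0<ε (ℚ-Lemmas.recip-pos B 0<B)))) (≤-trans (x≤∣x∣ c) c≤B)))
        (≃-trans (+-cong (sumOver-* c g (ball m)) (≃-sym (scaled B 0<B)))
          (solve 4 (λ c s b e → c :* s :+ b :* e := c :* (s :+ e) :+ (b :* e :- c :* e)) ≃-refl
            c (ballSum g m) (fromℚ B) (fromℚ (ε ℚ.* ℚ-Lemmas.recip B 0<B))))))
    where
    open ℚ-Solver
    scaled : ∀ B 0<B → fromℚ B * fromℚ (ε ℚ.* ℚ-Lemmas.recip B 0<B) ≃ fromℚ ε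
    scaled B 0<B = ≃-pointwise λ _ → trans
      (≡-solve 3 (λ b e r → b ⊠ (e ⊠ r) ⊜ e ⊠ (b ⊠ r)) refl B ε (ℚ-Lemmas.recip B 0<B))
      (trans (cong (ε ℚ.*_) (ℚ-Lemmas.*-recip B 0<B)) (ℚ.*-identityʳ ε))

  module DominatedSum {a g : I → ℝ} (a≤g : ∀ i → ∣ a i ∣ ≤ g i) (small : SmallTails g) where

    0≤g : ∀ i → 0ℝ ≤ g i
    0≤g i = ≤-trans (0≤∣∣ (a i)) (a≤g i)

    increment : ∀ {F G} → Unique F → Unique G → F ⊆ G →
      ∣ sumOver a G - sumOver a F ∣ ≤ sumOver g G - sumOver g F
    increment {F} {G} uF uG F⊆G =
      let R , p , _ = ⊆⇒↭++ uF uG F⊆G in ∣∣≤-by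
      (≃-trans (+-cong (≃-trans (sumOver-↭ a p) (sumOver-++ a F R)) ≃-refl)
        (solve 2 (λ s t → s :+ t :- s := t) ≃-refl (sumOver a F) (sumOver a R)))
      (sumOver-∣∣≤ a≤g R)
      (≤-reflexive (≃-trans (solve 2 (λ s t → t := s :+ t :- s) ≃-refl (sumOver g F) (sumOver g R))
        (+-cong (≃-sym (≃-trans (sumOver-↭ g p) (sumOver-++ g F R))) ≃-refl)))

    sumOver-g-mono : ∀ {F G} → Unique F → Unique G → F ⊆ G → sumOver g F ≤ sumOver g G
    sumOver-g-mono {F} {G} uF uG F⊆G = ≤-by (≤-trans (0≤∣∣ _) (increment uF uG F⊆G))
      (solve 2 (λ s t → t := s :+ (t :- s)) ≃-refl (sumOver g F) (sumOver g G))

    -- A finite `G` lies in some larger ball, so what `g` sums to on `G` outside the first ball is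
    -- bounded by a difference of two ball sums. This passes from the balls to arbitrary finite
    -- sets.
    beyond : ∀ ε 0<ε G → Unique G → ball (proj₁ (small ε 0<ε)) ⊆ G →
      ∣ sumOver a G - ballSum a (proj₁ (small ε 0<ε)) ∣ ≤ fromℚ ε
    beyond ε 0<ε G uG m⊆G =
      let m , close = small ε 0<ε
          k , G⊆ = exhaust-list G
          n = m ℕ.⊔ k
      in ≤-trans (increment (ball-unique m) uG m⊆G)
        (≤-trans (+-mono-≤ (≤-trans
            (sumOver-g-mono uG (ball-unique n) (λ i∈ → ball-mono (ℕ.m≤n⊔m m k) (G⊆ i∈)))
            (close n (ℕ.m≤m⊔n m k))) (≤-refl { - ballSum g m}))
          (≤-reflexive (solve 2 (λ s e → s :+ e :- s := e) ≃-refl (ballSum g m) (fromℚ ε))))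

    ballSum-cauchy : CauchySequence (ballSum a)
    ballSum-cauchy ε 0<ε = proj₁ (small _ (½ε 0<ε)) , λ m n hm hn → ≤-trans
      (∣-∣-triangle (beyond _ (½ε 0<ε) (ball m) (ball-unique m) (ball-mono hm))
        (≤-respˡ (∣-∣-sym (ballSum a n) _) (beyond _ (½ε 0<ε) (ball n) (ball-unique n) (ball-mono hn))))
      (fromℚ-halves ε)

    total : ℝ
    total = Completeness.limit (ballSum a) ballSum-cauchy

    total-⟶ : ballSum a ⟶ total
    total-⟶ = Completeness.converges (ballSum a) ballSum-cauchy

    total-HasSum : HasSum a total
    total-HasSum ε 0<ε = ball m , ball-unique m , λ G uG m⊆G → ≤-trans
      (∣-∣-triangle (beyond _ (½ε 0<ε) G uG m⊆G)
        (⟶-≤ (m , λ n m≤n → ≤-respˡ (∣-∣-sym (ballSum a n) (ballSum a m))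
            (beyond _ (½ε 0<ε) (ball n) (ball-unique n) (ball-mono m≤n)))
          (⟶-∣∣ (⟶-+ (⟶-≃ λ _ → ≃-refl) (⟶-neg total-⟶))) (⟶-≃ λ _ → ≃-refl)))
      (fromℚ-halves ε)
      where
      m = proj₁ (small _ (½ε 0<ε))

    summable : Σ[ l ∈ ℝ ] HasSum a l
    summable = total , total-HasSum

-- Enumeration of the lattice

-- These are the integers from -N to N - 1. There are exactly 2N of them, and all others still have
-- absolute value at least N.
range : ℕ → List ℤ
range N = map (λ k → + k) (upTo N) ++ map ℤ.-[1+_] (upTo N)

range⁻ : ∀ {N z} → z ∈ range N → ∃[ k ] k ℕ.< N × (z ≡ + k ⊎ z ≡ ℤ.-[1+ k ])
range⁻ {N} z∈ with ∈-++⁻ (map (λ k → + k) (upTo N)) z∈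
... | inj₁ h = let k , k∈ , e = ∈-map⁻ (λ k → + k) h in k , ∈-upTo⁻ k∈ , inj₁ e
... | inj₂ h = let k , k∈ , e = ∈-map⁻ ℤ.-[1+_] h in k , ∈-upTo⁻ k∈ , inj₂ e

range⁺ : ∀ {N k z} → k ℕ.< N → z ≡ + k ⊎ z ≡ ℤ.-[1+ k ] → z ∈ range N
range⁺ k<N (inj₁ refl) = ∈-++⁺ˡ (∈-map⁺ (λ k → + k) (∈-upTo⁺ k<N))
range⁺ {N} k<N (inj₂ refl) = ∈-++⁺ʳ (map (λ k → + k) (upTo N)) (∈-map⁺ ℤ.-[1+_] (∈-upTo⁺ k<N))

range-mono : ∀ {M N} → M ℕ.≤ N → range M ⊆ range N
range-mono {M} {N} M≤N z∈ = let k , k<M , e = range⁻ {M} z∈ in range⁺ {N} (ℕ.<-≤-trans k<M M≤N) e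

∈range-or-large : ∀ N z → z ∈ range N ⊎ N ℕ.≤ ℤ.∣ z ∣
∈range-or-large N (+ k) with k ℕ.<? N
... | yes k<N = inj₁ (range⁺ {N} k<N (inj₁ refl))
... | no k≮N  = inj₂ (ℕ.≮⇒≥ k≮N)
∈range-or-large N ℤ.-[1+ k ] with k ℕ.<? N
... | yes k<N = inj₁ (range⁺ {N} k<N (inj₂ refl))
... | no k≮N  = inj₂ (ℕ.m≤n⇒m≤1+n (ℕ.≮⇒≥ k≮N))

small⇒∈range : ∀ N z → ℤ.∣ z ∣ ℕ.< N → z ∈ range N
small⇒∈range N (+ k)      h = range⁺ {N} h (inj₁ refl)
small⇒∈range N ℤ.-[1+ k ] h = range⁺ {N} (ℕ.<-trans (ℕ.n<1+n k) h) (inj₂ refl)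

length-range : ∀ N → length (range N) ≡ N ℕ.+ N
length-range N = trans (List.length-++ (map (λ k → + k) (upTo N)))
  (cong₂ ℕ._+_ (trans (List.length-map (λ k → + k) (upTo N)) (List.length-upTo N))
               (trans (List.length-map ℤ.-[1+_] (upTo N)) (List.length-upTo N)))

length-cartesianProduct : ∀ {A B : Set} (xs : List A) (ys : List B) →
  length (cartesianProduct xs ys) ≡ length xs ℕ.* length ys
length-cartesianProduct []       ys = refl
length-cartesianProduct (x ∷ xs) ys = trans (List.length-++ (map (x ,_) ys))
  (cong₂ ℕ._+_ (List.length-map (x ,_) ys) (length-cartesianProduct xs ys))

length-concatMap : ∀ {A B : Set} (f : A → List B) → (∀ x → length (f x) ℕ.≤ 1) →
  ∀ xs → length (concatMap f xs) ℕ.≤ length xs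
length-concatMap f h []       = ℕ.z≤n
length-concatMap f h (x ∷ xs) = subst (ℕ._≤ suc (length xs))
  (sym (List.length-++ (f x))) (ℕ.+-mono-≤ (h x) (length-concatMap f h xs))

_≟ᴵ_ : DecidableEquality Index
index i j k _ ≟ᴵ index i′ j′ k′ _ with i ℤ.≟ i′ | j ℤ.≟ j′ | k ℤ.≟ k′
... | yes refl | yes refl | yes refl = yes refl
... | no i≢i′  | _        | _        = no λ { refl → i≢i′ refl }
... | _        | no j≢j′  | _        = no λ { refl → j≢j′ refl }
... | _        | _        | no k≢k′  = no λ { refl → k≢k′ refl }

zero? : ∀ i j k → Dec (i ≡ 0ℤ × j ≡ 0ℤ × k ≡ 0ℤ)
zero? i j k = (i ℤ.≟ 0ℤ) ×-dec ((j ℤ.≟ 0ℤ) ×-dec (k ℤ.≟ 0ℤ))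

fromTriple : ℤ × ℤ × ℤ → List Index
fromTriple (i , j , k) with zero? i j k
... | yes _      = []
... | no nonzero = index i j k nonzero ∷ []

fromTriple⁺ : ∀ i j k .nonzero → index i j k nonzero ∈ fromTriple (i , j , k)
fromTriple⁺ i j k nonzero with zero? i j k
... | yes vanish = contradiction vanish (¬-recompute nonzero)
  where open import Relation.Nullary.Recomputable using (¬-recompute)
... | no _     = here refl

fromTriple⁻ : ∀ {i j k} .{nonzero} t → index i j k nonzero ∈ fromTriple t → t ≡ (i , j , k)
fromTriple⁻ (i , j , k) h with zero? i j k
fromTriple⁻ (i , j , k) () | yes _
fromTriple⁻ (i , j , k) (here refl) | no _ = refl

length-fromTriple : ∀ t → length (fromTriple t) ℕ.≤ 1
length-fromTriple (i , j , k) with zero? i j k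
... | yes _ = ℕ.z≤n
... | no _  = ℕ.≤-refl

triples : ℕ → List (ℤ × ℤ × ℤ)
triples N = cartesianProduct (range N) (cartesianProduct (range N) (range N))

-- Deduplication gives uniqueness at once, and it can only shorten the list, of which no more than
-- an upper bound for the length is needed.
box : ℕ → List Index
box N = deduplicate _≟ᴵ_ (concatMap fromTriple (triples N))

box⁺ : ∀ N {i j k} .{nonzero} → i ∈ range N → j ∈ range N → k ∈ range N →
  index i j k nonzero ∈ box N
box⁺ N {i} {j} {k} {nonzero} i∈ j∈ k∈ = ∈-deduplicate⁺ _≟ᴵ_ (∈-concatMap⁺ fromTriple
  (Any.map (λ { refl → fromTriple⁺ i j k nonzero })
    (∈-cartesianProduct⁺ i∈ (∈-cartesianProduct⁺ j∈ k∈))))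

box⁻ : ∀ N {i j k} .{nonzero} → index i j k nonzero ∈ box N →
  i ∈ range N × j ∈ range N × k ∈ range N
box⁻ N p∈ =
  let t , t∈ , p∈t = find (∈-concatMap⁻ fromTriple {xs = triples N} (∈-deduplicate⁻ _≟ᴵ_ _ p∈))
      i∈ , jk∈ = ∈-cartesianProduct⁻ (range N) _ (subst (_∈ triples N) (fromTriple⁻ t p∈t) t∈)
  in i∈ , ∈-cartesianProduct⁻ (range N) (range N) jk∈

length-box : ∀ N → length (box N) ℕ.≤ (N ℕ.+ N) ℕ.* ((N ℕ.+ N) ℕ.* (N ℕ.+ N))
length-box N = ℕ.≤-trans (List.length-deduplicate _≟ᴵ_ (concatMap fromTriple (triples N)))
  (ℕ.≤-trans (length-concatMap fromTriple length-fromTriple (triples N)) (ℕ.≤-reflexive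
    (trans (length-cartesianProduct (range N) _) (cong₂ ℕ._*_ (length-range N)
      (trans (length-cartesianProduct (range N) (range N))
        (cong₂ ℕ._*_ (length-range N) (length-range N)))))))

∉box⇒large : ∀ N i j k .nonzero → index i j k nonzero ∉ box N →
  N ℕ.≤ ℤ.∣ i ∣ ⊎ N ℕ.≤ ℤ.∣ j ∣ ⊎ N ℕ.≤ ℤ.∣ k ∣
∉box⇒large N i j k nonzero p∉ with ∈range-or-large N i | ∈range-or-large N j | ∈range-or-large N k
... | inj₂ h  | _       | _       = inj₁ h
... | inj₁ _  | inj₂ h  | _       = inj₂ (inj₁ h)
... | inj₁ _  | inj₁ _  | inj₂ h  = inj₂ (inj₂ h)
... | inj₁ i∈ | inj₁ j∈ | inj₁ k∈ = contradiction (box⁺ N i∈ j∈ k∈) p∉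

-- Doubling the side makes both the number of points and the bound on the terms geometric in m.
ball : ℕ → List Index
ball m = box (2 ℕ.^ m)

ball-unique : ∀ m → Unique (ball m)
ball-unique m = deduplicate-! _≟ᴵ_ _

ball-mono : ∀ {m n} → m ℕ.≤ n → ball m ⊆ ball n
ball-mono {m} {n} m≤n {index i j k nonzero} p∈ =
  let i∈ , j∈ , k∈ = box⁻ (2 ℕ.^ m) p∈
      widen = λ {z} → range-mono {2 ℕ.^ m} {2 ℕ.^ n} (ℕ.^-monoʳ-≤ 2 m≤n) {z}
  in box⁺ (2 ℕ.^ n) (widen i∈) (widen j∈) (widen k∈)

n<2^n : ∀ n → n ℕ.< 2 ℕ.^ n
n<2^n zero    = ℕ.s≤s ℕ.z≤n
n<2^n (suc n) = ℕ.+-mono-≤ (ℕ.m^n>0 2 n) (subst (suc n ℕ.≤_) (sym (ℕ.+-identityʳ (2 ℕ.^ n))) (n<2^n n))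

ball-exhaust : ∀ p → ∃[ m ] p ∈ ball m
ball-exhaust (index i j k nonzero) = m , box⁺ (2 ℕ.^ m)
  (small⇒∈range (2 ℕ.^ m) i (below (ℕ.≤-trans (ℕ.m≤m⊔n ℤ.∣ i ∣ ℤ.∣ j ∣) (ℕ.m≤m⊔n _ ℤ.∣ k ∣))))
  (small⇒∈range (2 ℕ.^ m) j (below (ℕ.≤-trans (ℕ.m≤n⊔m ℤ.∣ i ∣ ℤ.∣ j ∣) (ℕ.m≤m⊔n _ ℤ.∣ k ∣))))
  (small⇒∈range (2 ℕ.^ m) k (below (ℕ.m≤n⊔m (ℤ.∣ i ∣ ℕ.⊔ ℤ.∣ j ∣) ℤ.∣ k ∣)))
  where
  m = ℤ.∣ i ∣ ℕ.⊔ ℤ.∣ j ∣ ℕ.⊔ ℤ.∣ k ∣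
  below : ∀ {n} → n ℕ.≤ m → n ℕ.< 2 ℕ.^ m
  below n≤m = ℕ.≤-<-trans n≤m (n<2^n m)

open Exhaustion ball ball-unique ball-mono ball-exhaust public

-- Counting points in dyadic shells

fromℕᴿ-+ : ∀ m n → fromℕᴿ (m ℕ.+ n) ≃ fromℕᴿ m + fromℕᴿ n
fromℕᴿ-+ zero    n = solve 1 (λ n → n := con 0ℚ :+ n) ≃-refl (fromℕᴿ n)
fromℕᴿ-+ (suc m) n = ≃-trans (fromℚ-fromℕ-suc (m ℕ.+ n)) (≃-trans
  (+-cong ≃-refl (fromℕᴿ-+ m n))
  (≃-trans (solve 2 (λ m n → con 1ℚ :+ (m :+ n) := con 1ℚ :+ m :+ n) ≃-refl (fromℕᴿ m) (fromℕᴿ n))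
    (+-cong (≃-sym (fromℚ-fromℕ-suc m)) ≃-refl)))

fromℕᴿ-* : ∀ m n → fromℕᴿ (m ℕ.* n) ≃ fromℕᴿ m * fromℕᴿ n
fromℕᴿ-* zero    n = solve 1 (λ n → con 0ℚ := con 0ℚ :* n) ≃-refl (fromℕᴿ n)
fromℕᴿ-* (suc m) n = ≃-trans (fromℕᴿ-+ n (m ℕ.* n)) (≃-trans
  (+-cong ≃-refl (fromℕᴿ-* m n))
  (≃-trans (solve 2 (λ m n → n :+ m :* n := (con 1ℚ :+ m) :* n) ≃-refl (fromℕᴿ m) (fromℕᴿ n))
    (*-cong (≃-sym (fromℚ-fromℕ-suc m)) ≃-refl)))

fromℕᴿ-mono : ∀ {m n} → m ℕ.≤ n → fromℕᴿ m ≤ fromℕᴿ n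
fromℕᴿ-mono {m} {n} h = fromℚ-mono (ℚ-Lemmas.fromℕ-mono {m} {n} h)

sumOver-≤-length : ∀ {I : Set} (g : I → ℝ) {b} F → (∀ {p} → p ∈ F → g p ≤ b) →
  sumOver g F ≤ fromℕᴿ (length F) * b
sumOver-≤-length g {b} []      h = ≤-reflexive (solve 1 (λ b → con 0ℚ := con 0ℚ :* b) ≃-refl b)
sumOver-≤-length g {b} (p ∷ F) h = ≤-trans
  (+-mono-≤ (h (here refl)) (sumOver-≤-length g F (λ q∈ → h (there q∈))))
  (≤-reflexive (≃-trans (solve 2 (λ b n → b :+ n :* b := (con 1ℚ :+ n) :* b) ≃-refl b (fromℕᴿ (length F)))
    (*-cong (≃-sym (fromℚ-fromℕ-suc (length F))) ≃-refl)))

2^ᴿ : ℕ → ℝ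
2^ᴿ m = fromℕᴿ (2 ℕ.^ m)

2^ᴿ-suc : ∀ m → 2^ᴿ (suc m) ≃ 2ℝ * 2^ᴿ m
2^ᴿ-suc m = fromℕᴿ-* 2 (2 ℕ.^ m)

-- There are at most 64 · 8ᵐ points in the m-th dyadic shell.
module GeometricTails {g : Index → ℝ} {C e : ℝ} {r : ℚ} (0≤g : ∀ p → 0ℝ ≤ g p)
  (0≤C : 0ℝ ≤ C) (0≤e : 0ℝ ≤ e) (0≤r : 0ℚ ℚ.≤ r) (r<1 : r ℚ.< 1ℚ)
  (8e≤r : fromℚ (+ 8 ℚ./ 1) * e ≤ fromℚ r) (decay : ∀ m p → p ∉ ball m → g p ≤ C * e ^ m) where

  P³ : ℕ → ℝ
  P³ m = 2^ᴿ m * (2^ᴿ m * 2^ᴿ m)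

  P³e≤r : ∀ m → P³ m * e ^ m ≤ fromℚ (r ℚ-Lemmas.^ m)
  P³e≤r zero    = ≤-pointwise λ _ → ℚ.≤-refl
  P³e≤r (suc m) = ≤-respˡ
    (≃-trans (solve 3 (λ p e q →
        con (+ 8 ℚ./ 1) :* e :* (p :* (p :* p) :* q)
        := con (+ 2 ℚ./ 1) :* p :* (con (+ 2 ℚ./ 1) :* p :* (con (+ 2 ℚ./ 1) :* p)) :* (e :* q))
      ≃-refl (2^ᴿ m) e (e ^ m))
      (*-cong (≃-sym (*-cong (2^ᴿ-suc m) (*-cong (2^ᴿ-suc m) (2^ᴿ-suc m)))) ≃-refl))
    (≤-trans (*-mono-≤
        (0≤* (fromℚ-mono (from-yes (0ℚ ℚ.≤? + 8 ℚ./ 1))) 0≤e) (fromℚ-mono (ℚ-Lemmas.0≤^ 0≤r m))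
        8e≤r (P³e≤r m))
      (≤-pointwise λ _ → ℚ.≤-refl))

  -- Each coordinate in this ball takes 4 · 2ᵐ values. The whole ball is counted, as a bound for its
  -- outermost shell.
  length≤ : ∀ m → fromℕᴿ (length (ball (suc m))) ≤ fromℚ (+ 64 ℚ./ 1) * P³ m
  length≤ m = ≤-trans (fromℕᴿ-mono (length-box N)) (≤-reflexive (≃-trans
    (≃-trans (fromℕᴿ-* (N ℕ.+ N) _) (*-cong double (≃-trans (fromℕᴿ-* (N ℕ.+ N) (N ℕ.+ N)) (*-cong double double))))
    (solve 1 (λ p → let d = con (+ 2 ℚ./ 1) :* p :+ con (+ 2 ℚ./ 1) :* p in
      d :* (d :* d) := con (+ 64 ℚ./ 1) :* (p :* (p :* p))) ≃-refl (2^ᴿ m))))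
    where
    N = 2 ℕ.^ suc m
    double : fromℕᴿ (N ℕ.+ N) ≃ 2ℝ * 2^ᴿ m + 2ℝ * 2^ᴿ m
    double = ≃-trans (fromℕᴿ-+ N N) (+-cong (2^ᴿ-suc m) (2^ᴿ-suc m))

  0≤Ceᵐ : ∀ m → 0ℝ ≤ C * e ^ m
  0≤Ceᵐ m = 0≤* 0≤C (^-nonneg 0≤e m)

  shell : ∀ m → ballSum g (suc m) ≤ ballSum g m + fromℚ (+ 64 ℚ./ 1) * C * fromℚ (r ℚ-Lemmas.^ m)
  shell m =
    let R , p , avoid = ⊆⇒↭++ (ball-unique m) (ball-unique (suc m)) (ball-mono (ℕ.n≤1+n m))
        |R|≤ = subst (length R ℕ.≤_) (trans (sym (List.length-++ (ball m))) (sym (↭-length p)))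
          (ℕ.m≤n+m (length R) (length (ball m)))
    in ≤-trans (≤-reflexive (≃-trans (sumOver-↭ g p) (sumOver-++ g (ball m) R)))
      (+-mono-≤ ≤-refl (≤-trans
        (sumOver-≤-length g R (λ {q} q∈ → decay m q (avoid q∈)))
        (≤-trans (*-monoʳ-≤ (0≤Ceᵐ m) (≤-trans (fromℕᴿ-mono |R|≤) (length≤ m)))
          (≤-respˡ (solve 4 (λ k p c e → k :* c :* (p :* e) := k :* p :* (c :* e)) ≃-refl
              (fromℚ (+ 64 ℚ./ 1)) (P³ m) C (e ^ m))
            (*-monoˡ-≤ (0≤* (fromℚ-mono (from-yes (0ℚ ℚ.≤? + 64 ℚ./ 1))) 0≤C) (P³e≤r m))))))

  small-tails : SmallTails g
  small-tails ε 0<ε = i , λ n i≤n → subst (λ n → ballSum g n ≤ ballSum g i + fromℚ ε)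
    (ℕ.m+[n∸m]≡n i≤n) (≤-trans (grow (n ℕ.∸ i)) (+-mono-≤ ≤-refl (fromℚ-mono
      (ℚ.≤-trans (ℚ-Lemmas.p≤∣p∣ _)
        (ℚ-Lemmas.GeometricTail.small {T} {λ n → D ℚ.* r ℚ-Lemmas.^ n} (λ _ → refl) {D} 0≤r r<1
          (λ n → ℚ.≤-reflexive (ℚ.0≤p⇒∣p∣≡p (ℚ-Lemmas.0≤* (ℚ.<⇒≤ 0<D) (ℚ-Lemmas.0≤^ 0≤r n))))
          i 0<ε (proj₁ (proj₂ tail)) (proj₂ (proj₂ tail)) (n ℕ.∸ i))))))
    where
    bound = bounded (fromℚ (+ 64 ℚ./ 1) * C)
    D = proj₁ bound
    0<D = proj₁ (proj₂ bound)
    tail = ℚ-Lemmas.tail-index D r ε r<1 0<ε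
    i = proj₁ tail
    -- Rational partial sums of Σ D rᵏ; the growth of the ball sums is compared with the tail of
    -- this geometric series.
    T : ℕ → ℚ
    T zero    = 0ℚ
    T (suc n) = T n ℚ.+ D ℚ.* r ℚ-Lemmas.^ n
    grow : ∀ j → ballSum g (i ℕ.+ j) ≤ ballSum g i + fromℚ (T (i ℕ.+ j) ℚ.- T i)
    grow zero = subst (λ k → ballSum g k ≤ ballSum g i + fromℚ (T k ℚ.- T i)) (sym (ℕ.+-identityʳ i))
      (≤-by {z = fromℚ (T i ℚ.- T i)} (≤-pointwise λ _ → ℚ.≤-reflexive (sym (ℚ.+-inverseʳ (T i)))) ≃-refl)
    grow (suc j) = subst (λ k → ballSum g k ≤ ballSum g i + fromℚ (T k ℚ.- T i)) (sym (ℕ.+-suc i j))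
      (≤-trans (shell (i ℕ.+ j)) (≤-trans
        (+-mono-≤ (grow j) (*-monoʳ-≤ (fromℚ-mono (ℚ-Lemmas.0≤^ 0≤r (i ℕ.+ j)))
          (≤-trans (x≤∣x∣ (fromℚ (+ 64 ℚ./ 1) * C)) (proj₂ (proj₂ bound)))))
        (≤-reflexive (≃-pointwise λ n →
          ≡-solve 4 (λ s t u q → s ⊞ (t ⊟ u) ⊞ q ⊜ s ⊞ (t ⊞ q ⊟ u)) refl
            (seq (ballSum g i) n) (T (i ℕ.+ j)) (T i) (D ℚ.* r ℚ-Lemmas.^ (i ℕ.+ j))))))
      where open ℚ-Solver

-- Decay of the terms

exp-fromℕ : ∀ m y → exp (fromℕᴿ m * y) ≃ exp y ^ m
exp-fromℕ zero    y = ≃-trans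
  (exp-cong {fromℕᴿ zero * y} {0ℝ} (solve 1 (λ y → con 0ℚ :* y := con 0ℚ) ≃-refl y)) exp-0
exp-fromℕ (suc m) y = ≃-trans
  (exp-cong {fromℕᴿ (suc m) * y} {y + fromℕᴿ m * y} (≃-trans (*-cong (fromℚ-fromℕ-suc m) ≃-refl)
    (solve 2 (λ m y → (con 1ℚ :+ m) :* y := y :+ m :* y) ≃-refl (fromℕᴿ m) y)))
  (≃-trans (exp-+ y (fromℕᴿ m * y)) (*-cong ≃-refl (exp-fromℕ m y)))

2^ᴿ-^ : ∀ m → 2^ᴿ m ≃ 2ℝ ^ m
2^ᴿ-^ zero    = ≃-refl
2^ᴿ-^ (suc m) = ≃-trans (2^ᴿ-suc m) (*-cong ≃-refl (2^ᴿ-^ m))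

0<2 : 0ℝ < 2ℝ
0<2 = 0<fromℚ (from-yes (0ℚ ℚ.<? + 2 ℚ./ 1))

-- If 2i = x + z - y, then 2i² ≤ 3/2 · (x² + y² + z²) by Cauchy-Schwarz, and x² ≤ 3 A x² for A ≥
-- 1/3. The product of 3/2 and 3 is the constant of `square-bound`.
9/2 : ℝ
9/2 = fromℚ (+ 9 ℚ./ 2)

0<9/2 : 0ℝ < 9/2
0<9/2 = 0<fromℚ (from-yes (0ℚ ℚ.<? + 9 ℚ./ 2))

module PowDecay (s : ℝ) (g : ℚ) (0<g : 0ℚ ℚ.< g) (3/2+g≤s : fromℚ (+ 3 ℚ./ 2) + fromℚ g ≤ s)
  (L k : ℝ) (exp-L : exp L ≃ 2ℝ) (exp-k : exp k ≃ 9/2) where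

  0≤s : 0ℝ ≤ s
  0≤s = ≤-trans (0≤+ (fromℚ-mono (from-yes (0ℚ ℚ.≤? + 3 ℚ./ 2))) (fromℚ-mono (ℚ.<⇒≤ 0<g))) 3/2+g≤s

  -- The quadratic estimate between ½ and 0 reads E - 3/2 ≤ E / 4 for E = `exp (fromℚ ½)`. This
  -- yields log 2 ≥ ½.
  exp-½≤2 : exp (fromℚ ½) ≤ 2ℝ
  exp-½≤2 = *-cancelˡ-≤ (0<fromℚ {+ 3 ℚ./ 4} (from-yes (0ℚ ℚ.<? + 3 ℚ./ 4)))
    (≤-by (≤⇒0≤- (≤-trans (x≤∣x∣ _)
        (exp-quadratic {fromℚ ½} {0ℝ} {fromℚ ½} (≤-pointwise λ _ → ℚ.≤-refl)
          (≤-pointwise λ _ → ℚ.<⇒≤ ℚ-Lemmas.0<½))))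
      (modulo exp-0 (solve 2 (λ E Z →
        con (+ 3 ℚ./ 4) :* con (+ 2 ℚ./ 1)
        := con (+ 3 ℚ./ 4) :* E
           :+ ((con ½ :- con 0ℚ) :* (con ½ :- con 0ℚ) :* E :- (E :- Z :- (con ½ :- con 0ℚ) :* Z))
           :+ (:- con (+ 3 ℚ./ 2)) :* (Z :- con 1ℚ)) ≃-refl (exp (fromℚ ½)) (exp 0ℝ))))

  ½≤L : fromℚ ½ ≤ L
  ½≤L = exp-cancel-≤ {fromℚ ½} {L} (≤-respʳ (≃-sym exp-L) exp-½≤2)

  -- With L = log 2 this is 4^(-s), the decay of the terms from one dyadic ball to the next.
  e : ℝ
  e = exp (- (2ℝ * (s * L)))

  P≃exp : ∀ m → 2^ᴿ m ≃ exp (fromℕᴿ m * L)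
  P≃exp m = ≃-trans (2^ᴿ-^ m) (≃-sym (≃-trans (exp-fromℕ m L) (^-cong exp-L m)))

  -- This is the logarithm of q ≤ (9/2) · 4^(-m), with x in the role of m log 2.
  log-bound-by : ∀ m x l q → 2^ᴿ m ≃ exp x → exp l ≃ q → q * (2^ᴿ m * 2^ᴿ m) ≤ 9/2 →
    l ≤ k + (- x + - x)
  log-bound-by m x l q P≃ el h = exp-cancel-≤ (begin
    exp l
      ≈⟨ el ⟩
    q
      ≈⟨ modulo (≃-trans (*-cong P≃ ≃-refl) (exp-inverse x)) (solve 3 (λ q P F →
           q := q :* (P :* P) :* (F :* F) :+ (:- (q :* (P :* F :+ con 1ℚ))) :* (P :* F :- con 1ℚ))
           ≃-refl q (2^ᴿ m) (exp (- x))) ⟩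
    q * (2^ᴿ m * 2^ᴿ m) * (exp (- x) * exp (- x))
      ≤⟨ *-monoʳ-≤ (0≤x*x (exp (- x))) h ⟩
    9/2 * (exp (- x) * exp (- x))
      ≈⟨ *-cong (≃-sym exp-k) (≃-sym (exp-+ (- x) (- x))) ⟩
    exp k * exp (- x + - x)
      ≈⟨ exp-+ k (- x + - x) ⟨
    exp (k + (- x + - x)) ∎)
    where open ≤-Reasoning

  exp-split-power : ∀ m →
    exp (s * (k + (- (fromℕᴿ m * L) + - (fromℕᴿ m * L)))) ≃ exp (s * k) * exp (- (2ℝ * (s * L))) ^ m
  exp-split-power m = ≃-trans
    (exp-cong {s * (k + (- (fromℕᴿ m * L) + - (fromℕᴿ m * L)))}
              {s * k + fromℕᴿ m * - (2ℝ * (s * L))}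
      (solve 4 (λ s k m L → s :* (k :+ (:- (m :* L) :+ :- (m :* L)))
        := s :* k :+ m :* :- (con (+ 2 ℚ./ 1) :* (s :* L))) ≃-refl s k (fromℕᴿ m) L))
    (≃-trans (exp-+ (s * k) (fromℕᴿ m * - (2ℝ * (s * L))))
      (*-cong ≃-refl (exp-fromℕ m (- (2ℝ * (s * L))))))

  decay-by : ∀ m l q → exp l ≃ q → q * (2^ᴿ m * 2^ᴿ m) ≤ 9/2 →
    exp (s * l) ≤ exp (s * k) * exp (- (2ℝ * (s * L))) ^ m
  decay-by m l q el h = ≤-respʳ (exp-split-power m)
    (exp-mono-≤ {s * l} {s * (k + (- (fromℕᴿ m * L) + - (fromℕᴿ m * L)))}
      (*-monoˡ-≤ 0≤s (log-bound-by m (fromℕᴿ m * L) l q (P≃exp m) el h)))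

  0<1+g : 0ℚ ℚ.< 1ℚ ℚ.+ g
  0<1+g = ℚ-Lemmas.0<+ ℚ-Lemmas.0<1 (ℚ.<⇒≤ 0<g)

  r : ℚ
  r = ℚ-Lemmas.recip (1ℚ ℚ.+ g) 0<1+g

  0<r : 0ℚ ℚ.< r
  0<r = ℚ-Lemmas.recip-pos (1ℚ ℚ.+ g) 0<1+g

  r<1 : r ℚ.< 1ℚ
  r<1 = subst₂ ℚ._<_ (ℚ.*-identityʳ r) (trans (ℚ.*-comm r (1ℚ ℚ.+ g)) (ℚ-Lemmas.*-recip (1ℚ ℚ.+ g) 0<1+g))
    (ℚ.*-monoʳ-<-pos r {{ℚ.positive 0<r}} (subst (ℚ._< 1ℚ ℚ.+ g) (ℚ.+-identityʳ 1ℚ) (ℚ.+-monoʳ-< 1ℚ 0<g)))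

  -- Here s > 3/2 enters: 4^s = 8 `exp θ` with θ = (2s - 3) log 2, and θ ≥ 2g · ½ = g gives `exp θ`
  -- ≥ 1 + g = 1 / `r`.
  8e≤r-by : ∀ e θ → exp (2ℝ * (s * L)) * e ≃ 1ℝ → 0ℝ ≤ e → fromℚ g ≤ θ →
    L + L + L + θ ≃ 2ℝ * (s * L) → fromℚ (+ 8 ℚ./ 1) * e ≤ fromℚ r
  8e≤r-by e θ inverse 0≤e g≤θ θ≃ = *-cancelˡ-≤ (0<fromℚ 0<1+g) (begin
    fromℚ (1ℚ ℚ.+ g) * (fromℚ (+ 8 ℚ./ 1) * e)
      ≤⟨ *-monoʳ-≤ (0≤* (fromℚ-mono (from-yes (0ℚ ℚ.≤? + 8 ℚ./ 1))) 0≤e) 1+g≤exp ⟩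
    exp θ * (fromℚ (+ 8 ℚ./ 1) * e)
      ≈⟨ solve 2 (λ T e → T :* (con (+ 8 ℚ./ 1) :* e)
           := con (+ 2 ℚ./ 1) :* con (+ 2 ℚ./ 1) :* con (+ 2 ℚ./ 1) :* T :* e) ≃-refl (exp θ) e ⟩
    2ℝ * 2ℝ * 2ℝ * exp θ * e
      ≈⟨ *-cong (*-cong (*-cong (*-cong two two) two) ≃-refl) ≃-refl ⟩
    exp L * exp L * exp L * exp θ * e
      ≈⟨ *-cong (≃-sym (≃-trans (exp-+ (L + L + L) θ)
           (*-cong (≃-trans (exp-+ (L + L) L) (*-cong (exp-+ L L) ≃-refl)) ≃-refl))) ≃-refl ⟩
    exp (L + L + L + θ) * e
      ≈⟨ *-cong (exp-cong {L + L + L + θ} {2ℝ * (s * L)} θ≃) ≃-refl ⟩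
    exp (2ℝ * (s * L)) * e
      ≈⟨ inverse ⟩
    1ℝ
      ≈⟨ ≃-pointwise (λ _ → ℚ-Lemmas.*-recip (1ℚ ℚ.+ g) 0<1+g) ⟨
    fromℚ (1ℚ ℚ.+ g) * fromℚ r ∎)
    where
    open ≤-Reasoning
    two : 2ℝ ≃ exp L
    two = ≃-sym exp-L
    1+g≤exp : fromℚ (1ℚ ℚ.+ g) ≤ exp θ
    1+g≤exp = ≤-trans (≤-respˡ (≃-pointwise λ _ → refl) (+-mono-≤ (≤-refl {1ℝ}) g≤θ))
      (1+x≤exp (≤-trans (fromℚ-mono (ℚ.<⇒≤ 0<g)) g≤θ))

  8e≤r : fromℚ (+ 8 ℚ./ 1) * e ≤ fromℚ r
  8e≤r = 8e≤r-by (exp (- (2ℝ * (s * L)))) θ (exp-inverse (2ℝ * (s * L))) (exp-nonneg (- (2ℝ * (s * L)))) g≤θ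
    (solve 2 (λ s L → L :+ L :+ L :+ (con (+ 2 ℚ./ 1) :* s :- con (+ 3 ℚ./ 1)) :* L
      := con (+ 2 ℚ./ 1) :* (s :* L)) ≃-refl s L)
    where
    θ : ℝ
    θ = (2ℝ * s - fromℚ (+ 3 ℚ./ 1)) * L
    g≤θ : fromℚ g ≤ θ
    g≤θ = ≤-respˡ (solve 1 (λ g → con (+ 2 ℚ./ 1) :* g :* con ½ := g) ≃-refl (fromℚ g))
      (*-mono-≤ (0≤* (<⇒≤ 0<2) (fromℚ-mono (ℚ.<⇒≤ 0<g)))
        (≤-trans (fromℚ-mono (ℚ.<⇒≤ ℚ-Lemmas.0<½)) ½≤L)
        (≤-by (0≤* (<⇒≤ 0<2) (≤⇒0≤- 3/2+g≤s))
          (solve 2 (λ s g → con (+ 2 ℚ./ 1) :* s :- con (+ 3 ℚ./ 1)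
            := con (+ 2 ℚ./ 1) :* g :+ con (+ 2 ℚ./ 1) :* (s :- (con (+ 3 ℚ./ 2) :+ g))) ≃-refl s (fromℚ g)))
        ½≤L)

fromℤ-+ : ∀ m n → fromℤ (m ℤ.+ n) ≃ fromℤ m + fromℤ n
fromℤ-+ m n = ≃-pointwise λ _ → ℚ.toℚᵘ-injective
  (ℚᵘ.≃-trans (ℚ-Lemmas.fromℤ-toℚᵘ (m ℤ.+ n)) (ℚᵘ.≃-sym
  (ℚᵘ.≃-trans (ℚ.toℚᵘ-homo-+ (ℚ-Lemmas.fromℤ m) (ℚ-Lemmas.fromℤ n))
  (ℚᵘ.≃-trans (ℚᵘ.+-cong (ℚ-Lemmas.fromℤ-toℚᵘ m) (ℚ-Lemmas.fromℤ-toℚᵘ n))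
    (ℚᵘ.*≡* (cong (ℤ._* 1ℤ) (cong₂ ℤ._+_ (ℤ.*-identityʳ m) (ℤ.*-identityʳ n))))))))

fromℤ-∣∣ : ∀ z → fromℤ z * fromℤ z ≃ fromℕᴿ ℤ.∣ z ∣ * fromℕᴿ ℤ.∣ z ∣
fromℤ-∣∣ (+ n)      = ≃-refl
fromℤ-∣∣ ℤ.-[1+ n ] = ≃-trans (*-cong negate negate)
  (solve 1 (λ a → :- a :* :- a := a :* a) ≃-refl (fromℕᴿ (suc n)))
  where
  negate : fromℤ ℤ.-[1+ n ] ≃ - fromℕᴿ (suc n)
  negate = ≃-pointwise λ _ → refl

large⇒square : ∀ {N} z → N ℕ.≤ ℤ.∣ z ∣ → fromℕᴿ N * fromℕᴿ N ≤ fromℤ z * fromℤ z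
large⇒square {N} z h = ≤-respʳ (≃-sym (fromℤ-∣∣ z))
  (*-mono-≤ (0≤fromℕᴿ N) (0≤fromℕᴿ ℤ.∣ z ∣) (fromℕᴿ-mono h) (fromℕᴿ-mono h))

-- The terms of the lattice sum

X² Y² Z² : Index → ℝ
X² (index i j k _) = fromℤ (i ℤ.+ j) ^ 2
Y² (index i j k _) = fromℤ (j ℤ.+ k) ^ 2
Z² (index i j k _) = fromℤ (i ℤ.+ k) ^ 2

form-squares : ∀ A p → form A p ≃ A * X² p + Y² p + Z² p
form-squares A (index i j k _) = ≃-refl

0≤^2 : ∀ x → 0ℝ ≤ x ^ 2
0≤^2 x = ≤-respʳ (solve 1 (λ x → x :* x := x :* (x :* con 1ℚ)) ≃-refl x) (0≤x*x x)

0≤X² : ∀ p → 0ℝ ≤ X² p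
0≤X² (index i j k _) = 0≤^2 (fromℤ (i ℤ.+ j))

0≤Y² : ∀ p → 0ℝ ≤ Y² p
0≤Y² (index i j k _) = 0≤^2 (fromℤ (j ℤ.+ k))

0≤Z² : ∀ p → 0ℝ ≤ Z² p
0≤Z² (index i j k _) = 0≤^2 (fromℤ (i ℤ.+ k))

-- 3 (x² + y² + z²) - (x + z - y)² = (x - z)² + (x + y)² + (z + y)².
square-bound : ∀ {A} x y z i → ⅓ᴿ ≤ A → 2ℝ * i ≃ x + z - y →
  2ℝ * (i * i) ≤ 9/2 * (A * (x * x) + y * y + z * z)
square-bound {A} x y z i ⅓≤A e = ≤-by
  (0≤+ (0≤+ (0≤* (<⇒≤ 0<9/2) (0≤* (≤⇒0≤- ⅓≤A) (0≤x*x x)))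
            (0≤* (fromℚ-mono (from-yes (0ℚ ℚ.≤? + 3 ℚ./ 1))) (0≤+ (0≤x*x y) (0≤x*x z))))
       (0≤* (fromℚ-mono (ℚ.<⇒≤ ℚ-Lemmas.0<½))
         (0≤+ (0≤+ (0≤x*x (x - z)) (0≤x*x (x + y))) (0≤x*x (z + y)))))
  (modulo e (solve 5 (λ A x y z i →
    let two = con (+ 2 ℚ./ 1) in
    con (+ 9 ℚ./ 2) :* (A :* (x :* x) :+ y :* y :+ z :* z)
    := two :* (i :* i)
       :+ (con (+ 9 ℚ./ 2) :* ((A :- con (+ 1 ℚ./ 3)) :* (x :* x)) :+ con (+ 3 ℚ./ 1) :* (y :* y :+ z :* z)
           :+ con ½ :* ((x :- z) :* (x :- z) :+ (x :+ y) :* (x :+ y) :+ (z :+ y) :* (z :+ y)))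
       :+ (:- (con ½ :* (two :* i :+ (x :+ z :- y)))) :* (two :* i :- (x :+ z :- y)))
    ≃-refl A x y z i))

module At {A : ℝ} (A∈ : [⅓,1] A) (p : Index) where

  c r w q : ℝ
  c = recip (A + 1ℝ) (A+1-pos (proj₁ A∈))
  r = recip (form A p) (form-pos (proj₁ A∈) p)
  w = X² p * r
  q = (A + 1ℝ) ÷ form A p [ form-pos (proj₁ A∈) p ]

  0<q : 0ℝ < q
  0<q = *-pos (A+1-pos (proj₁ A∈)) (recip-pos (form-pos (proj₁ A∈) p))

  0≤A : 0ℝ ≤ A
  0≤A = ≤-trans (fromℚ-mono (ℚ.<⇒≤ ℚ-Lemmas.0<⅓)) (proj₁ A∈)

  c-inverse : (A + 1ℝ) * c ≃ 1ℝ
  c-inverse = *-recip (A + 1ℝ) (A+1-pos (proj₁ A∈))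

  r-inverse : (A * X² p + Y² p + Z² p) * r ≃ 1ℝ
  r-inverse = ≃-trans (*-cong (≃-sym (form-squares A p)) ≃-refl)
    (*-recip (form A p) (form-pos (proj₁ A∈) p))

  0≤c : 0ℝ ≤ c
  0≤c = <⇒≤ (recip-pos (A+1-pos (proj₁ A∈)))

  0≤r : 0ℝ ≤ r
  0≤r = <⇒≤ (recip-pos (form-pos (proj₁ A∈) p))

  ∣c∣≤1 : ∣ c ∣ ≤ 1ℝ
  ∣c∣≤1 = 0≤⇒∣∣≤ 0≤c (≤-by (0≤* 0≤A 0≤c) (modulo c-inverse (solve 2 (λ A c →
    con 1ℚ := c :+ A :* c :+ (:- con 1ℚ) :* ((A :+ con 1ℚ) :* c :- con 1ℚ)) ≃-refl A c)))

  -- As Y² and Z² are nonnegative, `w` = X² / (A X² + Y² + Z²) is at most 1 / A where X² > 0; the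
  -- proof uses A ≥ 1/3 without dividing by A.
  ∣w∣≤3 : ∣ w ∣ ≤ fromℚ (+ 3 ℚ./ 1)
  ∣w∣≤3 = 0≤⇒∣∣≤ (0≤* (0≤X² p) 0≤r) (≤-by
    (0≤* (fromℚ-mono (from-yes (0ℚ ℚ.≤? + 3 ℚ./ 1)))
      (0≤* (0≤+ (0≤* (≤⇒0≤- (proj₁ A∈)) (0≤X² p)) (0≤+ (0≤Y² p) (0≤Z² p))) 0≤r))
    (modulo r-inverse (solve 5 (λ A x y z r →
      con (+ 3 ℚ./ 1) := x :* r
        :+ con (+ 3 ℚ./ 1) :* (((A :- con (+ 1 ℚ./ 3)) :* x :+ (y :+ z)) :* r)
        :+ (:- con (+ 3 ℚ./ 1)) :* ((A :* x :+ y :+ z) :* r :- con 1ℚ)) ≃-refl A (X² p) (Y² p) (Z² p) r)))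

  -- A ≤ 1 gives `q` ≤ 2 / form, and the hypothesis bounds 2 S by 9/2 times the form.
  q-bound : ∀ S → 2ℝ * S ≤ 9/2 * (A * X² p + Y² p + Z² p) → 0ℝ ≤ S → q * S ≤ 9/2
  q-bound S h 0≤S = ≤-by
    (0≤+ (0≤* 0≤r (0≤* (≤⇒0≤- (proj₂ A∈)) 0≤S)) (0≤* 0≤r (≤⇒0≤- h)))
    (modulo r-inverse (solve 6 (λ A x y z r s →
      con (+ 9 ℚ./ 2) := (A :+ con 1ℚ) :* r :* s
        :+ (r :* ((con 1ℚ :- A) :* s) :+ r :* (con (+ 9 ℚ./ 2) :* (A :* x :+ y :+ z) :- con (+ 2 ℚ./ 1) :* s))
        :+ (:- con (+ 9 ℚ./ 2)) :* ((A :* x :+ y :+ z) :* r :- con 1ℚ)) ≃-refl A (X² p) (Y² p) (Z² p) r S))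

outside⇒form-large : ∀ {A} → ⅓ᴿ ≤ A → ∀ m p → p ∉ ball m →
  2ℝ * (2^ᴿ m * 2^ᴿ m) ≤ 9/2 * (A * X² p + Y² p + Z² p)
outside⇒form-large {A} ⅓≤A m (index i j k nonzero) p∉ =
  case-large (∉box⇒large (2 ℕ.^ m) i j k nonzero p∉)
  where
  x y z : ℝ
  x = fromℤ (i ℤ.+ j)
  y = fromℤ (j ℤ.+ k)
  z = fromℤ (i ℤ.+ k)
  finish : ∀ n i u v → 2 ℕ.^ m ℕ.≤ ℤ.∣ n ∣ → i * i ≃ fromℤ n * fromℤ n →
    u * u + v * v ≃ y * y + z * z → 2ℝ * i ≃ x + v - u →
    2ℝ * (2^ᴿ m * 2^ᴿ m) ≤ 9/2 * (A * x ^ 2 + y ^ 2 + z ^ 2)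
  finish n i u v h i²≃ uv≃ e = ≤-respʳ
    (modulo uv≃ (solve 6 (λ A x y z u v → con (+ 9 ℚ./ 2) :* (A :* (x :* x) :+ u :* u :+ v :* v)
      := con (+ 9 ℚ./ 2) :* (A :* (x :* (x :* con 1ℚ)) :+ y :* (y :* con 1ℚ) :+ z :* (z :* con 1ℚ))
         :+ con (+ 9 ℚ./ 2) :* (u :* u :+ v :* v :- (y :* y :+ z :* z)))
      ≃-refl A x y z u v))
    (≤-trans (*-monoˡ-≤ (<⇒≤ 0<2) (≤-respʳ (≃-sym i²≃) (large⇒square n h)))
      (square-bound x u v i ⅓≤A e))
  I J K : ℝ
  I = fromℤ i
  J = fromℤ j
  K = fromℤ k
  x≃ : x ≃ I + J
  x≃ = fromℤ-+ i j
  y≃ : y ≃ J + K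
  y≃ = fromℤ-+ j k
  z≃ : z ≃ I + K
  z≃ = fromℤ-+ i k
  case-large : 2 ℕ.^ m ℕ.≤ ℤ.∣ i ∣ ⊎ 2 ℕ.^ m ℕ.≤ ℤ.∣ j ∣ ⊎ 2 ℕ.^ m ℕ.≤ ℤ.∣ k ∣ →
    2ℝ * (2^ᴿ m * 2^ᴿ m) ≤ 9/2 * (A * x ^ 2 + y ^ 2 + z ^ 2)
  case-large (inj₁ h) = finish i I y z h ≃-refl ≃-refl (≃-trans
    (solve 3 (λ i j k → con (+ 2 ℚ./ 1) :* i := i :+ j :+ (i :+ k) :- (j :+ k)) ≃-refl I J K)
    (≃-sym (+-cong (+-cong x≃ z≃) (-‿cong y≃))))
  case-large (inj₂ (inj₁ h)) = finish j J z y h ≃-refl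
    (solve 2 (λ y z → z :+ y := y :+ z) ≃-refl (y * y) (z * z)) (≃-trans
    (solve 3 (λ i j k → con (+ 2 ℚ./ 1) :* j := i :+ j :+ (j :+ k) :- (i :+ k)) ≃-refl I J K)
    (≃-sym (+-cong (+-cong x≃ y≃) (-‿cong z≃))))
  -- Here 2k = y + z - x, with the wrong sign at x, the coordinate that carries the weight A.
  -- Replacing k by -k and z by -z restores the shape x + v - u.
  case-large (inj₂ (inj₂ h)) = finish k (- K) y (- z) h
    (solve 1 (λ k → :- k :* :- k := k :* k) ≃-refl K)
    (solve 2 (λ y z → y :* y :+ :- z :* :- z := y :* y :+ z :* z) ≃-refl y z) (≃-trans
    (solve 3 (λ i j k → con (+ 2 ℚ./ 1) :* :- k := i :+ j :+ :- (i :+ k) :- (j :+ k)) ≃-refl I J K)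
    (≃-sym (+-cong (+-cong x≃ (-‿cong z≃)) (-‿cong y≃))))

-- Dependence of a term on A

module Change {A B : ℝ} (A∈ : [⅓,1] A) (B∈ : [⅓,1] B) (p : Index) where

  module a = At A∈ p
  module b = At B∈ p

  Δ t : ℝ
  Δ = B - A
  t = Δ * (a.c - b.w - Δ * a.c * b.w)

  c-change : b.c ≃ a.c - Δ * (a.c * b.c)
  c-change = modulo a.c-inverse (modulo b.c-inverse (solve 4 (λ A B c c′ →
    c′ := c :- (B :- A) :* (c :* c′)
      :+ (:- c′) :* ((A :+ con 1ℚ) :* c :- con 1ℚ)
      :+ c :* ((B :+ con 1ℚ) :* c′ :- con 1ℚ)) ≃-refl A B a.c b.c))

  w-change : b.w ≃ a.w - Δ * (a.w * b.w)
  w-change = modulo a.r-inverse (modulo b.r-inverse (solve 7 (λ A B x y z r r′ →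
    x :* r′ := x :* r :- (B :- A) :* (x :* r :* (x :* r′))
      :+ (:- (x :* r′)) :* ((A :* x :+ y :+ z) :* r :- con 1ℚ)
      :+ x :* r :* ((B :* x :+ y :+ z) :* r′ :- con 1ℚ)) ≃-refl A B (X² p) (Y² p) (Z² p) a.r b.r))

  q-change : b.q ≃ a.q * (1ℝ + t)
  q-change = modulo a.c-inverse (modulo a.r-inverse (modulo b.r-inverse (solve 8 (λ A B x y z c r r′ →
    let Δ = B :- A
        w′ = x :* r′
        D = A :* x :+ y :+ z
    in (B :+ con 1ℚ) :* r′
       := (A :+ con 1ℚ) :* r :* (con 1ℚ :+ Δ :* (c :- w′ :- Δ :* c :* w′))
          :+ (:- (r :* Δ :* (con 1ℚ :- Δ :* w′))) :* ((A :+ con 1ℚ) :* c :- con 1ℚ)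
          :+ (:- ((B :+ con 1ℚ) :* r′)) :* (D :* r :- con 1ℚ)
          :+ (B :+ con 1ℚ) :* r :* ((B :* x :+ y :+ z) :* r′ :- con 1ℚ))
    ≃-refl A B (X² p) (Y² p) (Z² p) a.c a.r b.r)))

  -- Since ∣ t ∣ ≤ 7 ∣ Δ ∣, the radius 1/14 keeps t in the range ∣ t ∣ ≤ ½ of the Taylor estimate
  -- for powers.
  t-small : ∣ Δ ∣ ≤ fromℚ (+ 1 ℚ./ 14) → ∣ t ∣ ≤ fromℚ ½
  t-small h = ≤-trans
    (∣∣≤-* h (∣∣≤-- (∣∣≤-- a.∣c∣≤1 b.∣w∣≤3)
      (∣∣≤-* (∣∣≤-* (≤-trans h (fromℚ-mono (from-yes (+ 1 ℚ./ 14 ℚ.≤? 1ℚ)))) a.∣c∣≤1) b.∣w∣≤3)))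
    (≤-pointwise λ _ → ℚ.≤-refl)

-- Opaque, since conversion checking would otherwise unfold exp and log into their series.
opaque

  power : ∀ x → 0ℝ < x → ℝ → ℝ
  power x 0<x s = pow x 0<x s

  term-power : ∀ s A A∈ p → term s A A∈ p ≡
    power ((A + 1ℝ) ÷ form A p [ form-pos (proj₁ A∈) p ])
      (*-pos (A+1-pos (proj₁ A∈)) (recip-pos (form-pos (proj₁ A∈) p))) s
  term-power s A A∈ p = refl

  power-pos : ∀ x 0<x s → 0ℝ < power x 0<x s
  power-pos x 0<x s = exp-pos (s * log x 0<x)

  power-cong : ∀ {x y} s → x ≃ y → ∀ 0<x 0<y → power x 0<x s ≃ power y 0<y s
  power-cong s h 0<x 0<y = pow-cong s h 0<x 0<y

  power-* : ∀ x y s 0<x 0<y 0<xy → power (x * y) 0<xy s ≃ power x 0<x s * power y 0<y s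
  power-* x y s 0<x 0<y 0<xy = pow-* x y s 0<x 0<y 0<xy

  taylorBound : ℝ → ℝ
  taylorBound s = PowTaylor.K s

  0≤taylorBound : ∀ s → 0ℝ ≤ taylorBound s
  0≤taylorBound s = PowTaylor.0≤K s

  power-taylor : ∀ s t 0<1+t → ∣ t ∣ ≤ fromℚ ½ →
    ∣ power (1ℝ + t) 0<1+t s - (1ℝ + s * t) ∣ ≤ taylorBound s * (t * t)
  power-taylor s t 0<1+t h = PowTaylor.pow-taylor s t 0<1+t h

  power-decay : ∀ s g (0<g : 0ℚ ℚ.< g) (h : fromℚ (+ 3 ℚ./ 2) + fromℚ g ≤ s) L k (eL : exp L ≃ 2ℝ) (ek : exp k ≃ 9/2)
    m q 0<q → q * (2^ᴿ m * 2^ᴿ m) ≤ 9/2 →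
    power q 0<q s ≤ exp (s * k) * exp (- (2ℝ * (s * L))) ^ m
  power-decay s g 0<g h L k eL ek m q 0<q =
    PowDecay.decay-by s g 0<g h L k eL ek m (log q 0<q) q (exp-log q 0<q)

-- Termwise differentiation of the lattice sum

HasSum-cong : ∀ {I : Set} {a b : I → ℝ} {l} → (∀ i → a i ≃ b i) → HasSum a l → HasSum b l
HasSum-cong e h ε 0<ε = let F , unique , close = h ε 0<ε in F , unique , λ G uG F⊆G →
  ≤-respˡ (∣∣-cong (+-cong (sumOver-cong e G) ≃-refl)) (close G uG F⊆G)

sumOver-taylor : ∀ (a b c g : Index → ℝ) Δ M → (∀ p → ∣ a p - b p - c p * Δ ∣ ≤ g p * M) →
  ∀ F → ∣ sumOver a F - sumOver b F - Δ * sumOver c F ∣ ≤ M * sumOver g F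
sumOver-taylor a b c g Δ M h F = ∣∣≤-by (linear F) (sumOver-∣∣≤ h F) (≤-reflexive (scale F))
  where
  linear : ∀ F → sumOver a F - sumOver b F - Δ * sumOver c F ≃ sumOver (λ p → a p - b p - c p * Δ) F
  linear []      = solve 1 (λ d → con 0ℚ :- con 0ℚ :- d :* con 0ℚ := con 0ℚ) ≃-refl Δ
  linear (p ∷ F) = ≃-trans
    (solve 7 (λ d a b c s t u → a :+ s :- (b :+ t) :- d :* (c :+ u) := a :- b :- c :* d :+ (s :- t :- d :* u))
      ≃-refl Δ (a p) (b p) (c p) (sumOver a F) (sumOver b F) (sumOver c F))
    (+-cong ≃-refl (linear F))
  scale : ∀ F → sumOver (λ p → g p * M) F ≃ M * sumOver g F
  scale []      = solve 1 (λ m → con 0ℚ := m :* con 0ℚ) ≃-refl M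
  scale (p ∷ F) = ≃-trans (+-cong ≃-refl (scale F))
    (solve 3 (λ g m s → g :* m :+ m :* s := m :* (g :+ s)) ≃-refl (g p) M (sumOver g F))

limit-taylor : ∀ {a b c g : Index → ℝ} {la lb lc lg} Δ M →
  (∀ p → ∣ a p - b p - c p * Δ ∣ ≤ g p * M) →
  ballSum a ⟶ la → ballSum b ⟶ lb → ballSum c ⟶ lc → ballSum g ⟶ lg →
  ∣ la - lb - lc * Δ ∣ ≤ M * lg
limit-taylor {a} {b} {c} {g} {la} {lb} {lc} Δ M h ha hb hc hg = ≤-respˡ
  (∣∣-cong (solve 4 (λ a b c d → a :- b :- d :* c := a :- b :- c :* d) ≃-refl la lb lc Δ))
  (⟶-≤ (always λ n → sumOver-taylor a b c g Δ M h (ball n))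
    (⟶-∣∣ (⟶-+ (⟶-+ ha (⟶-neg hb)) (⟶-neg (⟶-*ˡ Δ hc)))) (⟶-*ˡ M hg))

⊓-pos : ∀ {p q} → 0ℚ ℚ.< p → 0ℚ ℚ.< q → 0ℚ ℚ.< p ℚ.⊓ q
⊓-pos {p} {q} 0<p 0<q with ℚ.⊓-sel p q
... | inj₁ e = subst (0ℚ ℚ.<_) (sym e) 0<p
... | inj₂ e = subst (0ℚ ℚ.<_) (sym e) 0<q

quadratic⇒derivative : ∀ {D : ℝ → Set} {f : ∀ x → D x → ℝ} {a a∈ d} K ρ → 0ℚ ℚ.< ρ →
  (∀ x x∈ → ∣ x - a ∣ ≤ fromℚ ρ → ∣ f x x∈ - f a a∈ - d * (x - a) ∣ ≤ K * ((x - a) * (x - a))) →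
  HasDerivative f a a∈ d
quadratic⇒derivative {D} {f} {a} {a∈} {d} K ρ 0<ρ h ε 0<ε = δ , 0<δ , λ x x∈ ∣Δ∣≤δ → ≤-trans
  (h x x∈ (≤-trans ∣Δ∣≤δ (fromℚ-mono (ℚ.p⊓q≤p ρ (ε ℚ.* b)))))
  (shrink (x - a) (≤-trans ∣Δ∣≤δ (fromℚ-mono (ℚ.p⊓q≤q ρ (ε ℚ.* b)))))
  where
  open ℚ-Solver
  bound = bounded K
  B b δ : ℚ
  B = proj₁ bound
  0<B : 0ℚ ℚ.< B
  0<B = proj₁ (proj₂ bound)
  b = ℚ-Lemmas.recip B 0<B
  -- With K ≤ B and `b` = 1 / B, the bound ∣ Δ ∣ ≤ ε / B turns K Δ² into at most ε ∣ Δ ∣.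
  δ = ρ ℚ.⊓ (ε ℚ.* b)
  0<εb : 0ℚ ℚ.< ε ℚ.* b
  0<εb = ℚ-Lemmas.0<* 0<ε (ℚ-Lemmas.recip-pos B 0<B)
  0<δ : 0ℚ ℚ.< δ
  0<δ = ⊓-pos 0<ρ 0<εb
  scaled : fromℚ B * fromℚ (ε ℚ.* b) ≃ fromℚ ε
  scaled = ≃-pointwise λ _ → trans (≡-solve 3 (λ B e r → B ⊠ (e ⊠ r) ⊜ e ⊠ (B ⊠ r)) refl B ε b)
    (trans (cong (ε ℚ.*_) (ℚ-Lemmas.*-recip B 0<B)) (ℚ.*-identityʳ ε))
  shrink : ∀ Δ → ∣ Δ ∣ ≤ fromℚ (ε ℚ.* b) → K * (Δ * Δ) ≤ fromℚ ε * ∣ Δ ∣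
  shrink Δ h = ≤-trans (*-monoʳ-≤ (0≤x*x Δ) (≤-trans (x≤∣x∣ K) (proj₂ (proj₂ bound))))
    (≤-by (0≤* (0≤* (fromℚ-mono (ℚ.<⇒≤ 0<B)) (0≤∣∣ Δ)) (≤⇒0≤- h))
      (modulo (∣x∣*∣x∣ Δ) (modulo scaled (solve 5 (λ B q d e η →
        e :* d := B :* q :+ B :* d :* (η :- d) :+ B :* (d :* d :- q) :+ (:- d) :* (B :* η :- e))
        ≃-refl (fromℚ B) (Δ * Δ) (∣ Δ ∣) (fromℚ ε) (fromℚ (ε ℚ.* b))))))

module LatticeSum (s : ℝ) (g : ℚ) (0<g : 0ℚ ℚ.< g) (3/2+g≤s : fromℚ (+ 3 ℚ./ 2) + fromℚ g ≤ s) where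

  open PowDecay s g 0<g 3/2+g≤s (log 2ℝ 0<2) (log 9/2 0<9/2) (exp-log 2ℝ 0<2) (exp-log 9/2 0<9/2)
    using (r; r<1; 0<r; 8e≤r)

  K K₁ : ℝ
  K = taylorBound s
  K₁ = fromℚ (+ 49 ℚ./ 1) * K + fromℚ (+ 12 ℚ./ 1) * ∣ s ∣

  -- f and h are the paper's summand and its logarithmic derivative in A.
  f h : ∀ A → [⅓,1] A → Index → ℝ
  f A A∈ p = power (At.q A∈ p) (At.0<q A∈ p) s
  h A A∈ p = s * (At.c A∈ p - At.w A∈ p)

  0≤f : ∀ A A∈ p → 0ℝ ≤ f A A∈ p
  0≤f A A∈ p = <⇒≤ (power-pos (At.q A∈ p) (At.0<q A∈ p) s)

  f-tails : ∀ A A∈ → SmallTails (f A A∈)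
  f-tails A A∈ = GeometricTails.small-tails (0≤f A A∈)
    (exp-nonneg (s * log 9/2 0<9/2)) (exp-nonneg (- (2ℝ * (s * log 2ℝ 0<2)))) (ℚ.<⇒≤ 0<r) r<1 8e≤r
    λ m p p∉ → power-decay s g 0<g 3/2+g≤s (log 2ℝ 0<2) (log 9/2 0<9/2)
      (exp-log 2ℝ 0<2) (exp-log 9/2 0<9/2) m (At.q A∈ p) (At.0<q A∈ p)
      (At.q-bound A∈ p (2^ᴿ m * 2^ᴿ m) (outside⇒form-large (proj₁ A∈) m p p∉) (0≤x*x (2^ᴿ m)))

  f-bound : ∀ A A∈ p → ∣ f A A∈ p ∣ ≤ 1ℝ * f A A∈ p
  f-bound A A∈ p = 0≤⇒∣∣≤ (0≤f A A∈ p)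
    (≤-reflexive (solve 1 (λ f → f := con 1ℚ :* f) ≃-refl (f A A∈ p)))

  f-weighted : ∀ A A∈ p {w C} → ∣ w ∣ ≤ C → ∣ f A A∈ p * w ∣ ≤ C * f A A∈ p
  f-weighted A A∈ p {w} {C} hw = ≤-trans (∣∣≤-* (0≤⇒∣∣≤ (0≤f A A∈ p) ≤-refl) hw)
    (≤-reflexive (solve 2 (λ f c → f :* c := c :* f) ≃-refl (f A A∈ p) C))

  H : ℝ
  H = ∣ s ∣ * (1ℝ + fromℚ (+ 3 ℚ./ 1))

  0≤H : 0ℝ ≤ H
  0≤H = 0≤* (0≤∣∣ s) (≤-pointwise λ _ → from-yes (0ℚ ℚ.≤? 1ℚ ℚ.+ + 3 ℚ./ 1))

  h-bound : ∀ A A∈ p → ∣ h A A∈ p ∣ ≤ H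
  h-bound A A∈ p = ∣∣≤-* (≤-refl {∣ s ∣}) (∣∣≤-- (At.∣c∣≤1 A∈ p) (At.∣w∣≤3 A∈ p))

  -- Not the derivative of `h` alone: as c and w have the derivatives -c² and -w², this is h² plus
  -- the derivative of h, so that `f` times it is the derivative of f h.
  h′ : ∀ A → [⅓,1] A → Index → ℝ
  h′ A A∈ p = h A A∈ p * h A A∈ p + s * (At.w A∈ p * At.w A∈ p - At.c A∈ p * At.c A∈ p)

  H′ : ℝ
  H′ = H * H + ∣ s ∣ * (fromℚ (+ 3 ℚ./ 1) * fromℚ (+ 3 ℚ./ 1) + 1ℝ * 1ℝ)

  0≤H′ : 0ℝ ≤ H′
  0≤H′ = 0≤+ (0≤* 0≤H 0≤H) (0≤* (0≤∣∣ s) (≤-pointwise λ _ →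
    from-yes (0ℚ ℚ.≤? + 3 ℚ./ 1 ℚ.* (+ 3 ℚ./ 1) ℚ.+ 1ℚ ℚ.* 1ℚ)))

  h′-bound : ∀ A A∈ p → ∣ h′ A A∈ p ∣ ≤ H′
  h′-bound A A∈ p = ∣∣≤-+ (∣∣≤-* (h-bound A A∈ p) (h-bound A A∈ p))
    (∣∣≤-* (≤-refl {∣ s ∣}) (∣∣≤-- (∣∣≤-* w≤ w≤) (∣∣≤-* c≤ c≤)))
    where
    w≤ = At.∣w∣≤3 A∈ p
    c≤ = At.∣c∣≤1 A∈ p

  opaque

    L-summable : ∀ A A∈ → Σ[ l ∈ ℝ ] HasSum (f A A∈) l
    L-summable A A∈ = DominatedSum.summable {f A A∈} {λ p → 1ℝ * f A A∈ p} (f-bound A A∈)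
      (SmallTails-* 1ℝ 0≤1ℝ (f-tails A A∈))

    L′-summable : ∀ A A∈ → Σ[ l ∈ ℝ ] HasSum (λ p → f A A∈ p * h A A∈ p) l
    L′-summable A A∈ = DominatedSum.summable {λ p → f A A∈ p * h A A∈ p} {λ p → H * f A A∈ p}
      (λ p → f-weighted A A∈ p (h-bound A A∈ p)) (SmallTails-* H 0≤H (f-tails A A∈))

    L″-summable : ∀ A A∈ → Σ[ l ∈ ℝ ] HasSum (λ p → f A A∈ p * h′ A A∈ p) l
    L″-summable A A∈ = DominatedSum.summable {λ p → f A A∈ p * h′ A A∈ p} {λ p → H′ * f A A∈ p}
      (λ p → f-weighted A A∈ p (h′-bound A A∈ p)) (SmallTails-* H′ 0≤H′ (f-tails A A∈))

  L L′ L″ : ∀ A → [⅓,1] A → ℝ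
  L A A∈ = proj₁ (L-summable A A∈)
  L′ A A∈ = proj₁ (L′-summable A A∈)
  L″ A A∈ = proj₁ (L″-summable A A∈)

  L-⟶ : ∀ A A∈ → ballSum (f A A∈) ⟶ L A A∈
  L-⟶ A A∈ = HasSum⇒⟶ (proj₂ (L-summable A A∈))

  L′-⟶ : ∀ A A∈ → ballSum (λ p → f A A∈ p * h A A∈ p) ⟶ L′ A A∈
  L′-⟶ A A∈ = HasSum⇒⟶ (proj₂ (L′-summable A A∈))

  L″-⟶ : ∀ A A∈ → ballSum (λ p → f A A∈ p * h′ A A∈ p) ⟶ L″ A A∈
  L″-⟶ A A∈ = HasSum⇒⟶ (proj₂ (L″-summable A A∈))

  module Local {A B : ℝ} (A∈ : [⅓,1] A) (B∈ : [⅓,1] B)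
    (close : ∣ B - A ∣ ≤ fromℚ (+ 1 ℚ./ 14)) (p : Index) where

    open Change A∈ B∈ p

    0<1+t : 0ℝ < 1ℝ + t
    0<1+t = fromℚ≤⇒0< ℚ-Lemmas.0<½ (PowTaylor.½≤1+t s (t-small close))

    open TermTaylor {s} {K} {Δ} {a.c} {b.c} {a.w} {b.w} {f A A∈ p} {f B B∈ p} {power (1ℝ + t) 0<1+t s}
      (0≤taylorBound s) (0≤f A A∈ p) (≤-trans close (fromℚ-mono (from-yes (+ 1 ℚ./ 14 ℚ.≤? 1ℚ))))
      a.∣c∣≤1 b.∣c∣≤1 a.∣w∣≤3 b.∣w∣≤3 c-change w-change public
      hiding (t; h; h′; K₁)

    ratio : f B B∈ p ≃ f A A∈ p * power (1ℝ + t) 0<1+t s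
    ratio = ≃-trans
      (power-cong {At.q B∈ p} {At.q A∈ p * (1ℝ + t)} s q-change (At.0<q B∈ p) (*-pos (At.0<q A∈ p) 0<1+t))
      (power-* (At.q A∈ p) (1ℝ + t) s (At.0<q A∈ p) 0<1+t (*-pos (At.0<q A∈ p) 0<1+t))

    first : ∣ f B B∈ p - f A A∈ p - f A A∈ p * h A A∈ p * (B - A) ∣ ≤ f A A∈ p * (K₁ * ((B - A) * (B - A)))
    first = first-order ratio (power-taylor s t 0<1+t (t-small close))

    second : ∣ f B B∈ p * h B B∈ p - f A A∈ p * h A A∈ p - f A A∈ p * h′ A A∈ p * (B - A) ∣
      ≤ f A A∈ p * ((K₁ * (∣ s ∣ * fromℚ (+ 4 ℚ./ 1)) + ∣ s ∣ * fromℚ (+ 28 ℚ./ 1)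
         + ∣ s ∣ * ∣ s ∣ * fromℚ (+ 40 ℚ./ 1)) * ((B - A) * (B - A)))
    second = second-order ratio (power-taylor s t 0<1+t (t-small close))

  reassociate : ∀ {x} K q l → x ≤ K * q * l → x ≤ l * K * q
  reassociate K q l = ≤-respʳ (solve 3 (λ K q l → K :* q :* l := l :* K :* q) ≃-refl K q l)

  0<1/14 : 0ℚ ℚ.< + 1 ℚ./ 14
  0<1/14 = from-yes (0ℚ ℚ.<? + 1 ℚ./ 14)

  -- The error of each term is at most f K₁ Δ², and f sums to `L`; the summed remainder therefore
  -- has the constant `L A A∈ * K₁`.
  derivative : ∀ A A∈ → HasDerivative L A A∈ (L′ A A∈)
  derivative A A∈ = quadratic⇒derivative (L A A∈ * K₁) (+ 1 ℚ./ 14) 0<1/14 λ B B∈ close →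
    reassociate K₁ ((B - A) * (B - A)) (L A A∈)
      (limit-taylor (B - A) (K₁ * ((B - A) * (B - A))) (Local.first A∈ B∈ close)
        (L-⟶ B B∈) (L-⟶ A A∈) (L′-⟶ A A∈) (L-⟶ A A∈))

  second-derivative : ∀ A A∈ →
    HasDerivative (λ B B∈ → L′ B (⟨⅓,1⟩⊆[⅓,1] B∈)) A A∈ (L″ A (⟨⅓,1⟩⊆[⅓,1] A∈))
  second-derivative A A∈ = quadratic⇒derivative (L A A∈′ * K₂) (+ 1 ℚ./ 14) 0<1/14 λ B B∈ close →
    let B∈′ = ⟨⅓,1⟩⊆[⅓,1] B∈ in
    reassociate K₂ ((B - A) * (B - A)) (L A A∈′)
      (limit-taylor (B - A) (K₂ * ((B - A) * (B - A))) (Local.second A∈′ B∈′ close)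
        (L′-⟶ B B∈′) (L′-⟶ A A∈′) (L″-⟶ A A∈′) (L-⟶ A A∈′))
    where
    A∈′ = ⟨⅓,1⟩⊆[⅓,1] A∈
    K₂ : ℝ
    K₂ = K₁ * (∣ s ∣ * fromℚ (+ 4 ℚ./ 1)) + ∣ s ∣ * fromℚ (+ 28 ℚ./ 1) + ∣ s ∣ * ∣ s ∣ * fromℚ (+ 40 ℚ./ 1)

module ℤ-Solver where
  open import Data.Integer.Solver
  open +-*-Solver public using () renaming
    (solve to ℤ-solve; _:-_ to _⊟_; _:+_ to _⊞_; _:=_ to _⊜_; :-_ to ⊝_)

-- The cubic symmetry at A = ½

-- In the coordinates P = i + j, Q = i + j + 2k, R = j - i the lattice is given
-- by P ≡ Q ≡ R mod 2 and the form at ½ by (P² + Q² + R²) / 2; σ permutes P, Q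
-- and R cyclically.
σ : Index → Index
σ (index i j k nonzero) = index k (i ℤ.+ j ℤ.+ k) (ℤ.- (i ℤ.+ k)) λ (k≡0 , ijk≡0 , ik≡0) →
  let i≡0 = trans (ℤ-solve 2 (λ i k → i ⊜ ⊝ (⊝ (i ⊞ k)) ⊟ k) refl i k)
              (cong₂ (λ a b → ℤ.- a ℤ.- b) ik≡0 k≡0)
  in nonzero (i≡0 ,
    trans (ℤ-solve 3 (λ i j k → j ⊜ i ⊞ j ⊞ k ⊟ i ⊟ k) refl i j k)
      (cong₂ ℤ._-_ (cong₂ ℤ._-_ ijk≡0 i≡0) k≡0) , k≡0)
  where open ℤ-Solver

index-cong : ∀ {i j k i′ j′ k′} .{n n′} → i ≡ i′ → j ≡ j′ → k ≡ k′ →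
  index i j k n ≡ index i′ j′ k′ n′
index-cong refl refl refl = refl

σ³ : ∀ p → σ (σ (σ p)) ≡ p
σ³ (index i j k _) = index-cong
  (ℤ-solve 3 (λ i j k → ⊝ (k ⊞ ⊝ (i ⊞ k)) ⊜ i) refl i j k)
  (ℤ-solve 3 (λ i j k → ⊝ (i ⊞ k) ⊞ (k ⊞ (i ⊞ j ⊞ k) ⊞ ⊝ (i ⊞ k)) ⊞ ⊝ (k ⊞ ⊝ (i ⊞ k)) ⊜ j) refl i j k)
  (ℤ-solve 3 (λ i j k → ⊝ (⊝ (i ⊞ k) ⊞ ⊝ (k ⊞ ⊝ (i ⊞ k))) ⊜ k) refl i j k)
  where open ℤ-Solver

fromℤ-neg : ∀ z → fromℤ (ℤ.- z) ≃ - fromℤ z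
fromℤ-neg z = modulo
  (≃-trans (≃-sym (fromℤ-+ z (ℤ.- z))) (≃-pointwise {y = 0ℝ} λ _ → cong ℚ-Lemmas.fromℤ (ℤ.+-inverseʳ z)))
  (solve 2 (λ z n → n := :- z :+ con 1ℚ :* (z :+ n :- con 0ℚ)) ≃-refl (fromℤ z) (fromℤ (ℤ.- z)))

square-cong : ∀ {x y} → x ≃ y → x ^ 2 ≃ y * y
square-cong {x} {y} h = ≃-trans (*-cong h (*-cong h ≃-refl))
  (solve 1 (λ y → y :* (y :* con 1ℚ) := y :* y) ≃-refl y)

orbitSum : (Index → ℝ) → Index → ℝ
orbitSum a p = a p + a (σ p) + a (σ (σ p))

-- `X²` is P², and its values at σ p and σ (σ p) are Q² and R². This is the diagonal shape of the
-- form at ½.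
norm-orbit : ∀ p → 2ℝ * (½ᴿ * X² p + Y² p + Z² p) ≃ orbitSum X² p
norm-orbit (index i j k _) = ≃-trans
  (*-cong ≃-refl (+-cong (+-cong (*-cong ≃-refl (square-cong (fromℤ-+ i j))) (square-cong (fromℤ-+ j k)))
    (square-cong (fromℤ-+ i k))))
  (≃-trans (solve 3 (λ i j k →
      con (+ 2 ℚ./ 1) :* (con ½ :* ((i :+ j) :* (i :+ j)) :+ (j :+ k) :* (j :+ k) :+ (i :+ k) :* (i :+ k))
      := (i :+ j) :* (i :+ j) :+ (k :+ (i :+ j :+ k)) :* (k :+ (i :+ j :+ k))
         :+ (:- (i :+ k) :+ (k :+ (i :+ j :+ k) :+ :- (i :+ k)))
            :* (:- (i :+ k) :+ (k :+ (i :+ j :+ k) :+ :- (i :+ k)))) ≃-refl I J K)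
    (≃-sym (+-cong (+-cong (square-cong (fromℤ-+ i j)) (square-cong Q≃)) (square-cong
      (≃-trans (fromℤ-+ (ℤ.- (i ℤ.+ k)) (k ℤ.+ (i ℤ.+ j ℤ.+ k) ℤ.+ ℤ.- (i ℤ.+ k))) (+-cong neg≃
        (≃-trans (fromℤ-+ (k ℤ.+ (i ℤ.+ j ℤ.+ k)) (ℤ.- (i ℤ.+ k))) (+-cong Q≃ neg≃))))))))
  where
  I J K : ℝ
  I = fromℤ i
  J = fromℤ j
  K = fromℤ k
  neg≃ : fromℤ (ℤ.- (i ℤ.+ k)) ≃ - (I + K)
  neg≃ = ≃-trans (fromℤ-neg (i ℤ.+ k)) (-‿cong (fromℤ-+ i k))
  Q≃ : fromℤ (k ℤ.+ (i ℤ.+ j ℤ.+ k)) ≃ K + (I + J + K)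
  Q≃ = ≃-trans (fromℤ-+ k (i ℤ.+ j ℤ.+ k)) (+-cong ≃-refl
    (≃-trans (fromℤ-+ (i ℤ.+ j) k) (+-cong (fromℤ-+ i j) ≃-refl)))

orbitSum-σ : ∀ a p → orbitSum a (σ p) ≃ orbitSum a p
orbitSum-σ a p = ≃-trans
  (+-cong ≃-refl (≃-pointwise λ n → cong (λ q → seq (a q) n) (σ³ p)))
  (solve 3 (λ x y z → x :+ y :+ z := z :+ x :+ y) ≃-refl (a (σ p)) (a (σ (σ p))) (a p))

½∈ : [⅓,1] ½ᴿ
½∈ = ⟨⅓,1⟩⊆[⅓,1] ½∈⟨⅓,1⟩

r-norm : ∀ p → orbitSum X² p * At.r ½∈ p ≃ 2ℝ
r-norm p = modulo (At.r-inverse ½∈ p) (modulo (norm-orbit p) (solve 3 (λ n d r →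
  n :* r := con (+ 2 ℚ./ 1)
    :+ con (+ 2 ℚ./ 1) :* (d :* r :- con 1ℚ)
    :+ (:- r) :* (con (+ 2 ℚ./ 1) :* d :- n))
  ≃-refl (orbitSum X² p) (½ᴿ * X² p + Y² p + Z² p) (At.r ½∈ p)))

-- By `r-norm` the reciprocal of the form is determined by the orbit sum of `X²`, which is invariant
-- because σ³ is the identity.
r-σ : ∀ p → At.r ½∈ (σ p) ≃ At.r ½∈ p
r-σ p = modulo (r-norm p) (modulo (r-norm (σ p)) (modulo (orbitSum-σ X² p) (solve 4 (λ n n′ r r′ →
  r′ := r :+ con ½ :* (:- r′) :* (n :* r :- con (+ 2 ℚ./ 1))
    :+ con ½ :* r :* (n′ :* r′ :- con (+ 2 ℚ./ 1))
    :+ (:- (con ½ :* r :* r′)) :* (n′ :- n))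
  ≃-refl (orbitSum X² p) (orbitSum X² (σ p)) (At.r ½∈ p) (At.r ½∈ (σ p)))))

q-σ : ∀ p → At.q ½∈ (σ p) ≃ At.q ½∈ p
q-σ p = *-cong ≃-refl (r-σ p)

c-½ : ∀ p → At.c ½∈ p ≃ fromℚ (+ 2 ℚ./ 3)
c-½ p = modulo (At.c-inverse ½∈ p) (solve 1 (λ c →
  c := con (+ 2 ℚ./ 3) :+ con (+ 2 ℚ./ 3) :* ((con ½ :+ con 1ℚ) :* c :- con 1ℚ)) ≃-refl (At.c ½∈ p))

-- The two derivatives at ½

module Symmetric (s : ℝ) (g : ℚ) (0<g : 0ℚ ℚ.< g) (3/2+g≤s : fromℚ (+ 3 ℚ./ 2) + fromℚ g ≤ s) where

  open LatticeSum s g 0<g 3/2+g≤s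

  f½ h½ h′½ : Index → ℝ
  f½ = f ½ᴿ ½∈
  h½ = h ½ᴿ ½∈
  h′½ = h′ ½ᴿ ½∈

  f-σ : ∀ p → f½ (σ p) ≃ f½ p
  f-σ p = power-cong {At.q ½∈ (σ p)} {At.q ½∈ p} s (q-σ p) (At.0<q ½∈ (σ p)) (At.0<q ½∈ p)

  w-σ : ∀ p → At.w ½∈ (σ p) ≃ X² (σ p) * At.r ½∈ p
  w-σ p = *-cong ≃-refl (r-σ p)

  w-σσ : ∀ p → At.w ½∈ (σ (σ p)) ≃ X² (σ (σ p)) * At.r ½∈ p
  w-σσ p = *-cong ≃-refl (≃-trans (r-σ (σ p)) (r-σ p))

  term-σ : ∀ p q {w} (G : ℝ → ℝ → ℝ) → (∀ {c c′ w w′} → c ≃ c′ → w ≃ w′ → G c w ≃ G c′ w′) →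
    f½ q ≃ f½ p → At.w ½∈ q ≃ w →
    f½ q * G (At.c ½∈ q) (At.w ½∈ q) ≃ f½ p * G (fromℚ (+ 2 ℚ./ 3)) w
  term-σ p q G G-cong f≃ w≃ = *-cong f≃ (G-cong (c-½ q) w≃)

  orbit : ∀ p (G : ℝ → ℝ → ℝ) → (∀ {c c′ w w′} → c ≃ c′ → w ≃ w′ → G c w ≃ G c′ w′) →
    let c = fromℚ (+ 2 ℚ./ 3)
        r = At.r ½∈ p
    in orbitSum (λ q → f½ q * G (At.c ½∈ q) (At.w ½∈ q)) p ≃
       f½ p * G c (X² p * r) + f½ p * G c (X² (σ p) * r) + f½ p * G c (X² (σ (σ p)) * r)
  orbit p G G-cong = +-cong (+-cong
    (term-σ p p G G-cong ≃-refl ≃-refl)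
    (term-σ p (σ p) G G-cong (f-σ p) (w-σ p)))
    (term-σ p (σ (σ p)) G G-cong (≃-trans (f-σ (σ p)) (f-σ p)) (w-σσ p))

  -- Over an orbit f and r are constant and the three values of w add up to 2 by `r-norm`, which is
  -- 3 c for c = 2/3.
  first-orbit : ∀ p → orbitSum (λ q → f½ q * h½ q) p ≃ 0ℝ
  first-orbit p = ≃-trans
    (orbit p (λ c w → s * (c - w)) (λ c≃ w≃ → *-cong ≃-refl (+-cong c≃ (-‿cong w≃))))
    (modulo (r-norm p) (solve 6 (λ s f x y z r →
      let c = con (+ 2 ℚ./ 3) in
      f :* (s :* (c :- x :* r)) :+ f :* (s :* (c :- y :* r)) :+ f :* (s :* (c :- z :* r))
      := con 0ℚ :+ (:- (f :* s)) :* ((x :+ y :+ z) :* r :- con (+ 2 ℚ./ 1)))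
      ≃-refl s (f½ p) (X² p) (X² (σ p)) (X² (σ (σ p))) (At.r ½∈ p)))

  -- By Lagrange's identity 3 Σ x² - (Σ x)² is a sum of squares.
  variance : Index → ℝ
  variance p = (x - y) * (x - y) + (y - z) * (y - z) + (x - z) * (x - z)
    where
    x y z : ℝ
    x = X² p
    y = X² (σ p)
    z = X² (σ (σ p))

  -- Since c = 2/3 is the mean of the three values of w, Σ (w² - c²) = Σ (w - c)². So the terms s²
  -- (c - w)² and s (w² - c²) combine to (s² + s) Σ (w - c)², and Σ (w - c)² is a third of
  -- `variance p` times r².
  second-orbit : ∀ p → orbitSum (λ q → f½ q * h′½ q) p ≃
    f½ p * ((s * s + s) * (fromℚ (+ 1 ℚ./ 3) * (variance p * (At.r ½∈ p * At.r ½∈ p))))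
  second-orbit p = ≃-trans
    (orbit p (λ c w → s * (c - w) * (s * (c - w)) + s * (w * w - c * c)) (λ c≃ w≃ →
      let h≃ = *-cong ≃-refl (+-cong c≃ (-‿cong w≃)) in
      +-cong (*-cong h≃ h≃) (*-cong ≃-refl (+-cong (*-cong w≃ w≃) (-‿cong (*-cong c≃ c≃))))))
    (modulo (r-norm p) (solve 6 (λ s f x y z r →
      let c = con (+ 2 ℚ./ 3)
          t = con (+ 1 ℚ./ 3)
          e = λ x → s :* (c :- x :* r) :* (s :* (c :- x :* r)) :+ s :* (x :* r :* (x :* r) :- c :* c)
          n = (x :+ y :+ z) :* r
      in f :* e x :+ f :* e y :+ f :* e z
         := f :* ((s :* s :+ s) :* (t :* (((x :- y) :* (x :- y) :+ (y :- z) :* (y :- z)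
              :+ (x :- z) :* (x :- z)) :* (r :* r))))
            :+ f :* ((s :* s :+ s) :* t :* (n :+ con (+ 2 ℚ./ 1)) :- s :* s :* con (+ 4 ℚ./ 3))
               :* (n :- con (+ 2 ℚ./ 1)))
      ≃-refl s (f½ p) (X² p) (X² (σ p)) (X² (σ (σ p))) (At.r ½∈ p)))

  -- The balls are not invariant under σ, but unconditional sums may be reindexed, so each of the
  -- three rearranged families has the sum l along the same balls.
  orbit-⟶ : ∀ {a l} → HasSum a l → ballSum (orbitSum a) ⟶ l + l + l
  orbit-⟶ {a} {l} ha = ⟶-cong
    (λ n → ≃-sym (≃-trans (sumOver-+ (λ p → a p + a (σ p)) (λ p → a (σ (σ p))) (ball n))
      (+-cong (sumOver-+ a (λ p → a (σ p)) (ball n)) ≃-refl)))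
    ≃-refl
    (⟶-+ (⟶-+ (HasSum⇒⟶ ha) (HasSum⇒⟶ haσ)) (HasSum⇒⟶ (reindex haσ)))
    where
    reindex : ∀ {b} → HasSum b l → HasSum (λ p → b (σ p)) l
    reindex = HasSum-reindex σ (λ p → σ (σ p)) σ³ σ³
    haσ : HasSum (λ p → a (σ p)) l
    haσ = reindex ha

  L′½≃0 : L′ ½ᴿ ½∈ ≃ 0ℝ
  L′½≃0 = ≃-trans
    (solve 1 (λ l → l := con (+ 1 ℚ./ 3) :* (l :+ l :+ l)) ≃-refl (L′ ½ᴿ ½∈))
    (≃-trans (*-cong (≃-refl {fromℚ (+ 1 ℚ./ 3)}) (⟶-unique (orbit-⟶ (proj₂ (L′-summable ½ᴿ ½∈)))
        (⟶-≃ λ n → vanish (ball n))))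
      (solve 0 (con (+ 1 ℚ./ 3) :* con 0ℚ := con 0ℚ) ≃-refl))
    where
    vanish : ∀ F → sumOver (orbitSum (λ q → f½ q * h½ q)) F ≃ 0ℝ
    vanish []      = ≃-refl
    vanish (p ∷ F) = ≃-trans (+-cong (first-orbit p) (vanish F)) (solve 0 (con 0ℚ :+ con 0ℚ := con 0ℚ) ≃-refl)

  0<s : 0ℝ < s
  0<s = fromℚ≤⇒0< {+ 3 ℚ./ 2} (from-yes (0ℚ ℚ.<? + 3 ℚ./ 2))
    (≤-trans (≤-by (fromℚ-mono {0ℚ} {g} (ℚ.<⇒≤ 0<g)) ≃-refl) 3/2+g≤s)

  0<s²+s : 0ℝ < s * s + s
  0<s²+s = <-≤-trans 0<s (≤-by (0≤x*x s) (solve 1 (λ s → s :* s :+ s := s :+ s :* s) ≃-refl s))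

  0<1/3 : 0ℝ < fromℚ (+ 1 ℚ./ 3)
  0<1/3 = 0<fromℚ (from-yes (0ℚ ℚ.<? + 1 ℚ./ 3))

  second-orbit-nonneg : ∀ p → 0ℝ ≤ orbitSum (λ q → f½ q * h′½ q) p
  second-orbit-nonneg p = ≤-respʳ (≃-sym (second-orbit p))
    (0≤* (0≤f ½ᴿ ½∈ p) (0≤* (<⇒≤ 0<s²+s) (0≤* (<⇒≤ 0<1/3)
      (0≤* (0≤+ (0≤+ (0≤x*x _) (0≤x*x _)) (0≤x*x _)) (0≤x*x (At.r ½∈ p))))))

  -- The point P = 2, Q = R = 0.
  p₀ : Index
  p₀ = index 1ℤ 1ℤ ℤ.-1ℤ λ ()

  second-orbit-pos : 0ℝ < orbitSum (λ q → f½ q * h′½ q) p₀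
  second-orbit-pos = <-≤-trans
    (*-pos (power-pos (At.q ½∈ p₀) (At.0<q ½∈ p₀) s) (*-pos 0<s²+s (*-pos 0<1/3 (*-pos
      -- On this orbit `X²` takes the values 4, 0, 0, so the variance is 16 + 0 + 16.
      (fromℚ≤⇒0< {+ 32 ℚ./ 1} (from-yes (0ℚ ℚ.<? + 32 ℚ./ 1)) (≤-pointwise λ _ → ℚ.≤-refl))
      (*-pos 0<r₀ 0<r₀)))))
    (≤-reflexive (≃-sym (second-orbit p₀)))
    where
    0<r₀ = recip-pos (form-pos (proj₁ ½∈) p₀)

  -- Strict inequalities do not pass to limits. As all orbit sums are nonnegative, every ball
  -- containing `p₀` has an orbit total of at least the one positive orbit sum at `p₀`, and this
  -- fixed bound persists for 3 L″.
  0<L″½ : 0ℝ < L″ ½ᴿ ½∈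
  0<L″½ = <-≤-trans (*-pos 0<1/3 second-orbit-pos) (≤-respʳ
    (solve 1 (λ l → con (+ 1 ℚ./ 3) :* (l :+ l :+ l) := l) ≃-refl (L″ ½ᴿ ½∈))
    (*-monoˡ-≤ (<⇒≤ 0<1/3) (⟶-≤ above (⟶-≃ λ _ → ≃-refl) (orbit-⟶ (proj₂ (L″-summable ½ᴿ ½∈))))))
    where
    above = let m , p₀∈ = ball-exhaust p₀ in m , λ n m≤n →
      ∈⇒≤sumOver second-orbit-nonneg (ball-mono m≤n p₀∈)

theorem3p1 : (s : ℝ) → fromℚ (+ 3 ℚ./ 2) < s →
    Σ[ L ∈ ((A : ℝ) → [⅓,1] A → ℝ) ]
    Σ[ L′ ∈ ((A : ℝ) → ⟨⅓,1⟩ A → ℝ) ]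
    Σ[ L″ ∈ ℝ ]
    IsLatticeSum s L ×
    ((A : ℝ) (A∈ : ⟨⅓,1⟩ A) → HasDerivative L A (⟨⅓,1⟩⊆[⅓,1] A∈) (L′ A A∈)) ×
    HasDerivative L′ ½ᴿ ½∈⟨⅓,1⟩ L″ ×
    L′ ½ᴿ ½∈⟨⅓,1⟩ ≃ 0ℝ ×
    0ℝ < L″
-- The proof of 3/2 < s contains a rational gap g, which fixes the ratio 1 / (1 + g) of the
-- dominating geometric series.
theorem3p1 s (mk< g 0<g 3/2+g≤s) =
  L , (λ A A∈ → L′ A (⟨⅓,1⟩⊆[⅓,1] A∈)) , L″ ½ᴿ ½∈ ,
  (λ A A∈ → HasSum-cong
    (λ p → ≃-pointwise λ n → cong (λ t → seq t n) (sym (term-power s A A∈ p)))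
    (proj₂ (L-summable A A∈))) ,
  (λ A A∈ → derivative A (⟨⅓,1⟩⊆[⅓,1] A∈)) ,
  second-derivative ½ᴿ ½∈⟨⅓,1⟩ ,
  Symmetric.L′½≃0 s g 0<g (≤-eventually 3/2+g≤s) ,
  Symmetric.0<L″½ s g 0<g (≤-eventually 3/2+g≤s)
  where open LatticeSum s g 0<g (≤-eventually 3/2+g≤s)
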